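{- Let $H$ be a homogeneous relation on a finite set $X$ such that the family $\mathcal{U}_H$ of umodules of $H$ is self-complemented. Then there is a unique tree of size $O(|X|)$ (the umodular decomposition tree of $H$, an unrooted tree) that describes all umodules of $H$. That is, with $\mathcal{B}=\{\{U,X\setminus U\}: U\in\mathcal{U}_H,\ \emptyset\neq U\neq X\}$, there is a unique unrooted tree $T=T(\mathcal{B})$ whose leaves are labelled bijectively by the elements of $X$ and whose edges correspond bijectively to the strong bipartitions of $\mathcal{B}$ (the leaf labels of the two components of $T-e$ being the two parts of the bipartition corresponding to the edge $e$); $T$ has size $O(|X|)$; and the internal nodes of $T$ can be labelled complete, circular or prime, with the neighbouring subtrees of each circular node ordered, in such a way that $\mathcal{B}$ consists exactly of the following bipartitions: - for each complete node $N$ of degree $k$, all $B_N(I)$ with $I\subseteq\{1,\dots,k\}$, $1\le|I|<k$; - for each circular node $N$ of degree $k$, all $B_N(I)$ with $I$ an interval of $\{1,\dots,k\}$, $1\le|I|<k$; - for each prime node $N$ of degree $k$, all $B_N(\{a\})$ with $a\in\{1,\dots,k\}$.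
   Context: Let $X$ be a finite set. A reflectless triple is $(x|yz)$ with $x,y,z\in X$, $x\neq y$, $x\neq z$. A homogeneous relation $H$ on $X$ is a boolean relation on reflectless triples such that for every $x\in X$ the binary relation $H_x$ on $X\setminus\{x\}$ given by $H_x(y,z)\Leftrightarrow H(x|yz)$ is an equivalence relation. A subset $U\subseteq X$ is a umodule of $H$ if for all $u,u'\in U$ and all $x,x'\in X\setminus U$: $H(u|xx')\Leftrightarrow H(u'|xx')$. The family of umodules is $\mathcal{U}_H$. A family $\mathcal{F}$ of subsets of $X$ is self-complemented if $A\in\mathcal{F}$ implies $X\setminus A\in\mathcal{F}$. A bipartition of $X$ is a partition into two nonempty parts. Two bipartitions $\{A^1,A^2\}$ and $\{B^1,B^2\}$ overlap if all four intersections $A^i\cap B^j$ are nonempty. A bipartition of $\mathcal{B}$ is strong if it overlaps no other bipartition of $\mathcal{B}$. For an internal node $N$ of degree $k$ of a tree $T$ with leaves labelled by $X$, the leaf labels of the $k$ components of $T-N$ form a partition $X_1,\dots,X_k$ of $X$ (indexed according to the chosen order if $N$ is circular), and for $I\subseteq\{1,\dots,k\}$ with $1\le |I|<k$ we put $B_N(I)=\{\bigcup_{i\in I}X_i,\ X\setminus\bigcup_{i\in I}X_i\}$. The statement is understood for $|X|\ge 3$ (so that internal nodes exist). -}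

module Defs where

open import Data.Bool.Base using (Bool; T)
open import Data.Bool.Properties using (not-involutive)
open import Data.Fin.Base using (Fin; _≤_)
open import Data.Fin.Properties using (_<?_)
open import Data.Fin.Subset using (Subset; _∈_; _∉_; _∩_; ∁; Nonempty; ⁅_⁆; ∣_∣)
open import Data.Irrelevant using ([_])
open import Data.List.Base using (List; _∷_; _∷ʳ_; allFin; cartesianProduct; filter; length; lookup)
open import Data.List.Relation.Binary.Permutation.Propositional using (_↭_)
open import Data.List.Relation.Unary.Linked using (Linked)
open import Data.List.Relation.Unary.Unique.Propositional using (Unique)
import Data.Nat.Base as ℕ
open import Data.Nat.Base using (ℕ)
open import Data.Product using (Σ; ∃; ∃₂; _×_; _,_; proj₁; proj₂)
open import Data.Refinement.Base using (Refinement; Refinement-syntax; _,_; value)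
open import Data.Sum.Base using (_⊎_; inj₁; inj₂)
open import Data.Unit.Base using (⊤)
open import Data.Vec.Properties using (map-∘; map-cong; map-id)
open import Function.Bundles using (_⇔_; _↔_; Inverse; Bijection)
open import Function.Definitions using (Injective)
open import Level using (0ℓ)
open import Relation.Binary.Bundles using (Setoid)
open import Relation.Binary.Core using (Rel)
open import Relation.Binary.Construct.Closure.ReflexiveTransitive using (Star)
open import Relation.Binary.Definitions using (Symmetric; Irreflexive; Decidable)
open import Relation.Binary.PropositionalEquality
  using (_≡_; _≢_; refl; sym; trans; cong; subst)
open import Relation.Binary.Structures using (IsEquivalence)
open import Relation.Nullary.Decidable using (_×-dec_)
open import Relation.Nullary.Negation using (¬_)
open import Relation.Unary using (Pred)

private
  variable
    n : ℕ

-- The ground set X is Fin n throughout.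

-- X ∖ {x}.  A reflectless triple (x|yz) is an x together with two elements
-- of Others x; the proofs of x ≢ y are irrelevant, so relations on triples
-- cannot depend on them.
Others : Fin n → Set
Others {n} x = [ y ∈ Fin n ∣ x ≢ y ]

record HomogeneousRelation (n : ℕ) : Set where
  field
    holds         : (x : Fin n) → Others x → Others x → Bool
    isEquivalence : ∀ x → IsEquivalence (λ y z → T (holds x y z))

∈∉⇒≢ : {U : Subset n} {u x : Fin n} → u ∈ U → x ∉ U → u ≢ x
∈∉⇒≢ {U = U} u∈U x∉U u≡x = x∉U (subst (_∈ U) u≡x u∈U)

Umodule : HomogeneousRelation n → Pred (Subset n) 0ℓ
Umodule {n} H U =
  (u u′ x x′ : Fin n) (u∈ : u ∈ U) (u′∈ : u′ ∈ U) (x∉ : x ∉ U) (x′∉ : x′ ∉ U) →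
  T (holds u  (x , [ ∈∉⇒≢ u∈  x∉ ]) (x′ , [ ∈∉⇒≢ u∈  x′∉ ])) ⇔
  T (holds u′ (x , [ ∈∉⇒≢ u′∈ x∉ ]) (x′ , [ ∈∉⇒≢ u′∈ x′∉ ]))
  where open HomogeneousRelation H

SelfComplemented : Pred (Subset n) 0ℓ → Set
SelfComplemented F = ∀ A → F A → F (∁ A)

-- The bipartition {part, ∁ part}; it is unordered, hence considered up to _≈_.
record Bipartition (n : ℕ) : Set where
  field
    part           : Subset n
    part-nonempty  : Nonempty part
    ∁part-nonempty : Nonempty (∁ part)

open Bipartition

infix 4 _≈_

_≈_ : Rel (Bipartition n) 0ℓ
b ≈ c = part b ≡ part c ⊎ part b ≡ ∁ (part c)

∁-involutive : (A : Subset n) → ∁ (∁ A) ≡ A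
∁-involutive A =
  trans (sym (map-∘ _ _ A)) (trans (map-cong not-involutive A) (map-id A))

≈-isEquivalence : IsEquivalence (_≈_ {n})
≈-isEquivalence = record
  { refl  = inj₁ refl
  ; sym   = λ where
      (inj₁ p) → inj₁ (sym p)
      (inj₂ p) → inj₂ (flip∁ p)
  ; trans = λ where
      (inj₁ p) (inj₁ q) → inj₁ (trans p q)
      (inj₁ p) (inj₂ q) → inj₂ (trans p q)
      (inj₂ p) (inj₁ q) → inj₂ (trans p (cong ∁ q))
      (inj₂ p) (inj₂ q) → inj₁ (trans p (trans (cong ∁ q) (∁-involutive _)))
  }
  where
  flip∁ : {A B : Subset n} → A ≡ ∁ B → B ≡ ∁ A
  flip∁ p = trans (sym (∁-involutive _)) (cong ∁ (sym p))

bipartitions : Pred (Subset n) 0ℓ → Pred (Bipartition n) 0ℓ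
bipartitions F b = ∃ λ c → F (part c) × b ≈ c

Overlap : Rel (Bipartition n) 0ℓ
Overlap b c =
  Nonempty (part b ∩ part c)     × Nonempty (part b ∩ ∁ (part c)) ×
  Nonempty (∁ (part b) ∩ part c) × Nonempty (∁ (part b) ∩ ∁ (part c))

Strong : Pred (Bipartition n) 0ℓ → Pred (Bipartition n) 0ℓ
Strong 𝓑 b = 𝓑 b × (∀ c → 𝓑 c → ¬ Overlap b c)

strongBipartitions : Pred (Bipartition n) 0ℓ → Setoid 0ℓ 0ℓ
strongBipartitions 𝓑 = record
  { Carrier       = ∃ (Strong 𝓑)
  ; _≈_           = λ b c → proj₁ b ≈ proj₁ c
  ; isEquivalence = record
    { refl  = λ {b} → E.refl {proj₁ b}
    ; sym   = λ {b} {c} → E.sym {proj₁ b} {proj₁ c}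
    ; trans = λ {b} {c} {d} → E.trans {proj₁ b} {proj₁ c} {proj₁ d}
    }
  }
  where module E = IsEquivalence ≈-isEquivalence

record Graph : Set₁ where
  infix 4 _~_ _~?_
  field
    #vertices : ℕ

  Vertex : Set
  Vertex = Fin #vertices

  field
    _~_      : Rel Vertex 0ℓ
    _~?_     : Decidable _~_
    ~-sym    : Symmetric _~_
    ~-irrefl : Irreflexive _≡_ _~_

  neighbours : Vertex → List Vertex
  neighbours v = filter (v ~?_) (allFin #vertices)

  degree : Vertex → ℕ
  degree v = length (neighbours v)

  Leaf : Pred Vertex 0ℓ
  Leaf v = degree v ≡ 1

  InternalNode : Set
  InternalNode = [ v ∈ Vertex ∣ ¬ Leaf v ]

  Connected : Set
  Connected = ∀ u v → Star _~_ u v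

  -- A cycle visits at least three distinct vertices and returns to the first.
  Acyclic : Set
  Acyclic = ∀ u v w vs → Unique (u ∷ v ∷ w ∷ vs) →
            ¬ Linked _~_ (u ∷ v ∷ w ∷ vs ∷ʳ u)

  record Edge : Set where
    field
      source target : Vertex
      adjacent      : source ~ target

  open Edge

  -- Edges are undirected.
  SameEdge : Rel Edge 0ℓ
  SameEdge e f = (source e ≡ source f × target e ≡ target f)
               ⊎ (source e ≡ target f × target e ≡ source f)

  edges : Setoid 0ℓ 0ℓ
  edges = record
    { Carrier       = Edge
    ; _≈_           = SameEdge
    ; isEquivalence = record
      { refl  = inj₁ (refl , refl)
      ; sym   = λ where
          (inj₁ (p , q)) → inj₁ (sym p , sym q)
          (inj₂ (p , q)) → inj₂ (sym q , sym p)
      ; trans = λ where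
          (inj₁ (p , q)) (inj₁ (r , s)) → inj₁ (trans p r , trans q s)
          (inj₁ (p , q)) (inj₂ (r , s)) → inj₂ (trans p r , trans q s)
          (inj₂ (p , q)) (inj₁ (r , s)) → inj₂ (trans p s , trans q r)
          (inj₂ (p , q)) (inj₂ (r , s)) → inj₁ (trans p s , trans q r)
      }
    }

  -- Each edge is counted once, as a pair u < v.
  #edges : ℕ
  #edges = length (filter (λ (u , v) → (u <? v) ×-dec (u ~? v))
                          (cartesianProduct (allFin #vertices) (allFin #vertices)))

  size : ℕ
  size = #vertices ℕ.+ #edges

  _-edge_ : Edge → Rel Vertex 0ℓ
  _-edge_ e u v = Σ (u ~ v) λ u~v →
    ¬ SameEdge (record { source = u; target = v; adjacent = u~v }) e

  _-node_ : Vertex → Rel Vertex 0ℓ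
  _-node_ N u v = u ~ v × u ≢ N × v ≢ N

record LabelledTree (n : ℕ) : Set₁ where
  field
    graph : Graph

  open Graph graph public

  field
    connected      : Connected
    acyclic        : Acyclic
    leaf           : Fin n → Vertex
    leaf-injective : Injective _≡_ _≡_ leaf
    leaf-image     : ∀ v → Leaf v ⇔ (∃ λ x → leaf x ≡ v)

  -- A is the set of leaf labels of the component of v, where R is the
  -- adjacency of the tree after a deletion.
  ComponentLabels : Rel Vertex 0ℓ → Vertex → Subset n → Set
  ComponentLabels R v A = ∀ x → x ∈ A ⇔ Star R v (leaf x)

  Induces : Edge → Bipartition n → Set
  Induces e b =
      (Labels (source e) (part b)     × Labels (target e) (∁ (part b)))
    ⊎ (Labels (source e) (∁ (part b)) × Labels (target e) (part b))
    where
    open Edge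
    Labels = ComponentLabels (_-edge_ e)

EdgesAreStrong : LabelledTree n → Pred (Bipartition n) 0ℓ → Set
EdgesAreStrong t 𝓑 =
  Σ (Bijection edges (strongBipartitions 𝓑)) λ f →
    ∀ e → Induces e (proj₁ (Bijection.to f e))
  where open LabelledTree t

-- Isomorphism of trees respecting the leaf labels.
record _≅_ (s t : LabelledTree n) : Set where
  private
    module S = LabelledTree s
    module T = LabelledTree t
  field
    vertices : S.Vertex ↔ T.Vertex
  open Inverse vertices using (to)
  field
    adjacency : ∀ u v → (u S.~ v) ⇔ (to u T.~ to v)
    leaves    : ∀ x → to (S.leaf x) ≡ T.leaf x

data Kind : Set where
  complete circular prime : Kind

Interval : {k : ℕ} → Subset k → Set
Interval {k} I = ∃₂ λ (a b : Fin k) → ∀ i → i ∈ I ⇔ (a ≤ i × i ≤ b)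

Admissible : {k : ℕ} → Kind → Subset k → Set
Admissible complete I = ⊤
Admissible circular I = Interval I
Admissible prime    I = ∃ λ a → I ≡ ⁅ a ⁆

module _ (t : LabelledTree n) where
  open LabelledTree t

  -- The order fixes the indexing of the components of t - N by their
  -- neighbours of N; which order is chosen matters only for circular nodes.
  record NodeLabelling : Set where
    field
      kind    : InternalNode → Kind
      order   : InternalNode → List Vertex
      order-↭ : ∀ N → order N ↭ neighbours (value N)

  module _ (L : NodeLabelling) where
    open NodeLabelling L

    InComponent : (N : InternalNode) → Fin (length (order N)) → Fin n → Set
    InComponent N i x = Star (_-node_ (value N)) (lookup (order N) i) (leaf x)

    InUnion : (N : InternalNode) → Subset (length (order N)) → Fin n → Set
    InUnion N I x = ∃ λ i → i ∈ I × InComponent N i x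

    -- b is B_N(I); as b consists of complementary parts, it suffices that
    -- one of them is the union of the components indexed by I.
    IsB : (N : InternalNode) → Subset (length (order N)) → Bipartition n → Set
    IsB N I b = (∀ x → x ∈ part b ⇔ InUnion N I x)
              ⊎ (∀ x → x ∈ ∁ (part b) ⇔ InUnion N I x)

    Described : Pred (Bipartition n) 0ℓ
    Described b = ∃₂ λ N I →
      1 ℕ.≤ ∣ I ∣ × ∣ I ∣ ℕ.< length (order N) × Admissible (kind N) I × IsB N I b

{-# OPTIONS --safe #-}

-- Fix a point r and represent every bipartition by its part avoiding r.  Umodules
-- that meet have a umodule as union, so self-complementation makes the umodules
-- avoiding r closed under union, intersection and difference of overlapping
-- members.  The strong ones form a laminar family; ordered by covering, with X on
-- top as the leaf r, it is the tree, each strong member being the lower end of its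
-- edge.  A tree whose edges are the strong bipartitions is determined by the
-- clusters below its vertices: an adjacency is a covering pair of clusters.
--
-- At an internal node the unions of children that are umodules form such a closed
-- family in which every nontrivial member is overlapped by another.  Join two
-- children when their union is a member.  If there is a nontrivial member, this
-- graph is connected; a vertex of degree three makes it complete, and then all
-- unions are members; otherwise it is a path, and the members are its segments.

module Submission where

open import Defs
open import Data.Nat.Base using (ℕ; _≤_; _*_)
open import Data.Product using (Σ; ∃; _×_)
open import Function.Bundles using (_⇔_)

import Data.Bool.Properties as Bool
open import Data.Bool.Base using (true; false)
open import Data.Empty using (⊥; ⊥-elim; ⊥-elim-irr)
open import Data.Fin.Base as Fin using (Fin; zero; suc; toℕ; fromℕ<; join)
import Data.Fin.Properties as Fin
open import Data.Fin.Properties using (any?; all?; _≟_; injective⇒≤; toℕ<n; toℕ-fromℕ<)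
import Data.Fin.Subset as Subset
open import Data.Fin.Subset
  using (Subset; _∈_; _∉_; _∩_; _∪_; ∁; Nonempty; ⁅_⁆; _⊆_; _⊈_; _⊂_; ⊤; ∣_∣)
open import Data.Fin.Subset.Induction using (⊂-wellFounded; ⊃-wellFounded; Acc; acc)
open import Data.Fin.Subset.Properties
open import Data.Irrelevant using ([_])
open import Data.List.Base
  using (List; []; _∷_; _++_; _∷ʳ_; length; lookup; map; filter; allFin; cartesianProduct; take; drop; initLast; _∷ʳ′_)
import Data.List.Membership.DecPropositional as DecMembership
open import Data.List.Membership.Propositional using () renaming (_∈_ to _∈ₗ_; _∉_ to _∉ₗ_)
open import Data.List.Membership.Propositional.Properties
  using (∈-∃++; ∈-++⁺ʳ; ∈-++⁺ˡ; ∈-++⁻; ∈-map⁺; ∈-map⁻; ∈-filter⁺; ∈-filter⁻; ∈-allFin; ∈-lookup)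
open import Data.List.Membership.Propositional.Properties.WithK using (unique∧set⇒bag)
open import Data.List.Properties using (++-assoc; length-++; take++drop≡id)
open import Data.List.Relation.Binary.BagAndSetEquality using (∼bag⇒↭)
open import Data.List.Relation.Binary.Permutation.Propositional using (_↭_; ↭-refl)
open import Data.List.Relation.Unary.All as All using (All; []; _∷_)
import Data.List.Relation.Unary.All.Properties as All
open import Data.List.Relation.Unary.AllPairs using ([]; _∷_)
open import Data.List.Relation.Unary.Any as Any using (here; there)
open import Data.List.Relation.Unary.Any.Properties using (lookup-index)
open import Data.List.Relation.Unary.Linked using (Linked; []; [-]; _∷_)
open import Data.List.Relation.Unary.Unique.Propositional using (Unique)
import Data.List.Relation.Unary.Unique.Propositional.Properties as Unique
open import Data.Nat.Base as ℕ using (_∸_; s≤s; z≤n)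
import Data.Nat.Properties as ℕ
open import Data.Product using (∃₂; _,_; proj₁; proj₂)
open import Data.Refinement.Base using (_,_; value)
open import Data.Sum.Base using (_⊎_; inj₁; inj₂; [_,_]′; swap) renaming (map to ⊎-map)
open import Data.Unit.Base using (tt) renaming (⊤ to Unit)
open import Data.Vec.Base as Vec using ([]; _∷_)
open import Data.Vec.Properties using (lookup∘tabulate; []=⇒lookup; lookup⇒[]=; ≡-dec; ∷-injectiveʳ)
open import Function.Base using (_∘_)
open import Function.Bundles using (mk⇔; mk↔ₛ′; Equivalence; Bijection)
open import Function.Definitions using (Injective)
open import Level using (0ℓ)
open import Relation.Binary.Construct.Closure.ReflexiveTransitive as Star using (Star; ε; _◅_; _◅◅_; reverse)
open import Relation.Binary.Core using (Rel)
open import Relation.Binary.PropositionalEquality using (_≡_; _≢_; refl; sym; trans; cong; subst)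
open import Relation.Nullary.Decidable
  using (Dec; yes; no; does; _×-dec_; _⊎-dec_; _→-dec_; ¬?; T?; dec-true; map′; decidable-stable)
open import Relation.Nullary.Negation using (¬_; contradiction)
open import Relation.Unary using (Pred; Decidable)

-- Rooting at `r` hides the cyclic symmetry of a circular node: its parent is not among the
-- children, so only the path obtained by cutting the cycle at the parent is visible. The parent is
-- therefore put in front of that path as position 0, and an interval through position 0 is read as
-- the complement of a segment of children. In the same way the set of all children stands for the
-- edge to the parent, also at a prime node.
--
-- Connectedness of the graph of pairs is proved by cuts. A minimal member meeting both sides of a
-- cut is shown to be a pair: if it had a third element, some member would overlap it and divide it
-- into two members, each on one side of the cut by minimality, and the one containing the third
-- element would again be overlapped, which yields a smaller member across the cut.
--
-- Membership is decidable and there are finitely many subsets, so extremal members and overlapping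
-- members are found by search.

private
  variable
    k n : ℕ
    A B C : Subset n
    X : Set
    R : Rel X 0ℓ
    xs : List X

-- Subsets of a finite set

_∈ₗ?_ : (x : Fin n) (xs : List (Fin n)) → Dec (x ∈ₗ xs)
_∈ₗ?_ = DecMembership._∈?_ _≟_

module _ {P : Pred (Fin n) 0ℓ} (P? : Decidable P) where

  abstract
    select : Subset n
    select = Vec.tabulate (does ∘ P?)

    ∈-select⁺ : ∀ {x} → P x → x ∈ select
    ∈-select⁺ {x} p =
      lookup⇒[]= x select (trans (lookup∘tabulate _ x) (dec-true (P? x) p))

    ∈-select⁻ : ∀ {x} → x ∈ select → P x
    ∈-select⁻ {x} x∈ with P? x | trans (sym (lookup∘tabulate (does ∘ P?) x)) ([]=⇒lookup x∈)
    ... | yes p | _ = p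

⊆-or-∃ : (A B : Subset n) → A ⊆ B ⊎ (∃ λ x → x ∈ A × x ∉ B)
⊆-or-∃ A B with any? (λ x → x ∈? A ×-dec ¬? (x ∈? B))
... | yes d = inj₂ d
... | no ¬d = inj₁ λ {x} x∈A → decidable-stable (x ∈? B) λ x∉B → ¬d (x , x∈A , x∉B)

⁅⁆-⊆ : ∀ {x} → x ∈ A → ⁅ x ⁆ ⊆ A
⁅⁆-⊆ {x = x} x∈A y∈x = subst (_∈ _) (sym (x∈⁅y⁆⇒x≡y x y∈x)) x∈A

⊆⇒≡⊎⊂ : A ⊆ B → A ≡ B ⊎ A ⊂ B
⊆⇒≡⊎⊂ {A = A} {B} A⊆B with ⊆-or-∃ B A
... | inj₁ B⊆A = inj₁ (⊆-antisym A⊆B B⊆A)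
... | inj₂ d   = inj₂ (A⊆B , d)

module _ {P : Pred (Subset n) 0ℓ} (P? : Decidable P) where

  abstract
    minimal : ∀ {A} → P A → ∃ λ B → P B × B ⊆ A × (∀ {C} → P C → C ⊆ B → C ≡ B)
    minimal = go (⊂-wellFounded _)
      where
      go : ∀ {A} → Acc _⊂_ A → P A → ∃ λ B → P B × B ⊆ A × (∀ {C} → P C → C ⊆ B → C ≡ B)
      go {A} (acc rs) pA with anySubset? (λ C → P? C ×-dec (C ⊂? A))
      ... | yes (C , pC , C⊂A) =
        let B , pB , B⊆C , min = go (rs C⊂A) pC in B , pB , ⊆-trans B⊆C (proj₁ C⊂A) , min
      ... | no ¬C = A , pA , (λ x → x) , λ pC C⊆A →
        [ (λ e → e) , (λ C⊂A → contradiction (_ , pC , C⊂A) ¬C) ]′ (⊆⇒≡⊎⊂ C⊆A)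

    maximal : ∀ {A} → P A → ∃ λ B → P B × A ⊆ B × (∀ {C} → P C → B ⊆ C → B ≡ C)
    maximal = go (⊃-wellFounded _)
      where
      go : ∀ {A} → Acc (λ B C → C ⊂ B) A → P A →
           ∃ λ B → P B × A ⊆ B × (∀ {C} → P C → B ⊆ C → B ≡ C)
      go {A} (acc rs) pA with anySubset? (λ C → P? C ×-dec (A ⊂? C))
      ... | yes (C , pC , A⊂C) =
        let B , pB , C⊆B , max = go (rs A⊂C) pC in B , pB , ⊆-trans (proj₁ A⊂C) C⊆B , max
      ... | no ¬C = A , pA , (λ x → x) , λ pC A⊆C →
        [ (λ e → e) , (λ A⊂C → contradiction (_ , pC , A⊂C) ¬C) ]′ (⊆⇒≡⊎⊂ A⊆C)

infix 4 _≬_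

-- Overlap of sets. For the sides of two bipartitions that avoid `r`, the fourth intersection in
-- `Overlap`, that of the complements, contains `r`, so these three conditions are what remains.
_≬_ : Subset n → Subset n → Set
A ≬ B = (∃ λ x → x ∈ A × x ∈ B) × (∃ λ x → x ∈ A × x ∉ B) × (∃ λ x → x ∈ B × x ∉ A)

_≬?_ : (A B : Subset n) → Dec (A ≬ B)
A ≬? B = any? (λ x → x ∈? A ×-dec x ∈? B)
   ×-dec any? (λ x → x ∈? A ×-dec ¬? (x ∈? B))
   ×-dec any? (λ x → x ∈? B ×-dec ¬? (x ∈? A))

¬≬⇒⊆⊎⊇ : ∀ {x} → ¬ A ≬ B → x ∈ A → x ∈ B → A ⊆ B ⊎ B ⊆ A
¬≬⇒⊆⊎⊇ {A = A} {B} ¬o x∈A x∈B with ⊆-or-∃ A B | ⊆-or-∃ B A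
... | inj₁ A⊆B | _        = inj₁ A⊆B
... | inj₂ _   | inj₁ B⊆A = inj₂ B⊆A
... | inj₂ d   | inj₂ e   = contradiction ((_ , x∈A , x∈B) , d , e) ¬o

∈∩∁⁺ : ∀ {x} → x ∈ A → x ∉ B → x ∈ A ∩ ∁ B
∈∩∁⁺ x∈A x∉B = x∈p∩q⁺ (x∈A , x∉p⇒x∈∁p x∉B)

∈∩∁⁻ : ∀ {x} → x ∈ A ∩ ∁ B → x ∈ A × x ∉ B
∈∩∁⁻ {A = A} {B} x∈ = let a , b = x∈p∩q⁻ A (∁ B) x∈ in a , x∈∁p⇒x∉p b

∪-⊆ : A ⊆ C → B ⊆ C → A ∪ B ⊆ C
∪-⊆ {A = A} {B = B} A⊆C B⊆C = [ A⊆C , B⊆C ]′ ∘ x∈p∪q⁻ A B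

-- Weakly partitive families

-- Used at two levels: for the umodules avoiding `r`, and for the sets of children of a node whose
-- union is such a umodule. Closure under symmetric difference is not among the axioms; it would
-- turn every path on three or more children into the complete case.
record WeaklyPartitive (K : Subset n) (F : Pred (Subset n) 0ℓ) : Set where
  field
    F?        : Decidable F
    F⇒⊆       : F A → A ⊆ K
    nonempty  : F A → Nonempty A
    singleton : ∀ {x} → x ∈ K → F ⁅ x ⁆
    whole     : F K
    ∪-closed  : F A → F B → A ≬ B → F (A ∪ B)
    ∩-closed  : F A → F B → A ≬ B → F (A ∩ B)
    ─-closed  : F A → F B → A ≬ B → F (A ∩ ∁ B)

  ∪-meet : ∀ {x} → F A → F B → x ∈ A → x ∈ B → F (A ∪ B)
  ∪-meet {A = A} {B} fA fB x∈A x∈B with A ≬? B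
  ... | yes o = ∪-closed fA fB o
  ... | no ¬o with ¬≬⇒⊆⊎⊇ ¬o x∈A x∈B
  ...   | inj₁ A⊆B = subst F (⊆-antisym (x∈p∪q⁺ ∘ inj₂) (∪-⊆ A⊆B (λ z → z))) fB
  ...   | inj₂ B⊆A = subst F (⊆-antisym (x∈p∪q⁺ ∘ inj₁) (∪-⊆ (λ z → z) B⊆A)) fA

-- Nontrivial sets, pairs, segments and shapes

Nontrivial : Subset n → Set
Nontrivial A = ∃₂ λ x y → x ∈ A × y ∈ A × x ≢ y

Nontrivial? : (A : Subset n) → Dec (Nontrivial A)
Nontrivial? A = any? λ x → any? λ y → x ∈? A ×-dec y ∈? A ×-dec ¬? (x ≟ y)

pair : Fin n → Fin n → Subset n
pair a b = ⁅ a ⁆ ∪ ⁅ b ⁆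

∈-pairˡ : ∀ {a b : Fin n} → a ∈ pair a b
∈-pairˡ = x∈p∪q⁺ (inj₁ (x∈⁅x⁆ _))

∈-pairʳ : ∀ {a b : Fin n} → b ∈ pair a b
∈-pairʳ = x∈p∪q⁺ (inj₂ (x∈⁅x⁆ _))

∈-pair⁻ : ∀ {a b x : Fin n} → x ∈ pair a b → x ≡ a ⊎ x ≡ b
∈-pair⁻ {a = a} {b} x∈ with x∈p∪q⁻ ⁅ a ⁆ ⁅ b ⁆ x∈
... | inj₁ x∈a = inj₁ (x∈⁅y⁆⇒x≡y a x∈a)
... | inj₂ x∈b = inj₂ (x∈⁅y⁆⇒x≡y b x∈b)

∉-pair : ∀ {a b x : Fin n} → x ≢ a → x ≢ b → x ∉ pair a b
∉-pair x≢a x≢b x∈ = [ x≢a , x≢b ]′ (∈-pair⁻ x∈)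

pair-⊆ : ∀ {a b : Fin n} → a ∈ A → b ∈ A → pair a b ⊆ A
pair-⊆ a∈A b∈A x∈ with ∈-pair⁻ x∈
... | inj₁ refl = a∈A
... | inj₂ refl = b∈A

abstract
  toSet : List (Fin n) → Subset n
  toSet xs = select (_∈ₗ? xs)

  ∈-toSet⁺ : ∀ {x} {xs : List (Fin n)} → x ∈ₗ xs → x ∈ toSet xs
  ∈-toSet⁺ = ∈-select⁺ (_∈ₗ? _)

  ∈-toSet⁻ : ∀ {x} {xs : List (Fin n)} → x ∈ toSet xs → x ∈ₗ xs
  ∈-toSet⁻ = ∈-select⁻ (_∈ₗ? _)

toSet-⊆ : ∀ {xs : List (Fin n)} → (∀ {x} → x ∈ₗ xs → x ∈ A) → toSet xs ⊆ A
toSet-⊆ h = h ∘ ∈-toSet⁻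

Segment : List (Fin n) → Subset n → Set
Segment p I = ∃ λ xs → ∃₂ λ ys zs → p ≡ xs ++ ys ++ zs × I ≡ toSet ys

-- `linear` is what the children of a circular node show. The member `K`, listed separately in
-- `prime`, comes from the edge to the parent.
data Shape (K : Subset n) (F : Pred (Subset n) 0ℓ) : Set where
  prime    : (∀ {I} → F I → (∃ λ a → I ≡ ⁅ a ⁆) ⊎ I ≡ K) → Shape K F
  complete : (∀ {I} → I ⊆ K → Nonempty I → F I) → Shape K F
  linear   : ∀ p → Unique p → (∀ v → v ∈ₗ p ⇔ v ∈ K) →
             (∀ {I} → Nonempty I → F I ⇔ Segment p I) → Shape K F

-- Lists without repetition and walks as lists

Unique-++ʳ : ∀ xs {ys : List X} → Unique (xs ++ ys) → Unique ys
Unique-++ʳ []       u       = u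
Unique-++ʳ (_ ∷ xs) (_ ∷ u) = Unique-++ʳ xs u

Unique-split-≢ : ∀ {a b} xs {ys : List X} → Unique (xs ++ ys) → a ∈ₗ xs → b ∈ₗ ys → a ≢ b
Unique-split-≢ (_ ∷ xs) (a≢ ∷ _) (here refl) b∈ = All.lookup a≢ (∈-++⁺ʳ xs b∈)
Unique-split-≢ (_ ∷ xs) (_ ∷ u)  (there a∈)  b∈ = Unique-split-≢ xs u a∈ b∈

lookup-injective : Unique xs → ∀ {i j} → lookup xs i ≡ lookup xs j → i ≡ j
lookup-injective {xs = _ ∷ xs} (x≢ ∷ u) {zero}  {zero}  eq = refl
lookup-injective {xs = _ ∷ xs} (x≢ ∷ u) {zero}  {suc j} eq = contradiction eq (All.lookup x≢ (∈-lookup j))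
lookup-injective {xs = _ ∷ xs} (x≢ ∷ u) {suc i} {zero}  eq = contradiction (sym eq) (All.lookup x≢ (∈-lookup i))
lookup-injective {xs = _ ∷ xs} (x≢ ∷ u) {suc i} {suc j} eq = cong suc (lookup-injective u eq)

Unique⇒length≤ : {xs : List (Fin n)} → Unique xs → length xs ℕ.≤ n
Unique⇒length≤ u = injective⇒≤ (lookup-injective u)

Linked-++ʳ : ∀ xs {ys : List X} → Linked R (xs ++ ys) → Linked R ys
Linked-++ʳ []            l       = l
Linked-++ʳ (_ ∷ [])      [-]     = []
Linked-++ʳ (_ ∷ [])      (_ ∷ l) = l
Linked-++ʳ (_ ∷ _ ∷ xs)  (_ ∷ l) = Linked-++ʳ (_ ∷ xs) l

Linked-++ˡ : ∀ xs {ys : List X} → Linked R (xs ++ ys) → Linked R xs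
Linked-++ˡ []           l       = []
Linked-++ˡ (_ ∷ [])     l       = [-]
Linked-++ˡ (_ ∷ _ ∷ xs) (r ∷ l) = r ∷ Linked-++ˡ (_ ∷ xs) l

Linked-adjacent : ∀ {a b} xs {ys : List X} → Linked R (xs ++ a ∷ b ∷ ys) → R a b
Linked-adjacent xs l with Linked-++ʳ xs l
... | r ∷ _ = r

Linked-snoc : ∀ {a b} (xs : List X) → Linked R (xs ++ a ∷ []) → R a b → Linked R (xs ++ a ∷ b ∷ [])
Linked-snoc []           _       r = r ∷ [-]
Linked-snoc (_ ∷ [])     (s ∷ _) r = s ∷ r ∷ [-]
Linked-snoc (_ ∷ _ ∷ xs) (s ∷ l) r = s ∷ Linked-snoc (_ ∷ xs) l r

Unique-snoc : ∀ {xs} {b : X} → Unique xs → b ∉ₗ xs → Unique (xs ++ b ∷ [])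
Unique-snoc {xs = []}     []       b∉ = [] ∷ []
Unique-snoc {xs = x ∷ xs} (x≢ ∷ u) b∉ =
  All.++⁺ x≢ ((λ { refl → b∉ (here refl) }) ∷ []) ∷ Unique-snoc u (b∉ ∘ there)

-- The alternatives for a subset of a path: empty, contiguous, or skipping a nonempty stretch
-- between two of its elements. The stretch in `gap` contains nothing of `Q`, so that in `F⇒Segment`
-- its two ends form a chord.
data Trace {X : Set} (Q : Pred X 0ℓ) (p : List X) : Set where
  none    : All (¬_ ∘ Q) p → Trace Q p
  block : ∀ xs y ys zs → p ≡ xs ++ (y ∷ ys) ++ zs →
            All (¬_ ∘ Q) xs → All Q (y ∷ ys) → All (¬_ ∘ Q) zs → Trace Q p
  gap     : ∀ xs a z us b ws → p ≡ xs ++ a ∷ z ∷ us ++ b ∷ ws →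
            Q a → Q b → All (¬_ ∘ Q) (z ∷ us) → Trace Q p

trace : {Q : Pred X 0ℓ} → Decidable Q → ∀ p → Trace Q p
trace Q? [] = none []
trace Q? (x ∷ p) with Q? x | trace Q? p
... | yes q | none ns                          = block [] x [] p refl [] (q ∷ []) ns
... | no ¬q | none ns                          = none (¬q ∷ ns)
... | yes q | block [] y ys zs refl nx ay nz = block [] x (y ∷ ys) zs refl [] (q ∷ ay) nz
... | yes q | block (z ∷ us) y ys zs refl nx (qy ∷ _) nz = gap [] x z us y (ys ++ zs) refl q qy nx
... | no ¬q | block xs y ys zs eq nx ay nz   = block (x ∷ xs) y ys zs (cong (x ∷_) eq) (¬q ∷ nx) ay nz
... | _     | gap xs a z us b ws eq qa qb nu   = gap (x ∷ xs) a z us b ws (cong (x ∷_) eq) qa qb nu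

-- The graph of two-element members

module Core {k} {K : Subset k} {F : Pred (Subset k) 0ℓ} (W : WeaklyPartitive K F)
  (crossed : ∀ {A} → F A → Nontrivial A → A ⊂ K → ∃ λ B → F B × A ≬ B) where

  open WeaklyPartitive W

  E : Rel (Fin k) 0ℓ
  E a b = a ≢ b × F (pair a b)

  E? : ∀ a b → Dec (E a b)
  E? a b = ¬? (a ≟ b) ×-dec F? (pair a b)

  E-sym : ∀ {a b} → E a b → E b a
  E-sym (a≢b , f) =
    a≢b ∘ sym , subst F (⊆-antisym (pair-⊆ ∈-pairʳ ∈-pairˡ) (pair-⊆ ∈-pairʳ ∈-pairˡ)) f

  Eˡ : ∀ {a b} → E a b → a ∈ K
  Eˡ (_ , f) = F⇒⊆ f ∈-pairˡ

  Eʳ : ∀ {a b} → E a b → b ∈ K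
  Eʳ (_ , f) = F⇒⊆ f ∈-pairʳ

  -- If D crosses S, then D, M ∩ D or M ∩ ∁ D is a smaller member meeting both S and T.
  no-split : ∀ {M S T} → F M → F S → S ⊆ M → (∃ λ t → t ∈ T) → T ⊆ M →
             (∀ {x} → x ∈ M → x ∈ S ⊎ x ∈ T) → (∀ {x} → x ∈ S → x ∈ T → ⊥) →
             (∀ {C x y} → F C → C ⊆ M → x ∈ C → x ∈ S → y ∈ C → y ∈ T → M ⊆ C) →
             ¬ Nontrivial S
  no-split {M} {S} {T} fM fS S⊆M (t₀ , t₀∈T) T⊆M cover disjoint min nt
    with crossed fS nt ((λ z → F⇒⊆ fM (S⊆M z)) , t₀ , F⇒⊆ fM (T⊆M t₀∈T) , λ t∈S → disjoint t∈S t₀∈T)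
  ... | D , fD , (d , d∈S , d∈D) , (s , s∈S , s∉D) , (e , e∈D , e∉S)
    with any? (λ t → t ∈? D ×-dec t ∈? T)
  ... | no ¬t =
    proj₂ (∈∩∁⁻ (min (─-closed fM fD
                       ((d , S⊆M d∈S , d∈D) , (s , S⊆M s∈S , s∉D) , e , e∈D ,
                        λ e∈M → [ e∉S , (λ e∈T → ¬t (e , e∈D , e∈T)) ]′ (cover e∈M)))
                     (proj₁ ∘ ∈∩∁⁻) (∈∩∁⁺ (S⊆M s∈S) s∉D) s∈S
                     (∈∩∁⁺ (T⊆M t₀∈T) (λ t∈D → ¬t (t₀ , t∈D , t₀∈T))) t₀∈T (S⊆M d∈S)))
          d∈D
  ... | yes (t , t∈D , t∈T) with ⊆-or-∃ D M
  ...   | inj₁ D⊆M = s∉D (min fD D⊆M d∈D d∈S t∈D t∈T (S⊆M s∈S))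
  ...   | inj₂ out =
    s∉D (proj₂ (x∈p∩q⁻ M D
      (min (∩-closed fM fD ((d , S⊆M d∈S , d∈D) , (s , S⊆M s∈S , s∉D) , out))
           (λ z → proj₁ (x∈p∩q⁻ M D z)) (x∈p∩q⁺ (S⊆M d∈S , d∈D)) d∈S
           (x∈p∩q⁺ (T⊆M t∈T , t∈D)) t∈T (S⊆M s∈S))))

  Meets : Subset k → Subset k → Set
  Meets Z M = (∃ λ x → x ∈ M × x ∈ Z) × (∃ λ x → x ∈ M × x ∉ Z)

  Meets? : ∀ Z M → Dec (Meets Z M)
  Meets? Z M = any? (λ x → x ∈? M ×-dec x ∈? Z) ×-dec any? (λ x → x ∈? M ×-dec ¬? (x ∈? Z))

  module Connected {A₀} (fA₀ : F A₀) (nt₀ : Nontrivial A₀) (A₀⊂K : A₀ ⊂ K) where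

    -- A maximal nontrivial proper member `A` and a member `B` overlapping it cover `K`, for
    -- otherwise their union would be larger and proper. If `A` lies on one side of `Z`, then so
    -- does the common point `c`, while `B` contains the one of `p` and `q` on the other side.
    proper-meeting : ∀ Z {p q} → p ∈ Z → p ∈ K → q ∈ K → q ∉ Z → ∃ λ M → F M × M ⊂ K × Meets Z M
    proper-meeting Z {p} {q} p∈Z p∈K q∈K q∉Z
      with maximal (λ A → F? A ×-dec Nontrivial? A ×-dec (A ⊂? K)) (fA₀ , nt₀ , A₀⊂K)
    ... | A , (fA , nt@(u , v , u∈A , v∈A , u≢v) , A⊂K) , _ , max
      with crossed fA nt A⊂K
    ... | B , fB , o@((c , c∈A , c∈B) , (a , a∈A , a∉B) , (b , b∈B , b∉A)) = result
      where
      full : ∀ {x} → x ∈ K → x ∈ A ⊎ x ∈ B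
      full x∈K with ⊆⇒≡⊎⊂ (F⇒⊆ (∪-closed fA fB o))
      ... | inj₁ eq = x∈p∪q⁻ A B (subst (_ ∈_) (sym eq) x∈K)
      ... | inj₂ ⊂K = contradiction
        (subst (b ∈_) (sym (max (∪-closed fA fB o , (u , v , x∈p∪q⁺ (inj₁ u∈A) , x∈p∪q⁺ (inj₁ v∈A) , u≢v) , ⊂K)
                                (x∈p∪q⁺ ∘ inj₁)))
               (x∈p∪q⁺ (inj₂ b∈B)))
        b∉A
      B⊂K : B ⊂ K
      B⊂K = F⇒⊆ fB , a , F⇒⊆ fA a∈A , a∉B
      result : ∃ λ M → F M × M ⊂ K × Meets Z M
      result with Meets? Z A
      ... | yes m = A , fA , A⊂K , m
      ... | no ¬m with c ∈? Z
      ...   | yes c∈Z = B , fB , B⊂K , (c , c∈B , c∈Z) , q ,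
        [ (λ q∈A → contradiction ((c , c∈A , c∈Z) , (q , q∈A , q∉Z)) ¬m) , (λ z → z) ]′ (full q∈K) , q∉Z
      ...   | no c∉Z = B , fB , B⊂K , (p ,
        [ (λ p∈A → contradiction ((p , p∈A , p∈Z) , (c , c∈A , c∉Z)) ¬m) , (λ z → z) ]′ (full p∈K) , p∈Z) ,
        c , c∈B , c∉Z

    abstract
      -- Connectedness of `E` in the form of cuts. Let `M` be a minimal member meeting both sides of
      -- `Z`. If it has a third element, some `C` overlaps it, and by minimality `M ∩ C` and
      -- `M ∩ ∁ C` lie on opposite sides of `Z`. Hence a member inside `M` that meets both parts is
      -- all of `M`, and `no-split` forbids either part to be nontrivial, although one of them
      -- contains the third element.
      crossing-edge : ∀ Z {p q} → p ∈ Z → p ∈ K → q ∈ K → q ∉ Z → ∃₂ λ a b → a ∈ Z × b ∉ Z × E a b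
      crossing-edge Z p∈Z p∈K q∈K q∉Z with proper-meeting Z p∈Z p∈K q∈K q∉Z
      ... | M₁ , fM₁ , M₁⊂K , m₁ with minimal (λ A → F? A ×-dec Meets? Z A) (fM₁ , m₁)
      ... | M , (fM , (x , x∈M , x∈Z) , (y , y∈M , y∉Z)) , M⊆M₁ , min
        with any? (λ z → z ∈? M ×-dec ¬? (z ≟ x) ×-dec ¬? (z ≟ y))
      ... | no ¬z = x , y , x∈Z , y∉Z , (λ { refl → y∉Z x∈Z }) ,
        subst F (⊆-antisym only (pair-⊆ x∈M y∈M)) fM
        where
        only : M ⊆ pair x y
        only {w} w∈M with w ≟ x | w ≟ y
        ... | yes refl | _        = ∈-pairˡ
        ... | no _     | yes refl = ∈-pairʳ
        ... | no w≢x   | no w≢y   = contradiction (w , w∈M , w≢x , w≢y) ¬z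
      ... | yes (z , z∈M , z≢x , z≢y)
        with crossed fM (x , y , x∈M , y∈M , λ { refl → y∉Z x∈Z }) (⊆-⊂-trans M⊆M₁ M₁⊂K)
      ... | C , fC , o@((c , c∈M , c∈C) , (d , d∈M , d∉C) , _) = ⊥-elim result
        where
        S T : Subset k
        S = M ∩ C
        T = M ∩ ∁ C
        fS : F S
        fS = ∩-closed fM fC o
        fT : F T
        fT = ─-closed fM fC o
        S⊆M : S ⊆ M
        S⊆M = proj₁ ∘ x∈p∩q⁻ M C
        T⊆M : T ⊆ M
        T⊆M = proj₁ ∘ ∈∩∁⁻
        cover : ∀ {w} → w ∈ M → w ∈ S ⊎ w ∈ T
        cover {w} w∈M with w ∈? C
        ... | yes w∈C = inj₁ (x∈p∩q⁺ (w∈M , w∈C))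
        ... | no w∉C  = inj₂ (∈∩∁⁺ w∈M w∉C)
        disjoint : ∀ {w} → w ∈ S → w ∈ T → ⊥
        disjoint w∈S w∈T = proj₂ (∈∩∁⁻ w∈T) (proj₂ (x∈p∩q⁻ M C w∈S))
        one-sided : ∀ {N e u v} → F N → N ⊆ M → e ∈ M → e ∉ N → u ∈ N → v ∈ N → u ∈ Z → v ∉ Z → ⊥
        one-sided fN N⊆M e∈M e∉N u∈N v∈N u∈Z v∉Z =
          e∉N (subst (_ ∈_) (sym (min (fN , (_ , u∈N , u∈Z) , (_ , v∈N , v∉Z)) N⊆M)) e∈M)
        -- It is unknown which of `x` and `y` lies in `C`, so the parts are arguments and both
        -- orders are used.
        two-sided : ∀ {S T} → F S → F T → S ⊆ M → T ⊆ M → (∀ {w} → w ∈ M → w ∈ S ⊎ w ∈ T) →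
                    (∀ {w} → w ∈ S → w ∈ T → ⊥) → x ∈ S → y ∈ T → ⊥
        two-sided {S} {T} fS fT S⊆M T⊆M cover disjoint x∈S y∈T = [
          (λ z∈S → no-split fM fS S⊆M (_ , y∈T) T⊆M cover disjoint
            (λ fN N⊆M u∈N u∈S v∈N v∈T → λ w∈M → subst (_ ∈_)
              (sym (min (fN , (_ , u∈N , S-in u∈S) , (_ , v∈N , T-out v∈T)) N⊆M)) w∈M)
            (z , x , z∈S , x∈S , z≢x)) ,
          (λ z∈T → no-split fM fT T⊆M (_ , x∈S) S⊆M ([ inj₂ , inj₁ ]′ ∘ cover) (λ t s → disjoint s t)
            (λ fN N⊆M u∈N u∈T v∈N v∈S → λ w∈M → subst (_ ∈_)
              (sym (min (fN , (_ , v∈N , S-in v∈S) , (_ , u∈N , T-out u∈T)) N⊆M)) w∈M)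
            (z , y , z∈T , y∈T , z≢y)) ]′ (cover z∈M)
          where
          S-in : ∀ {w} → w ∈ S → w ∈ Z
          S-in {w} w∈S = decidable-stable (w ∈? Z) λ w∉Z →
            one-sided fS S⊆M y∈M (λ y∈S → disjoint y∈S y∈T) x∈S w∈S x∈Z w∉Z
          T-out : ∀ {w} → w ∈ T → w ∉ Z
          T-out w∈T w∈Z = one-sided fT T⊆M x∈M (disjoint x∈S) w∈T y∈T w∈Z y∉Z
        result : ⊥
        result with cover x∈M | cover y∈M
        ... | inj₁ x∈S | inj₁ y∈S = one-sided fS S⊆M d∈M (d∉C ∘ proj₂ ∘ x∈p∩q⁻ M C) x∈S y∈S x∈Z y∉Z
        ... | inj₂ x∈T | inj₂ y∈T =
          one-sided fT T⊆M c∈M (λ c∈T → proj₂ (∈∩∁⁻ c∈T) c∈C) x∈T y∈T x∈Z y∉Z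
        ... | inj₁ x∈S | inj₂ y∈T = two-sided fS fT S⊆M T⊆M cover disjoint x∈S y∈T
        ... | inj₂ x∈T | inj₁ y∈S =
          two-sided fT fS T⊆M S⊆M ([ inj₂ , inj₁ ]′ ∘ cover) (λ t s → disjoint s t) x∈T y∈S

    -- The union of `pair c x` and `pair c y` overlaps `pair c z` in `c` alone; removing the latter
    -- leaves `pair x y`.
    triple : ∀ {c x y z} → x ≢ y → x ≢ z → y ≢ z → E c x → E c y → E c z → E x y
    triple {c} {x} {y} {z} x≢y x≢z y≢z ex@(c≢x , fx) ey@(c≢y , fy) (c≢z , fz) =
      x≢y , subst F (⊆-antisym to from) (─-closed (∪-meet fx fy ∈-pairˡ ∈-pairˡ) fz
        ((c , x∈p∪q⁺ (inj₁ ∈-pairˡ) , ∈-pairˡ) ,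
         (x , x∈p∪q⁺ (inj₁ ∈-pairʳ) , ∉-pair (c≢x ∘ sym) x≢z) ,
         (z , ∈-pairʳ , λ z∈ → [ ∉-pair (c≢z ∘ sym) (x≢z ∘ sym) , ∉-pair (c≢z ∘ sym) (y≢z ∘ sym) ]′
                                 (x∈p∪q⁻ (pair c x) (pair c y) z∈))))
      where
      to : (pair c x ∪ pair c y) ∩ ∁ (pair c z) ⊆ pair x y
      to w∈ with ∈∩∁⁻ {A = pair c x ∪ pair c y} w∈
      ... | w∈∪ , w∉ with x∈p∪q⁻ (pair c x) (pair c y) w∈∪
      ...   | inj₁ w∈x with ∈-pair⁻ w∈x
      ...     | inj₁ refl = contradiction ∈-pairˡ w∉
      ...     | inj₂ refl = ∈-pairˡ
      to w∈ | w∈∪ , w∉ | inj₂ w∈y with ∈-pair⁻ w∈y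
      ...     | inj₁ refl = contradiction ∈-pairˡ w∉
      ...     | inj₂ refl = ∈-pairʳ
      from : pair x y ⊆ (pair c x ∪ pair c y) ∩ ∁ (pair c z)
      from = pair-⊆ (∈∩∁⁺ (x∈p∪q⁺ (inj₁ ∈-pairʳ)) (∉-pair (c≢x ∘ sym) x≢z))
                    (∈∩∁⁺ (x∈p∪q⁺ (inj₂ ∈-pairʳ)) (∉-pair (c≢y ∘ sym) y≢z))

    AllAdjacent : Set
    AllAdjacent = ∀ a → a ∈ K → ∀ b → b ∈ K → a ≢ b → E a b

    AllAdjacent? : Dec AllAdjacent
    AllAdjacent? = all? λ a → (a ∈? K) →-dec all? λ b → (b ∈? K) →-dec (¬? (a ≟ b) →-dec E? a b)

    abstract
      avoid : ∀ {c x y z : Fin k} → x ≢ y → x ≢ z → y ≢ z → E c x → E c y → E c z →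
              ∀ u v → ∃ λ w → E c w × w ≢ u × w ≢ v
      avoid {x = x} {y} {z} x≢y x≢z y≢z ex ey ez u v with x ≟ u | x ≟ v
      ... | no x≢u   | no x≢v = x , ex , x≢u , x≢v
      ... | yes refl | _ with y ≟ v
      ...   | no y≢v   = y , ey , x≢y ∘ sym , y≢v
      ...   | yes refl = z , ez , x≢z ∘ sym , y≢z ∘ sym
      avoid {x = x} {y} {z} x≢y x≢z y≢z ex ey ez u v | no x≢u | yes refl with y ≟ u
      ...   | no y≢u   = y , ey , y≢u , x≢y ∘ sym
      ...   | yes refl = z , ez , y≢z ∘ sym , x≢z ∘ sym

    -- Two neighbours of `c` are adjacent by `triple`, with a further neighbour as third. If `a` is
    -- a neighbour of `c` and `b` one of `a`, then `a` has the neighbours `c`, `b` and another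
    -- neighbour `w` of `c`, so `triple` at `a` joins `c` to `b`. Thus `c` and its neighbours are
    -- closed under adjacency and exhaust `K` by connectedness.
    degree≥3⇒all-adjacent : ∀ {c x y z} → x ≢ y → x ≢ z → y ≢ z → E c x → E c y → E c z → AllAdjacent
    degree≥3⇒all-adjacent {c} x≢y x≢z y≢z ex ey ez = all-adjacent
      where
      other : ∀ u v → ∃ λ w → E c w × w ≢ u × w ≢ v
      other = avoid x≢y x≢z y≢z ex ey ez
      neighbours-adjacent : ∀ {a b} → E c a → E c b → a ≢ b → E a b
      neighbours-adjacent {a} {b} ea eb a≢b =
        let w , ew , w≢a , w≢b = other a b in triple a≢b (w≢a ∘ sym) (w≢b ∘ sym) ea eb ew
      Near : Pred (Fin k) 0ℓ
      Near v = v ≡ c ⊎ E c v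
      closed : ∀ {a b} → Near a → E a b → Near b
      closed {a} {b} (inj₁ refl) eab = inj₂ eab
      closed {a} {b} (inj₂ ea) eab with b ≟ c
      ... | yes b≡c = inj₁ b≡c
      ... | no b≢c  =
        let w , ew , w≢a , w≢b = other a b
        in inj₂ (triple (b≢c ∘ sym) (proj₁ ew) (w≢b ∘ sym) (E-sym ea) eab
                        (neighbours-adjacent ea ew (w≢a ∘ sym)))
      near? : Decidable Near
      near? v = (v ≟ c) ⊎-dec E? c v
      near : ∀ {v} → v ∈ K → Near v
      near {v} v∈K = decidable-stable (near? v) λ ¬s →
        let a , b , a∈ , b∉ , eab = crossing-edge (select near?) {c} (∈-select⁺ near? (inj₁ refl)) (Eˡ ex)
                                      v∈K (¬s ∘ ∈-select⁻ near?)
        in b∉ (∈-select⁺ near? (closed (∈-select⁻ near? a∈) eab))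
      all-adjacent : AllAdjacent
      all-adjacent a a∈K b b∈K a≢b with near a∈K | near b∈K
      ... | inj₁ refl | inj₁ refl = contradiction refl a≢b
      ... | inj₁ refl | inj₂ eb   = eb
      ... | inj₂ ea   | inj₁ refl = E-sym ea
      ... | inj₂ ea   | inj₂ eb   = neighbours-adjacent ea eb a≢b

    -- A maximal member inside `I` through `a` absorbs every further element `x` of `I` by its union
    -- with `pair a x`.
    all-adjacent⇒complete : AllAdjacent → ∀ {I} → I ⊆ K → Nonempty I → F I
    all-adjacent⇒complete adj {I} I⊆K (a , a∈I)
      with maximal (λ J → F? J ×-dec (a ∈? J) ×-dec (J ⊆? I))
                   (singleton (I⊆K a∈I) , x∈⁅x⁆ a , ⁅⁆-⊆ a∈I)
    ... | J , (fJ , a∈J , J⊆I) , _ , max with ⊆-or-∃ I J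
    ...   | inj₁ I⊆J = subst F (⊆-antisym J⊆I I⊆J) fJ
    ...   | inj₂ (x , x∈I , x∉J) = contradiction
      (subst (x ∈_) (sym (max (∪-meet fJ (proj₂ (adj a (I⊆K a∈I) x (I⊆K x∈I) λ { refl → x∉J a∈J })) a∈J ∈-pairˡ ,
                               x∈p∪q⁺ (inj₁ a∈J) , ∪-⊆ J⊆I (pair-⊆ a∈I x∈I))
                              (x∈p∪q⁺ ∘ inj₁)))
             (x∈p∪q⁺ (inj₂ ∈-pairʳ)))
      x∉J

    path⇒F : ∀ y ys → y ∈ K → Linked E (y ∷ ys) → F (toSet (y ∷ ys))
    path⇒F y [] y∈K [-] = subst F
      (⊆-antisym (λ x∈ → ∈-toSet⁺ (here (x∈⁅y⁆⇒x≡y y x∈)))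
                 (toSet-⊆ λ { (here refl) → x∈⁅x⁆ y ; (there ()) }))
      (singleton y∈K)
    path⇒F y (z ∷ ys) y∈K (e ∷ l) = subst F
      (⊆-antisym (∪-⊆ (pair-⊆ (∈-toSet⁺ (here refl)) (∈-toSet⁺ (there (here refl))))
                      (toSet-⊆ (∈-toSet⁺ ∘ there)))
                 (toSet-⊆ λ { (here refl)         → x∈p∪q⁺ (inj₁ ∈-pairˡ)
                            ; (there x∈) → x∈p∪q⁺ (inj₂ (∈-toSet⁺ x∈)) }))
      (∪-meet (proj₂ e) (path⇒F z ys (Eʳ e) l) ∈-pairʳ (∈-toSet⁺ (here refl)))

    module Sparse (¬adj : ¬ AllAdjacent) where

      degree≤2 : ∀ {c x y z} → E c x → E c y → E c z → x ≢ y → x ≢ z → y ≢ z → ⊥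
      degree≤2 ex ey ez x≢y x≢z y≢z = ¬adj (degree≥3⇒all-adjacent x≢y x≢z y≢z ex ey ez)

      Path : Pred (List (Fin k)) 0ℓ
      Path p = Unique p × All (_∈ K) p × Linked E p

      Hamiltonian : Pred (List (Fin k)) 0ℓ
      Hamiltonian p = Path p × (∀ {v} → v ∈ K → v ∈ₗ p)

      abstract
        -- An inner vertex of the path already has two neighbours on it and admits no third. So `a`
        -- is an end, and the path grows there.
        extend : ∀ {p a b} → Path p → a ∈ₗ p → b ∉ₗ p → E a b → ∃ λ q → Path q × length q ≡ ℕ.suc (length p)
        extend {a = a} {b} (u , p⊆K , l) a∈p b∉p eab with ∈-∃++ a∈p
        ... | ys , zs , refl with initLast ys | zs
        ...   | [] | zs =
          b ∷ _ , (All.¬Any⇒All¬ _ b∉p ∷ u , Eʳ eab ∷ p⊆K , E-sym eab ∷ l) , refl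
        ...   | ws ∷ʳ′ w | [] =
          _ , (Unique-snoc u b∉p , All.++⁺ p⊆K (Eʳ eab ∷ []) ,
               subst (Linked E) (sym (++-assoc (ws ++ w ∷ []) _ _)) (Linked-snoc (ws ++ w ∷ []) l eab)) ,
          trans (length-++ ((ws ++ w ∷ []) ++ _)) (ℕ.+-comm _ 1)
        ...   | ws ∷ʳ′ w | z ∷ zs = ⊥-elim (degree≤2 (E-sym ewa) eaz eab w≢z
          (λ { refl → b∉p (∈-++⁺ˡ (∈-++⁺ʳ ws (here refl))) })
          (λ { refl → b∉p (∈-++⁺ʳ (ws ++ w ∷ []) (there (here refl))) }))
          where
          ewa : E w a
          ewa = Linked-adjacent ws (subst (Linked E) (++-assoc ws _ _) l)
          eaz : E a z
          eaz = Linked-adjacent (ws ++ w ∷ []) l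
          w≢z : w ≢ z
          w≢z with Unique-++ʳ ws (subst Unique (++-assoc ws _ _) u)
          ... | (_ ∷ w≢z ∷ _) ∷ _ = w≢z

      -- `m` bounds the number of extensions still possible: a path without repetition has at most
      -- `k` vertices.
      grow : ∀ m {p x} → k ℕ.≤ length p ℕ.+ m → Path p → x ∈ₗ p → ∃ Hamiltonian
      grow m {p} {x} bound path x∈p with any? (λ v → v ∈? K ×-dec ¬? (v ∈ₗ? p))
      ... | no ¬v = p , path , λ {v} v∈K → decidable-stable (v ∈ₗ? p) λ v∉p → ¬v (v , v∈K , v∉p)
      ... | yes (v , v∈K , v∉p)
        with crossing-edge (toSet p) (∈-toSet⁺ x∈p) (All.lookup (proj₁ (proj₂ path)) x∈p) v∈K (v∉p ∘ ∈-toSet⁻)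
      ...   | a , b , a∈ , b∉ , eab with extend path (∈-toSet⁻ a∈) (b∉ ∘ ∈-toSet⁺) eab
      grow ℕ.zero    {p} bound path x∈p | yes _ | _ | q , path′ , eq =
        contradiction (ℕ.≤-trans (ℕ.≤-reflexive (sym eq))
          (ℕ.≤-trans (Unique⇒length≤ (proj₁ path′)) (ℕ.≤-trans bound (ℕ.≤-reflexive (ℕ.+-identityʳ _)))))
          ℕ.1+n≰n
      grow (ℕ.suc m) {p} bound path x∈p | yes _ | _ | [] , path′ , ()
      grow (ℕ.suc m) {p} bound path x∈p | yes _ | _ | q@(_ ∷ _) , path′ , eq =
        grow m (ℕ.≤-trans bound (ℕ.≤-reflexive
                 (trans (ℕ.+-suc (length p) m) (cong (ℕ._+ m) (sym eq))))) path′ (here refl)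

      hamiltonian : ∃ Hamiltonian
      hamiltonian with nonempty whole
      ... | x , x∈K = grow k (ℕ.m≤n+m k 1) (([] ∷ []) , (x∈K ∷ []) , [-]) (here refl)

      -- The list starts before `a`, so `a` has a predecessor and the successor `z`; the chord would
      -- give it a third neighbour.
      no-chord-from-inside : ∀ x xs {a z b} ys → Unique (x ∷ xs ++ a ∷ z ∷ ys) →
                             Linked E (x ∷ xs ++ a ∷ z ∷ ys) → b ∈ₗ ys → ¬ E a b
      no-chord-from-inside x [] ys ((_ ∷ x≢z ∷ x≢s) ∷ _ ∷ z≢s ∷ _) (exa ∷ eaz ∷ _) b∈ eab =
        degree≤2 (E-sym exa) eaz eab x≢z (All.lookup x≢s b∈) (All.lookup z≢s b∈)
      no-chord-from-inside x (y ∷ xs) ys (_ ∷ u) (_ ∷ l) b∈ eab = no-chord-from-inside y xs ys u l b∈ eab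

      -- The same count at the other end of the chord: `b` has a predecessor and the successor `w`.
      no-chord-to-inside : ∀ z us {a b w ws} → All (a ≢_) (z ∷ us ++ b ∷ w ∷ ws) →
                           Unique (z ∷ us ++ b ∷ w ∷ ws) → Linked E (z ∷ us ++ b ∷ w ∷ ws) → ¬ E a b
      no-chord-to-inside z [] (a≢z ∷ _ ∷ a≢w ∷ _) ((_ ∷ z≢w ∷ _) ∷ _) (ezb ∷ ebw ∷ _) eab =
        degree≤2 (E-sym ezb) (E-sym eab) ebw (a≢z ∘ sym) z≢w a≢w
      no-chord-to-inside z (y ∷ us) (_ ∷ a≢) (_ ∷ u) (_ ∷ l) eab = no-chord-to-inside y us a≢ u l eab

      triangle : ∀ {a z b} → E a z → E a b → E z b →
                 ∀ {v w} → v ∈ₗ a ∷ z ∷ b ∷ [] → w ∈ₗ a ∷ z ∷ b ∷ [] → v ≢ w → E v w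
      triangle az ab zb (here refl)                 (here refl)                 v≢w = contradiction refl v≢w
      triangle az ab zb (here refl)                 (there (here refl))         _   = az
      triangle az ab zb (here refl)                 (there (there (here refl))) _   = ab
      triangle az ab zb (there (here refl))         (here refl)                 _   = E-sym az
      triangle az ab zb (there (here refl))         (there (here refl))         v≢w = contradiction refl v≢w
      triangle az ab zb (there (here refl))         (there (there (here refl))) _   = zb
      triangle az ab zb (there (there (here refl))) (here refl)                 _   = E-sym ab
      triangle az ab zb (there (there (here refl))) (there (here refl))         _   = E-sym zb
      triangle az ab zb (there (there (here refl))) (there (there (here refl))) v≢w = contradiction refl v≢w

      -- {a, b, z} meets the rest of the cycle in {z, b} only, which makes z a
      -- vertex of degree three.
      no-long-cycle : ∀ {a z t} us {b} → All (a ≢_) (z ∷ t ∷ us ++ b ∷ []) →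
                      Unique (z ∷ t ∷ us ++ b ∷ []) → Linked E (a ∷ z ∷ t ∷ us ++ b ∷ []) → ¬ E a b
      no-long-cycle {a} {z} {t} us {b} a≢@(a≢z ∷ a≢t ∷ _) ((z≢t ∷ z≢s) ∷ t≢s ∷ _) (eaz ∷ l@(ezt ∷ _)) eab =
        degree≤2 (E-sym eaz) ezt ezb a≢t (All.lookup a≢ (there (there b∈us))) t≢b
        where
        b∈us : b ∈ₗ us ++ b ∷ []
        b∈us = ∈-++⁺ʳ us (here refl)
        t≢b : t ≢ b
        t≢b = All.lookup t≢s b∈us
        rest : List (Fin k)
        rest = z ∷ t ∷ us ++ b ∷ []
        a∉rest : a ∉ toSet rest
        a∉rest a∈ = All.lookup a≢ (∈-toSet⁻ a∈) refl
        t∉ : t ∉ pair a b ∪ pair a z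
        t∉ t∈ = [ ∉-pair (a≢t ∘ sym) t≢b , ∉-pair (a≢t ∘ sym) (z≢t ∘ sym) ]′
                  (x∈p∪q⁻ (pair a b) (pair a z) t∈)
        only : (pair a b ∪ pair a z) ∩ toSet rest ⊆ pair z b
        only v∈ with x∈p∩q⁻ (pair a b ∪ pair a z) (toSet rest) v∈
        ... | v∈∪ , v∈rest with x∈p∪q⁻ (pair a b) (pair a z) v∈∪
        ...   | inj₁ v∈ab with ∈-pair⁻ v∈ab
        ...     | inj₁ refl = contradiction v∈rest a∉rest
        ...     | inj₂ refl = ∈-pairʳ
        only v∈ | v∈∪ , v∈rest | inj₂ v∈az with ∈-pair⁻ v∈az
        ...     | inj₁ refl = contradiction v∈rest a∉rest
        ...     | inj₂ refl = ∈-pairˡ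
        b∈rest : b ∈ toSet rest
        b∈rest = ∈-toSet⁺ {xs = rest} (there (there b∈us))
        z∈rest : z ∈ toSet rest
        z∈rest = ∈-toSet⁺ {xs = rest} (here refl)
        ezb : E z b
        ezb = All.lookup z≢s b∈us , subst F
          (⊆-antisym only (pair-⊆ (x∈p∩q⁺ (x∈p∪q⁺ (inj₂ ∈-pairʳ) , z∈rest))
                                  (x∈p∩q⁺ (x∈p∪q⁺ (inj₁ ∈-pairʳ) , b∈rest))))
          (∩-closed (∪-meet (proj₂ eab) (proj₂ eaz) ∈-pairˡ ∈-pairˡ) (path⇒F z _ (Eʳ eaz) l)
            ((z , x∈p∪q⁺ (inj₂ ∈-pairʳ) , z∈rest) , (a , x∈p∪q⁺ (inj₁ ∈-pairˡ) , a∉rest) ,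
             (t , ∈-toSet⁺ {xs = rest} (there (here refl)) , t∉)))

      -- By degrees a chord can join only the two ends of the path, closing it to a cycle through
      -- all of `K`. A cycle of length three would make all elements adjacent; longer ones fall to
      -- `no-long-cycle`.
      chordless : ∀ xs {a z us b ws} → Hamiltonian (xs ++ a ∷ z ∷ us ++ b ∷ ws) → ¬ E a b
      chordless (x ∷ xs) {us = us} {b} {ws} ((u , _ , l) , _) =
        no-chord-from-inside x xs (us ++ b ∷ ws) u l (∈-++⁺ʳ us (here refl))
      chordless [] {us = us} {ws = _ ∷ _} ((a≢ ∷ u , _ , _ ∷ l) , _) = no-chord-to-inside _ us a≢ u l
      chordless [] {us = []} {ws = []} ((_ , _ , eaz ∷ ezb ∷ _) , full) eab =
        ¬adj λ v v∈K w w∈K → triangle eaz eab ezb (full v∈K) (full w∈K)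
      chordless [] {us = _ ∷ us} {ws = []} ((a≢ ∷ u , _ , l) , _) = no-long-cycle us a≢ u l

      -- If `I` skipped a stretch between `a` and `b`, it would meet the subpath `J` from `a` to `b`
      -- in these two points only. As `J` is a member, the pair would be one too, and hence a chord.
      F⇒Segment : ∀ {p I} → Hamiltonian p → F I → Segment p I
      F⇒Segment {p} {I} ham@((u , p⊆K , l) , full) fI with trace (_∈? I) p
      ... | none ∉I =
        let x , x∈I = nonempty fI in contradiction x∈I (All.lookup ∉I (full (F⇒⊆ fI x∈I)))
      ... | block xs y ys zs refl xs∉ ys∈ zs∉ =
        xs , y ∷ ys , zs , refl , ⊆-antisym I⊆ (toSet-⊆ (All.lookup ys∈))
        where
        I⊆ : I ⊆ toSet (y ∷ ys)
        I⊆ v∈I with ∈-++⁻ xs (full (F⇒⊆ fI v∈I))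
        ... | inj₁ v∈xs = contradiction v∈I (All.lookup xs∉ v∈xs)
        ... | inj₂ v∈′ with ∈-++⁻ (y ∷ ys) v∈′
        ...   | inj₁ v∈ys = ∈-toSet⁺ v∈ys
        ...   | inj₂ v∈zs = contradiction v∈I (All.lookup zs∉ v∈zs)
      ... | gap xs a z us b ws refl a∈I b∈I ∉I@(z∉I ∷ _) = contradiction (a≢b , pair∈F) (chordless xs ham)
        where
        J = a ∷ z ∷ us ++ b ∷ []
        a∈J : a ∈ toSet J
        a∈J = ∈-toSet⁺ {xs = J} (here refl)
        b∈J : b ∈ toSet J
        b∈J = ∈-toSet⁺ {xs = J} (there (there (∈-++⁺ʳ us (here refl))))
        a≢b : a ≢ b
        a≢b = Unique-split-≢ (a ∷ []) (Unique-++ʳ xs u) (here refl) (∈-++⁺ʳ (z ∷ us) (here refl))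
        fJ : F (toSet J)
        fJ = path⇒F a _ (F⇒⊆ fI a∈I) (Linked-++ˡ J (subst (Linked E)
               (cong (λ w → a ∷ z ∷ w) (sym (++-assoc us (b ∷ []) ws))) (Linked-++ʳ xs l)))
        ends : ∀ {v} → v ∈ₗ J → v ∈ I → v ∈ pair a b
        ends (here refl) _ = ∈-pairˡ
        ends (there v∈) v∈I with ∈-++⁻ (z ∷ us) v∈
        ... | inj₁ v∈zus       = contradiction v∈I (All.lookup ∉I v∈zus)
        ... | inj₂ (here refl) = ∈-pairʳ
        pair∈F : F (pair a b)
        pair∈F with ⊆-or-∃ I (toSet J)
        -- Here `I` does not overlap `J`, but is itself the pair.
        ... | inj₁ I⊆J = subst F (⊆-antisym (λ v∈I → ends (∈-toSet⁻ (I⊆J v∈I)) v∈I) (pair-⊆ a∈I b∈I)) fI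
        ... | inj₂ out = subst F
          (⊆-antisym (λ v∈ → let v∈I , v∈J = x∈p∩q⁻ I (toSet J) v∈ in ends (∈-toSet⁻ v∈J) v∈I)
                     (pair-⊆ (x∈p∩q⁺ (a∈I , a∈J)) (x∈p∩q⁺ (b∈I , b∈J))))
          (∩-closed fI fJ ((a , a∈I , a∈J) , out , (z , ∈-toSet⁺ {xs = J} (there (here refl)) , z∉I)))

      Segment⇒F : ∀ {p I} → Path p → Nonempty I → Segment p I → F I
      Segment⇒F (_ , p⊆K , l) ne (xs , [] , zs , refl , refl) =
        contradiction (∈-toSet⁻ (proj₂ ne)) λ ()
      Segment⇒F (_ , p⊆K , l) ne (xs , y ∷ ys , zs , refl , refl) =
        path⇒F y ys (All.lookup p⊆K (∈-++⁺ʳ xs (here refl))) (Linked-++ˡ (y ∷ ys) (Linked-++ʳ xs l))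

  abstract
    shape : Shape K F
    shape with any? (λ x → any? λ y → ¬? (x ≟ y) ×-dec anySubset? λ A →
                     F? A ×-dec (A ⊂? K) ×-dec x ∈? A ×-dec y ∈? A)
    ... | no ¬nt = prime λ {I} fI → small fI
      where
      small : ∀ {I} → F I → (∃ λ a → I ≡ ⁅ a ⁆) ⊎ I ≡ K
      small {I} fI with ⊆⇒≡⊎⊂ (F⇒⊆ fI)
      ... | inj₁ I≡K = inj₂ I≡K
      ... | inj₂ I⊂K = let x , x∈I = nonempty fI in inj₁ (x , ⊆-antisym
        (λ {y} y∈I → subst (_∈ ⁅ x ⁆)
          (decidable-stable (x ≟ y) λ x≢y → ¬nt (x , y , x≢y , I , fI , I⊂K , x∈I , y∈I)) (x∈⁅x⁆ x))
        (⁅⁆-⊆ x∈I))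
    ... | yes (x , y , x≢y , A , fA , A⊂K , x∈A , y∈A) = main
      where
      open Connected fA (x , y , x∈A , y∈A , x≢y) A⊂K
      main : Shape K F
      main with AllAdjacent?
      ... | yes adj = complete (all-adjacent⇒complete adj)
      ... | no ¬adj with Sparse.hamiltonian ¬adj
      ...   | p , ham@(path@(u , p⊆K , _) , full) =
        linear p u (λ v → mk⇔ (All.lookup p⊆K) full)
          (λ ne → mk⇔ (Sparse.F⇒Segment ¬adj ham) (Sparse.Segment⇒F ¬adj path ne))

_≟ₛ_ : ∀ {n} (A B : Subset n) → Dec (A ≡ B)
_≟ₛ_ = ≡-dec Bool._≟_

-- Strong members and the tree they form

module Rooted {n} (r : Fin n) {F : Pred (Subset n) 0ℓ} (W : WeaklyPartitive (∁ ⁅ r ⁆) F) where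

  open WeaklyPartitive W public

  private
    variable
      D : Subset n

  r∉ : F A → r ∉ A
  r∉ fA r∈A = x∈∁p⇒x∉p (F⇒⊆ fA r∈A) (x∈⁅x⁆ r)

  StrongMember : Pred (Subset n) 0ℓ
  StrongMember A = F A × (∀ {B} → F B → ¬ A ≬ B)

  crossing-or-strong : F A → (∃ λ B → F B × A ≬ B) ⊎ StrongMember A
  crossing-or-strong {A} fA with anySubset? (λ B → F? B ×-dec (A ≬? B))
  ... | yes c = inj₁ c
  ... | no ¬c = inj₂ (fA , λ fB o → ¬c (_ , fB , o))

  strong? : Decidable StrongMember
  strong? A with F? A
  ... | no ¬f = no (¬f ∘ proj₁)
  ... | yes f with crossing-or-strong f
  ...   | inj₁ (B , fB , o) = no λ s → proj₂ s fB o
  ...   | inj₂ s = yes s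

  -- The vertices of the tree: strong members, i.e. edges identified with
  -- their ends away from r, and X for the leaf r.
  Node : Pred (Subset n) 0ℓ
  Node A = A ≡ ⊤ ⊎ StrongMember A

  node? : Decidable Node
  node? A = (A ≟ₛ ⊤) ⊎-dec strong? A

  node-nonempty : Node A → Nonempty A
  node-nonempty (inj₁ refl)    = r , ∈⊤
  node-nonempty (inj₂ (f , _)) = nonempty f

  laminar : ∀ {x} → Node A → Node B → x ∈ A → x ∈ B → A ⊆ B ⊎ B ⊆ A
  laminar _ (inj₁ refl) _ _ = inj₁ λ _ → ∈⊤
  laminar (inj₁ refl) _ _ _ = inj₂ λ _ → ∈⊤
  laminar (inj₂ (_ , s)) (inj₂ (fB , _)) = ¬≬⇒⊆⊎⊇ (s fB)

  node-r : Node A → r ∈ A → A ≡ ⊤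
  node-r (inj₁ eq) _ = eq
  node-r (inj₂ (f , _)) r∈A = contradiction r∈A (r∉ f)

  ⊂⇒strong : Node A → A ⊂ B → StrongMember A
  ⊂⇒strong (inj₁ refl) (_ , _ , _ , x∉⊤) = contradiction ∈⊤ x∉⊤
  ⊂⇒strong (inj₂ s) _ = s

  singleton-node : ∀ {x} → x ≢ r → Node ⁅ x ⁆
  singleton-node {x} x≢r =
    inj₂ (singleton (x∉p⇒x∈∁p (x≢r ∘ x∈⁅y⁆⇒x≡y r)) ,
      λ { _ ((y , y∈x , y∈B) , (z , z∈x , z∉B) , _) →
          z∉B (subst (_∈ _) (trans (x∈⁅y⁆⇒x≡y x y∈x) (sym (x∈⁅y⁆⇒x≡y x z∈x))) y∈B) })

  whole-node : Node (∁ ⁅ r ⁆)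
  whole-node = inj₂ (whole , λ fB o → let _ , _ , x , x∈B , x∉ = o in x∉ (F⇒⊆ fB x∈B))

  infix 4 _⋖_

  -- Covering in the form suited to a laminar family: the nodes above a nonempty set form a chain,
  -- so `B` is required to be least, not just minimal. The lower set may be any member; `home` uses
  -- this for members that are not strong.
  _⋖_ : Rel (Subset n) 0ℓ
  A ⋖ B = A ⊂ B × (∀ {C} → Node C → A ⊂ C → B ⊆ C)

  _⋖?_ : ∀ A B → Dec (A ⋖ B)
  A ⋖? B with A ⊂? B
  ... | no ¬A⊂B = no (¬A⊂B ∘ proj₁)
  ... | yes A⊂B with anySubset? (λ C → node? C ×-dec (A ⊂? C) ×-dec ¬? (B ⊆? C))
  ...   | yes (C , nC , A⊂C , ¬B⊆C) = no λ c → ¬B⊆C (proj₂ c nC A⊂C)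
  ...   | no ¬C = yes (A⊂B , λ {C} nC A⊂C {x} x∈B →
            decidable-stable (B ⊆? C) (λ ¬B⊆C → ¬C (C , nC , A⊂C , ¬B⊆C)) x∈B)

  abstract
    least-above : Nonempty A → r ∉ A → ∃ λ B → Node B × A ⋖ B
    least-above {A} (x , x∈A) r∉A
      with minimal (λ B → node? B ×-dec (A ⊂? B)) {⊤} (inj₁ refl , (λ _ → ∈⊤) , r , ∈⊤ , r∉A)
    ... | B , (nB , A⊂B) , _ , min = B , nB , A⊂B , least
      where
      least : ∀ {C} → Node C → A ⊂ C → B ⊆ C
      least nC A⊂C with laminar nB nC (proj₁ A⊂B x∈A) (proj₁ A⊂C x∈A)
      ... | inj₁ B⊆C = B⊆C
      ... | inj₂ C⊆B = ⊆-reflexive (sym (min (nC , A⊂C) C⊆B))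

    child : ∀ {x} → Node D → Nontrivial D → x ∈ D → x ≢ r → ∃ λ C → Node C × C ⋖ D × x ∈ C
    child {D} {x} nD (u , v , u∈D , v∈D , u≢v) x∈D x≢r
      with maximal (λ C → node? C ×-dec (C ⊂? D) ×-dec (x ∈? C))
                   {⁅ x ⁆} (singleton-node x≢r , single⊂ , x∈⁅x⁆ x)
      where
      single⊂ : ⁅ x ⁆ ⊂ D
      single⊂ with u ≟ x
      ... | no u≢x   = ⁅⁆-⊆ x∈D , u , u∈D , u≢x ∘ x∈⁅y⁆⇒x≡y x
      ... | yes refl = ⁅⁆-⊆ x∈D , v , v∈D , u≢v ∘ sym ∘ x∈⁅y⁆⇒x≡y x
    ... | C , (nC , C⊂D , x∈C) , _ , max = C , nC , (C⊂D , least) , x∈C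
      where
      least : ∀ {E} → Node E → C ⊂ E → D ⊆ E
      least nE C⊂E with laminar nD nE x∈D (proj₁ C⊂E x∈C)
      ... | inj₁ D⊆E = D⊆E
      ... | inj₂ E⊆D with ⊆⇒≡⊎⊂ E⊆D
      ...   | inj₁ refl = λ z → z
      ...   | inj₂ E⊂D  = contradiction C⊂E (⊂-irref (max (nE , E⊂D , proj₁ C⊂E x∈C) (proj₁ C⊂E)))

  ⋖-unique : Node B → Node C → A ⋖ B → A ⋖ C → B ≡ C
  ⋖-unique nB nC (A⊂B , minB) (A⊂C , minC) = ⊆-antisym (minB nC A⊂C) (minC nB A⊂B)

  siblings : ∀ {x} → Node A → Node B → A ⋖ D → B ⋖ D → x ∈ A → x ∈ B → A ≡ B
  siblings {A} {B} nA nB A⋖D B⋖D x∈A x∈B with laminar nA nB x∈A x∈B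
  ... | inj₁ A⊆B with ⊆⇒≡⊎⊂ A⊆B
  ...   | inj₁ A≡B = A≡B
  ...   | inj₂ A⊂B = ⊥-elim (⊂-irref refl (⊂-⊆-trans (proj₁ B⋖D) (proj₂ A⋖D nB A⊂B)))
  siblings nA nB A⋖D B⋖D x∈A x∈B | inj₂ B⊆A with ⊆⇒≡⊎⊂ B⊆A
  ...   | inj₁ B≡A = sym B≡A
  ...   | inj₂ B⊂A = ⊥-elim (⊂-irref refl (⊂-⊆-trans (proj₁ A⋖D) (proj₂ B⋖D nA B⊂A)))

  ⊆-node : Node A → Node B → A ⋖ D → A ⊆ B → B ≢ A → D ⊆ B
  ⊆-node nA nB (_ , least) A⊆B B≢A with ⊆⇒≡⊎⊂ A⊆B
  ... | inj₁ A≡B = contradiction (sym A≡B) B≢A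
  ... | inj₂ A⊂B = least nB A⊂B

  -- Bipartitions and their sides away from `r`

  module Sides (𝓑 : Pred (Bipartition n) 0ℓ)
    (𝓑⇒F : ∀ {b} → 𝓑 b → F (Bipartition.part b) ⊎ F (∁ (Bipartition.part b)))
    (F⇒𝓑 : ∀ {b} → F (Bipartition.part b) ⊎ F (∁ (Bipartition.part b)) → 𝓑 b) where

    open Bipartition

    abstract
      side : Bipartition n → Subset n
      side b with r ∈? part b
      ... | yes _ = ∁ (part b)
      ... | no  _ = part b

      side-part : ∀ b → side b ≡ part b ⊎ side b ≡ ∁ (part b)
      side-part b with r ∈? part b
      ... | yes _ = inj₂ refl
      ... | no  _ = inj₁ refl

      r∉side : ∀ b → r ∉ side b
      r∉side b with r ∈? part b
      ... | yes r∈ = x∈p⇒x∉∁p r∈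
      ... | no r∉ = r∉

    side-nonempty : ∀ b → Nonempty (side b)
    side-nonempty b with side-part b
    ... | inj₁ eq = subst Nonempty (sym eq) (part-nonempty b)
    ... | inj₂ eq = subst Nonempty (sym eq) (∁part-nonempty b)

    side-unique : ∀ b {A} → r ∉ A → A ≡ part b ⊎ A ≡ ∁ (part b) → A ≡ side b
    side-unique b r∉A A≡ with A≡ | side-part b
    ... | inj₁ refl | inj₁ eq = sym eq
    ... | inj₂ refl | inj₂ eq = sym eq
    ... | inj₁ refl | inj₂ eq = contradiction (subst (r ∈_) (sym eq) (x∉p⇒x∈∁p r∉A)) (r∉side b)
    ... | inj₂ refl | inj₁ eq = contradiction (subst (r ∈_) (sym eq) (x∉∁p⇒x∈p r∉A)) (r∉side b)

    ≈⇒side≡ : ∀ {b c} → b ≈ c → side b ≡ side c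
    ≈⇒side≡ {b} {c} b≈c = side-unique c (r∉side b) (go b≈c (side-part b))
      where
      go : b ≈ c → side b ≡ part b ⊎ side b ≡ ∁ (part b) → side b ≡ part c ⊎ side b ≡ ∁ (part c)
      go (inj₁ p) (inj₁ q) = inj₁ (trans q p)
      go (inj₁ p) (inj₂ q) = inj₂ (trans q (cong ∁ p))
      go (inj₂ p) (inj₁ q) = inj₂ (trans q p)
      go (inj₂ p) (inj₂ q) = inj₁ (trans q (trans (cong ∁ p) (∁-involutive _)))

    side≡⇒≈ : ∀ {b c} → side b ≡ side c → b ≈ c
    side≡⇒≈ {b} {c} eq with side-part b | side-part c
    ... | inj₁ p | inj₁ q = inj₁ (trans (sym p) (trans eq q))
    ... | inj₁ p | inj₂ q = inj₂ (trans (sym p) (trans eq q))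
    ... | inj₂ p | inj₁ q = inj₂ (trans (sym (∁-involutive _)) (cong ∁ (trans (sym p) (trans eq q))))
    ... | inj₂ p | inj₂ q = inj₁ (trans (sym (∁-involutive _))
                              (trans (cong ∁ (trans (sym p) (trans eq q))) (∁-involutive _)))

    𝓑⇒F-side : ∀ {b} → 𝓑 b → F (side b)
    𝓑⇒F-side {b} ∈𝓑 with 𝓑⇒F ∈𝓑
    ... | inj₁ f = subst F (side-unique b (r∉ f) (inj₁ refl)) f
    ... | inj₂ f = subst F (side-unique b (r∉ f) (inj₂ refl)) f

    F-side⇒𝓑 : ∀ {b} → F (side b) → 𝓑 b
    F-side⇒𝓑 {b} f with side-part b
    ... | inj₁ eq = F⇒𝓑 (inj₁ (subst F eq f))
    ... | inj₂ eq = F⇒𝓑 (inj₂ (subst F eq f))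

    split : F A → Bipartition n
    split {A} f = record
      { part = A ; part-nonempty = nonempty f ; ∁part-nonempty = r , x∉p⇒x∈∁p (r∉ f) }

    side-split : (f : F A) → side (split f) ≡ A
    side-split f = sym (side-unique (split f) (r∉ f) (inj₁ refl))

    overlap⇒≬ : ∀ b c → Overlap b c → side b ≬ side c
    overlap⇒≬ b c ((w , w∈) , (x , x∈) , (y , y∈) , (z , z∈)) with side-part b | side-part c
    ... | inj₁ p | inj₁ q rewrite p | q =
      (w , x∈p∩q⁻ _ _ w∈) , (x , ∈∩∁⁻ x∈) ,
      (y , let y∈∁ , y∈c = x∈p∩q⁻ (∁ (part b)) (part c) y∈ in y∈c , x∈∁p⇒x∉p y∈∁)
    ... | inj₁ p | inj₂ q rewrite p | q =
      (x , x∈p∩q⁻ _ _ x∈) , (w , let w∈b , w∈c = x∈p∩q⁻ (part b) (part c) w∈ in w∈b , λ w∈∁ → x∈∁p⇒x∉p w∈∁ w∈c) ,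
      (z , let z∈∁ , z∈c = x∈p∩q⁻ (∁ (part b)) (∁ (part c)) z∈ in z∈c , x∈∁p⇒x∉p z∈∁)
    ... | inj₂ p | inj₁ q rewrite p | q =
      (y , x∈p∩q⁻ _ _ y∈) , (z , ∈∩∁⁻ z∈) ,
      (w , let w∈b , w∈c = x∈p∩q⁻ (part b) (part c) w∈ in w∈c , λ w∈∁ → x∈∁p⇒x∉p w∈∁ w∈b)
    ... | inj₂ p | inj₂ q rewrite p | q =
      (z , x∈p∩q⁻ _ _ z∈) ,
      (y , let y∈b , y∈c = x∈p∩q⁻ (∁ (part b)) (part c) y∈ in y∈b , λ y∈∁ → x∈∁p⇒x∉p y∈∁ y∈c) ,
      (x , let x∈b , x∈c = x∈p∩q⁻ (part b) (∁ (part c)) x∈ in x∈c , λ x∈∁ → x∈∁p⇒x∉p x∈∁ x∈b)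

    ≬⇒overlap : ∀ {b B} → side b ≬ B → (f : F B) → Overlap b (split f)
    ≬⇒overlap {b} {B} ((w , w∈b , w∈B) , (x , x∈b , x∉B) , (y , y∈B , y∉b)) f
      with side-part b | r∉side b
    ... | inj₁ p | r∉b rewrite p =
      (w , x∈p∩q⁺ (w∈b , w∈B)) , (x , ∈∩∁⁺ x∈b x∉B) , (y , x∈p∩q⁺ (x∉p⇒x∈∁p y∉b , y∈B)) ,
      (r , x∈p∩q⁺ (x∉p⇒x∈∁p r∉b , x∉p⇒x∈∁p (r∉ f)))
    ... | inj₂ p | r∉b rewrite p =
      (y , x∈p∩q⁺ (x∉∁p⇒x∈p y∉b , y∈B)) , (r , ∈∩∁⁺ (x∉∁p⇒x∈p r∉b) (r∉ f)) , (w , x∈p∩q⁺ (w∈b , w∈B)) ,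
      (x , ∈∩∁⁺ x∈b x∉B)

    strong⇒ : ∀ {b} → Strong 𝓑 b → StrongMember (side b)
    strong⇒ {b} (∈𝓑 , s) = 𝓑⇒F-side ∈𝓑 , λ fB o →
      s (split fB) (F⇒𝓑 (inj₁ fB)) (≬⇒overlap {b} o fB)

    strong⇐ : ∀ {b} → StrongMember (side b) → Strong 𝓑 b
    strong⇐ {b} (f , s) = F-side⇒𝓑 f , λ c ∈𝓑 o → s (𝓑⇒F-side ∈𝓑) (overlap⇒≬ b c o)

-- Enumeration of subsets and lists of neighbours

subsets : ∀ n → List (Subset n)
subsets ℕ.zero    = [] ∷ []
subsets (ℕ.suc n) = map (true ∷_) (subsets n) ++ map (false ∷_) (subsets n)

∈-subsets : ∀ {n} (A : Subset n) → A ∈ₗ subsets n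
∈-subsets []          = here refl
∈-subsets (true  ∷ A) = ∈-++⁺ˡ (∈-map⁺ (true ∷_) (∈-subsets A))
∈-subsets (false ∷ A) = ∈-++⁺ʳ _ (∈-map⁺ (false ∷_) (∈-subsets A))

subsets-unique : ∀ n → Unique (subsets n)
subsets-unique ℕ.zero    = [] ∷ []
subsets-unique (ℕ.suc n) =
  Unique.++⁺ (Unique.map⁺ ∷-injectiveʳ (subsets-unique n)) (Unique.map⁺ ∷-injectiveʳ (subsets-unique n))
    λ (∈t , ∈f) → let _ , _ , p = ∈-map⁻ (true ∷_) ∈t ; _ , _ , q = ∈-map⁻ (false ∷_) ∈f in
                  true≢false (trans (sym p) q)
  where
  true≢false : ∀ {n} {A B : Subset n} → true ∷ A ≡ false ∷ B → ⊥
  true≢false ()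

length≡1⁺ : ∀ {X : Set} {xs : List X} {x} → Unique xs → x ∈ₗ xs → (∀ {y} → y ∈ₗ xs → y ≡ x) → length xs ≡ 1
length≡1⁺ {xs = _ ∷ []}    _ _ _ = refl
length≡1⁺ {xs = _ ∷ _ ∷ _} ((y≢z ∷ _) ∷ _) _ eq =
  contradiction (trans (eq (here refl)) (sym (eq (there (here refl))))) y≢z

length≡1⁻ : ∀ {X : Set} {xs : List X} {x y} → length xs ≡ 1 → x ∈ₗ xs → y ∈ₗ xs → x ≡ y
length≡1⁻ {xs = _ ∷ []} _ (here refl) (here refl) = refl

module Neighbours (G : Graph) where
  open Graph G

  ∈-neighbours⁺ : ∀ {u v} → u ~ v → v ∈ₗ neighbours u
  ∈-neighbours⁺ {u} u~v = ∈-filter⁺ (u ~?_) (∈-allFin _) u~v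

  ∈-neighbours⁻ : ∀ {u v} → v ∈ₗ neighbours u → u ~ v
  ∈-neighbours⁻ {u} v∈ = proj₂ (∈-filter⁻ (u ~?_) {xs = allFin _} v∈)

  neighbours-unique : ∀ u → Unique (neighbours u)
  neighbours-unique u = Unique.filter⁺ (u ~?_) (Unique.allFin⁺ _)

-- The tree of strong members

module Tree {n} (r : Fin n) {F : Pred (Subset n) 0ℓ} (W : WeaklyPartitive (∁ ⁅ r ⁆) F) where

  open Rooted r W public

  abstract
    nodes : List (Subset n)
    nodes = filter node? (subsets n)

    nodes-unique : Unique nodes
    nodes-unique = Unique.filter⁺ node? (subsets-unique n)

    ∈-nodes⁺ : ∀ {A} → Node A → A ∈ₗ nodes
    ∈-nodes⁺ nA = ∈-filter⁺ node? (∈-subsets _) nA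

    ∈-nodes⁻ : ∀ {A} → A ∈ₗ nodes → Node A
    ∈-nodes⁻ A∈ = proj₂ (∈-filter⁻ node? {xs = subsets n} A∈)

  Vertex : Set
  Vertex = Fin (length nodes)

  set : Vertex → Subset n
  set = lookup nodes

  set-injective : ∀ {u v} → set u ≡ set v → u ≡ v
  set-injective = lookup-injective nodes-unique

  set-node : ∀ v → Node (set v)
  set-node v = ∈-nodes⁻ (∈-lookup v)

  abstract
    find : ∀ {A} → Node A → ∃ λ v → set v ≡ A
    find nA = Any.index (∈-nodes⁺ nA) , sym (lookup-index (∈-nodes⁺ nA))

  ⊆⇒≡⊎⊂ᵥ : ∀ {u v} → set u ⊆ set v → u ≡ v ⊎ set u ⊂ set v
  ⊆⇒≡⊎⊂ᵥ u⊆v = [ inj₁ ∘ set-injective , inj₂ ]′ (⊆⇒≡⊎⊂ u⊆v)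

  private
    variable
      u v w c p N : Vertex

  parent : r ∉ set v → ∃ λ p → set v ⋖ set p
  parent {v} r∉v with least-above (node-nonempty (set-node v)) r∉v
  ... | B , nB , v⋖B with find nB
  ...   | p , refl = p , v⋖B

  parent-unique : set v ⋖ set u → set v ⋖ set w → u ≡ w
  parent-unique v⋖u v⋖w = set-injective (⋖-unique (set-node _) (set-node _) v⋖u v⋖w)

  ⋖⇒r∉ : set v ⋖ set p → r ∉ set v
  ⋖⇒r∉ v⋖p = r∉ (proj₁ (⊂⇒strong (set-node _) (proj₁ v⋖p)))

  ⋖-irrefl : ¬ set v ⋖ set v
  ⋖-irrefl = ⊂-irref refl ∘ proj₁

  graph : Graph
  graph = record
    { #vertices = length nodes
    ; _~_       = λ u v → set u ⋖ set v ⊎ set v ⋖ set u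
    ; _~?_      = λ u v → (set u ⋖? set v) ⊎-dec (set v ⋖? set u)
    ; ~-sym     = swap
    ; ~-irrefl  = λ { refl → [ ⋖-irrefl , ⋖-irrefl ]′ }
    }

  open Graph graph hiding (Vertex) public
  open Neighbours graph public

  -- An upward step that stays between `u` and `v`. The bounds travel with the walk, so that walks
  -- produced by `climb` can be seen to avoid a given vertex or edge.
  Between : Vertex → Vertex → Rel Vertex 0ℓ
  Between u v a b = set a ⋖ set b × set u ⊆ set a × set b ⊆ set v

  climb : set u ⊆ set v → Star (Between u v) u v
  climb {u} {v} u⊆v = go (⊃-wellFounded (set u)) (λ z → z) u⊆v
    where
    go : ∀ {w} → Acc (λ B C → C ⊂ B) (set w) → set u ⊆ set w → set w ⊆ set v → Star (Between u v) w v
    go {w} (acc rs) u⊆w w⊆v with ⊆⇒≡⊎⊂ᵥ w⊆v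
    ... | inj₁ refl = ε
    ... | inj₂ w⊂v with parent (r∉ (proj₁ (⊂⇒strong (set-node w) w⊂v)))
    ...   | p , w⋖p = (w⋖p , u⊆w , p⊆v) ◅ go (rs (proj₁ w⋖p)) (⊆-trans u⊆w (proj₁ (proj₁ w⋖p))) p⊆v
      where
      p⊆v : set p ⊆ set v
      p⊆v = proj₂ w⋖p (set-node v) w⊂v

  top : Vertex
  top = proj₁ (find (inj₁ refl))

  set-top : set top ≡ ⊤
  set-top = proj₂ (find (inj₁ refl))

  ⊆top : ∀ v → set v ⊆ set top
  ⊆top v {x} _ = subst (x ∈_) (sym set-top) ∈⊤

  connected : Connected
  connected u v = Star.map (inj₁ ∘ proj₁) (climb (⊆top u)) ◅◅
                  reverse swap (Star.map (inj₁ ∘ proj₁) (climb (⊆top v)))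

  -- A vertex below `N` other than `N` has its parent below `N` as well, so the edge from `N` to `p`
  -- is the only one that leaves the subtree of `N`.
  step-out : set N ⋖ set p → u ~ v → set u ⊈ set N → set v ⊈ set N ⊎ (v ≡ N × u ≡ p)
  step-out N⋖p (inj₁ u⋖v) u⊈N = inj₁ λ v⊆N → u⊈N (⊆-trans (proj₁ (proj₁ u⋖v)) v⊆N)
  step-out {N} {v = v} N⋖p (inj₂ v⋖u) u⊈N with v ≟ N
  ... | yes refl = inj₂ (refl , parent-unique v⋖u N⋖p)
  ... | no v≢N   = inj₁ λ v⊆N →
    u⊈N (⊆-node (set-node v) (set-node N) v⋖u v⊆N (v≢N ∘ set-injective ∘ sym))

  step-in : set N ⋖ set p → u ~ v → set u ⊆ set N → set v ⊆ set N ⊎ (u ≡ N × v ≡ p)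
  step-in {N} {v = v} N⋖p u~v u⊆N with set v ⊆? set N
  ... | yes v⊆N = inj₁ v⊆N
  ... | no v⊈N with step-out N⋖p (~-sym u~v) v⊈N
  ...   | inj₁ u⊈N = ⊥-elim (u⊈N u⊆N)
  ...   | inj₂ eqs = inj₂ eqs

  ⋖⇒⊈ : set v ⋖ set p → set p ⊈ set v
  ⋖⇒⊈ ((_ , _ , x∈p , x∉v) , _) p⊆v = x∉v (p⊆v x∈p)

  stays-below : set c ⋖ set N → Star (_-node_ N) u v → set u ⊆ set c → set v ⊆ set c
  stays-below c⋖N ε u⊆c = u⊆c
  stays-below c⋖N ((u~w , _ , w≢N) ◅ s) u⊆c with step-in c⋖N u~w u⊆c
  ... | inj₁ w⊆c       = stays-below c⋖N s w⊆c
  ... | inj₂ (_ , w≡N) = contradiction w≡N w≢N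

  stays-outside : set N ⋖ set p → Star (_-node_ N) u v → set u ⊈ set N → set v ⊈ set N
  stays-outside N⋖p ε u⊈N = u⊈N
  stays-outside N⋖p ((u~w , _ , w≢N) ◅ s) u⊈N with step-out N⋖p u~w u⊈N
  ... | inj₁ w⊈N       = stays-outside N⋖p s w⊈N
  ... | inj₂ (w≡N , _) = contradiction w≡N w≢N

  below-component : set c ⋖ set N → set v ⊆ set c → Star (_-node_ N) c v
  below-component {c} {N} {v} c⋖N v⊆c =
    reverse (λ (a~b , a≢N , b≢N) → ~-sym a~b , b≢N , a≢N) (Star.map step (climb v⊆c))
    where
    ≢N : ∀ {w} → set w ⊆ set c → w ≢ N
    ≢N w⊆c refl = ⋖⇒⊈ c⋖N w⊆c
    step : ∀ {a b} → Between v c a b → (_-node_ N) a b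
    step (a⋖b , _ , b⊆c) = inj₁ a⋖b , ≢N (⊆-trans (proj₁ (proj₁ a⋖b)) b⊆c) , ≢N b⊆c

  -- All ancestors of a vertex not below `N` differ from `N`, so `p` and `v` are joined through
  -- `top`.
  outside-component : set N ⋖ set p → set v ⊈ set N → Star (_-node_ N) p v
  outside-component {N} {p} {v} N⋖p v⊈N =
    rise (⋖⇒⊈ N⋖p) ◅◅ reverse (λ (a~b , a≢N , b≢N) → ~-sym a~b , b≢N , a≢N) (rise v⊈N)
    where
    rise : ∀ {w} → set w ⊈ set N → Star (_-node_ N) w top
    rise {w} w⊈N = Star.map
      (λ (a⋖b , w⊆a , _) → inj₁ a⋖b , (λ { refl → w⊈N w⊆a }) ,
                           λ { refl → w⊈N (⊆-trans w⊆a (proj₁ (proj₁ a⋖b))) })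
      (climb (⊆top w))

  -- Once a walk without repetition goes down, it never goes up again.
  descend : ∀ {x a b} bs → set b ⋖ set a → Unique (x ∷ a ∷ b ∷ bs) → Linked _~_ (b ∷ bs ∷ʳ x) → set x ⊂ set b
  descend [] b⋖a ((x≢a ∷ _) ∷ _) (inj₁ b⋖x ∷ _) = contradiction (parent-unique b⋖x b⋖a) x≢a
  descend [] _ _ (inj₂ x⋖b ∷ _) = proj₁ x⋖b
  descend (c ∷ bs) b⋖a (_ ∷ (_ ∷ a≢c ∷ _) ∷ _) (inj₁ b⋖c ∷ _) = contradiction (parent-unique b⋖a b⋖c) a≢c
  descend (c ∷ bs) b⋖a ((_ ∷ x≢) ∷ _ ∷ u) (inj₂ c⋖b ∷ l) = ⊂-trans (descend bs c⋖b (x≢ ∷ u) l) (proj₁ c⋖b)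

  siblingsᵥ : ∀ {a b x} → set a ⋖ set c → set b ⋖ set c → set x ⊆ set a → set x ⊆ set b → a ≡ b
  siblingsᵥ {x = x} a⋖c b⋖c x⊆a x⊆b =
    let y , y∈x = node-nonempty (set-node x)
    in set-injective (siblings (set-node _) (set-node _) a⋖c b⋖c (x⊆a y∈x) (x⊆b y∈x))

  -- The walk has to close up at `x`, which lies below `a`. If it only rises, it ends strictly above
  -- `x` or enters `x` from its parent as a sibling of `a`. At its first turn down it enters a child
  -- `c` of `b` other than `a`; by `descend` it never rises again, so `x` lies below `c` too,
  -- against the disjointness of siblings.
  no-ascent : ∀ {x a b} bs → set x ⊆ set a → set a ⋖ set b → Unique (x ∷ a ∷ b ∷ bs) →
              ¬ Linked _~_ (b ∷ bs ∷ʳ x)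
  no-ascent [] x⊆a a⋖b _ (inj₁ b⋖x ∷ _) =
    ⊂-irref refl (⊆-⊂-trans x⊆a (⊂-trans (proj₁ a⋖b) (proj₁ b⋖x)))
  no-ascent [] x⊆a a⋖b ((x≢a ∷ _) ∷ _) (inj₂ x⋖b ∷ _) = x≢a (siblingsᵥ x⋖b a⋖b (λ z → z) x⊆a)
  no-ascent (c ∷ bs) x⊆a a⋖b ((_ ∷ x≢) ∷ _ ∷ u) (inj₁ b⋖c ∷ l) =
    no-ascent bs (⊆-trans x⊆a (proj₁ (proj₁ a⋖b))) b⋖c (x≢ ∷ u) l
  no-ascent (c ∷ bs) x⊆a a⋖b ((_ ∷ x≢) ∷ (_ ∷ a≢c ∷ _) ∷ u) (inj₂ c⋖b ∷ l) =
    a≢c (siblingsᵥ a⋖b c⋖b x⊆a (proj₁ (descend bs c⋖b (x≢ ∷ u) l)))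

  -- The first two steps decide. Down and up returns to the same vertex; down twice never comes back
  -- up; up twice is `no-ascent`; up and down enters a sibling of `u` that would have to contain it.
  acyclic : Acyclic
  acyclic u v w vs ((_ ∷ u≢w ∷ _) ∷ _) (inj₂ v⋖u ∷ inj₁ v⋖w ∷ _) = u≢w (parent-unique v⋖u v⋖w)
  acyclic u v w vs uniq (inj₂ v⋖u ∷ inj₂ w⋖v ∷ l) =
    ⊂-irref refl (⊂-trans (descend vs w⋖v uniq l) (⊂-trans (proj₁ w⋖v) (proj₁ v⋖u)))
  acyclic u v w vs uniq (inj₁ u⋖v ∷ inj₁ v⋖w ∷ l) = no-ascent vs (proj₁ (proj₁ u⋖v)) v⋖w uniq l
  acyclic u v w vs uniq@((_ ∷ u≢w ∷ _) ∷ _) (inj₁ u⋖v ∷ inj₂ w⋖v ∷ l) =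
    u≢w (siblingsᵥ u⋖v w⋖v (λ z → z) (proj₁ (descend vs w⋖v uniq l)))

  abstract
    leaf-vertex : ∀ x → ∃ λ v → (x ≡ r × set v ≡ ⊤) ⊎ (x ≢ r × set v ≡ ⁅ x ⁆)
    leaf-vertex x with x ≟ r
    ... | yes x≡r = let v , eq = find (inj₁ refl) in v , inj₁ (x≡r , eq)
    ... | no x≢r  = let v , eq = find (singleton-node x≢r) in v , inj₂ (x≢r , eq)

  leaf : Fin n → Vertex
  leaf x = proj₁ (leaf-vertex x)

  set-leaf : ∀ x → (x ≡ r × set (leaf x) ≡ ⊤) ⊎ (x ≢ r × set (leaf x) ≡ ⁅ x ⁆)
  set-leaf x = proj₂ (leaf-vertex x)

  set-leaf-r : set (leaf r) ≡ ⊤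
  set-leaf-r with set-leaf r
  ... | inj₁ (_ , eq)  = eq
  ... | inj₂ (r≢r , _) = contradiction refl r≢r

  ∈-set-leaf : ∀ x → x ∈ set (leaf x)
  ∈-set-leaf x with set-leaf x
  ... | inj₁ (_ , eq) = subst (x ∈_) (sym eq) ∈⊤
  ... | inj₂ (_ , eq) = subst (x ∈_) (sym eq) (x∈⁅x⁆ x)

  leaf⊆⁺ : ∀ {x} → r ∉ set v → x ∈ set v → set (leaf x) ⊆ set v
  leaf⊆⁺ {x = x} r∉v x∈v with set-leaf x
  ... | inj₁ (refl , _) = contradiction x∈v r∉v
  ... | inj₂ (_ , eq)   = λ y∈ → subst (_∈ _) (sym (x∈⁅y⁆⇒x≡y x (subst (_ ∈_) eq y∈))) x∈v

  leaf⊆⁻ : ∀ {x} → set (leaf x) ⊆ set v → x ∈ set v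
  leaf⊆⁻ {x = x} x⊆v = x⊆v (∈-set-leaf x)

  leaf-injective : Injective _≡_ _≡_ leaf
  leaf-injective {x} {y} eq with set-leaf x | set-leaf y
  ... | inj₁ (refl , _) | inj₁ (refl , _) = refl
  ... | _ | inj₂ (_ , p) = x∈⁅y⁆⇒x≡y y (subst (x ∈_) (trans (cong set eq) p) (∈-set-leaf x))
  ... | inj₂ (_ , p) | _ = sym (x∈⁅y⁆⇒x≡y x (subst (y ∈_) (trans (cong set (sym eq)) p) (∈-set-leaf y)))

  Internal : Pred Vertex 0ℓ
  Internal v = r ∉ set v × Nontrivial (set v)

  leaf-or-internal : ∀ v → (∃ λ x → leaf x ≡ v) ⊎ Internal v
  leaf-or-internal v with r ∈? set v
  ... | yes r∈v = inj₁ (r , set-injective (trans set-leaf-r (sym (node-r (set-node v) r∈v))))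
  ... | no r∉v with Nontrivial? (set v)
  ...   | yes nt = inj₂ (r∉v , nt)
  ...   | no ¬nt = let x , x∈v = node-nonempty (set-node v) in
    inj₁ (x , set-injective (⊆-antisym (leaf⊆⁺ r∉v x∈v) λ {y} y∈v →
      subst (_∈ set (leaf x)) (decidable-stable (x ≟ y) λ x≢y → ¬nt (x , y , x∈v , y∈v , x≢y)) (∈-set-leaf x)))

  childᵥ : ∀ {x} → Internal v → x ∈ set v → ∃ λ c → set c ⋖ set v × x ∈ set c
  childᵥ {v} (r∉v , nt) x∈v with child (set-node v) nt x∈v (λ { refl → r∉v x∈v })
  ... | C , nC , C⋖v , x∈C with find nC
  ...   | c , refl = c , C⋖v , x∈C

  whole⋖⊤ : ∁ ⁅ r ⁆ ⋖ ⊤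
  whole⋖⊤ = ((λ _ → ∈⊤) , r , ∈⊤ , λ r∈ → x∈∁p⇒x∉p r∈ (x∈⁅x⁆ r)) ,
    λ { nC (_ , x , x∈C , x∉) → ⊆-reflexive (sym (node-r nC
          (subst (_∈ _) (x∈⁅y⁆⇒x≡y r (x∉∁p⇒x∈p x∉)) x∈C))) }

  -- With `whole⋖⊤` this leaves the vertex labelled `r` a single neighbour, so that it is a leaf.
  ⋖⊤ : ∀ {A} → Node A → A ⋖ ⊤ → A ≡ ∁ ⁅ r ⁆
  ⋖⊤ nA (A⊂⊤ , least) with ⊆⇒≡⊎⊂ (F⇒⊆ (proj₁ (⊂⇒strong nA A⊂⊤)))
  ... | inj₁ eq = eq
  ... | inj₂ A⊂ = contradiction (least whole-node A⊂ ∈⊤) (proj₂ (proj₂ (proj₂ (proj₁ whole⋖⊤))))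

  unique-neighbour : ∀ {v w} → v ~ w → (∀ {u} → v ~ u → u ≡ w) → Leaf v
  unique-neighbour {v} v~w only = length≡1⁺ (neighbours-unique v) (∈-neighbours⁺ v~w) (only ∘ ∈-neighbours⁻)

  leaf-Leaf : ∀ x → Leaf (leaf x)
  leaf-Leaf x with set-leaf x
  ... | inj₁ (refl , eq) with find whole-node
  ...   | w , weq = unique-neighbour {leaf r} {w}
    (inj₂ (subst (_⋖ _) (sym weq) (subst (_ ⋖_) (sym eq) whole⋖⊤)))
    λ { {u} (inj₁ t⋖u) → contradiction (subst (r ∈_) (sym eq) ∈⊤) (⋖⇒r∉ t⋖u)
      ; {u} (inj₂ u⋖t) → set-injective (trans (⋖⊤ (set-node _) (subst (set u ⋖_) eq u⋖t)) (sym weq)) }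
  leaf-Leaf x | inj₂ (x≢r , eq) with parent {leaf x} (λ r∈ → x≢r (sym (x∈⁅y⁆⇒x≡y x (subst (r ∈_) eq r∈))))
  ...   | p , x⋖p = unique-neighbour {leaf x} {p} (inj₁ x⋖p)
    λ { (inj₁ x⋖u) → parent-unique x⋖u x⋖p
      ; (inj₂ u⋖x) → ⊥-elim (below u⋖x) }
    where
    below : ∀ {u} → ¬ set u ⋖ set (leaf x)
    below {u} ((u⊆x , y , y∈x , y∉u) , _) with node-nonempty (set-node u)
    ... | z , z∈u = y∉u (subst (_∈ set u)
      (trans (x∈⁅y⁆⇒x≡y x (subst (z ∈_) eq (u⊆x z∈u))) (sym (x∈⁅y⁆⇒x≡y x (subst (y ∈_) eq y∈x)))) z∈u)

  internal-¬Leaf : Internal v → ¬ Leaf v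
  internal-¬Leaf {v} int@(r∉v , x , _ , x∈v , _) leaf-v with parent r∉v | childᵥ int x∈v
  ... | p , v⋖p | c , c⋖v , _ with length≡1⁻ leaf-v (∈-neighbours⁺ {v} {p} (inj₁ v⋖p)) (∈-neighbours⁺ {v} {c} (inj₂ c⋖v))
  ...   | refl = ⊂-irref refl (⊂-trans (proj₁ v⋖p) (proj₁ c⋖v))

  tree : LabelledTree n
  tree = record
    { graph          = graph
    ; connected      = connected
    ; acyclic        = acyclic
    ; leaf           = leaf
    ; leaf-injective = leaf-injective
    ; leaf-image     = λ v → mk⇔
        (λ leaf-v → [ (λ z → z) , (λ int → contradiction leaf-v (internal-¬Leaf int)) ]′ (leaf-or-internal v))
        λ { (x , refl) → leaf-Leaf x }
    }

-- Edges of the tree and uniqueness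

module Walks (G : Graph) where
  open Graph G
  open Edge

  private
    variable
      a b u v w : Vertex

  ⟨_⟩ : u ~ v → Edge
  ⟨ u~v ⟩ = record { adjacent = u~v }

  -- The walk is cut after its last visit to `u`.
  first-step : u ≢ v → Star _~_ u v → ∃ λ w → u ~ w × Star (_-node_ u) w v
  first-step {u} {v} u≢v s with leave s
    where
    leave : ∀ {a} → Star _~_ a v → (a ≢ u × Star (_-node_ u) a v) ⊎ (∃ λ w → u ~ w × Star (_-node_ u) w v)
    leave ε = inj₁ (u≢v ∘ sym , ε)
    leave {a} (a~b ◅ s) with leave s
    ... | inj₂ exit = inj₂ exit
    ... | inj₁ (b≢u , s′) with a ≟ u
    ...   | yes refl = inj₂ (_ , a~b , s′)
    ...   | no a≢u   = inj₁ (a≢u , (a~b , a≢u , b≢u) ◅ s′)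
  ... | inj₁ (u≢u , _) = contradiction refl u≢u
  ... | inj₂ exit      = exit

  node⇒edge : ∀ {e} → source e ≡ v ⊎ target e ≡ v → Star (_-node_ v) a b → Star (_-edge_ e) a b
  node⇒edge {v} {e = e} end = Star.map λ (u~w , u≢v , w≢v) → u~w , different {u~w = u~w} end u≢v w≢v
    where
    different : ∀ {u w} {u~w : u ~ w} → source e ≡ v ⊎ target e ≡ v → u ≢ v → w ≢ v → ¬ SameEdge ⟨ u~w ⟩ e
    different (inj₁ refl) u≢v w≢v (inj₁ (p , _)) = u≢v p
    different (inj₁ refl) u≢v w≢v (inj₂ (_ , q)) = w≢v q
    different (inj₂ refl) u≢v w≢v (inj₁ (_ , q)) = w≢v q
    different (inj₂ refl) u≢v w≢v (inj₂ (p , _)) = u≢v p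

  -- A visit to `v` would leave an initial part of the walk leading from `a` to `v`. In `avoid-to`
  -- the final part, from `v` to `b`, is used instead.
  avoid-from : ∀ {e} → ¬ Star (_-edge_ e) a v → Star (_-edge_ e) a b → a ≢ v × Star (_-node_ v) a b
  avoid-from ¬s ε = (λ { refl → ¬s ε }) , ε
  avoid-from {e = e} ¬s (x ◅ s) with avoid-from {e = e} (¬s ∘ (x ◅_)) s
  ... | b≢v , s′ = (λ { refl → ¬s ε }) , (proj₁ x , (λ { refl → ¬s ε }) , b≢v) ◅ s′

  avoid-to : ∀ {e} → ¬ Star (_-edge_ e) v b → Star (_-edge_ e) a b → a ≢ v × Star (_-node_ v) a b
  avoid-to ¬s ε = (λ { refl → ¬s ε }) , ε
  avoid-to {e = e} ¬s (x ◅ s) with avoid-to {e = e} ¬s s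
  ... | b≢v , s′ = (λ { refl → ¬s (x ◅ s) }) , (proj₁ x , (λ { refl → ¬s (x ◅ s) }) , b≢v) ◅ s′

module TreeEdges {n} (r : Fin n) {F : Pred (Subset n) 0ℓ} (W : WeaklyPartitive (∁ ⁅ r ⁆) F)
  (𝓑 : Pred (Bipartition n) 0ℓ)
  (𝓑⇒F : ∀ {b} → 𝓑 b → F (Bipartition.part b) ⊎ F (∁ (Bipartition.part b)))
  (F⇒𝓑 : ∀ {b} → F (Bipartition.part b) ⊎ F (∁ (Bipartition.part b)) → 𝓑 b) where

  open Tree r W
  open Sides 𝓑 𝓑⇒F F⇒𝓑
  open Edge
  open Walks graph using (⟨_⟩)

  Ends : Edge → Rel Vertex 0ℓ
  Ends e c p = (source e ≡ c × target e ≡ p) ⊎ (source e ≡ p × target e ≡ c)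

  private
    variable
      c p u v : Vertex

  same-ends : ∀ e f → Ends e c p → Ends f c p → SameEdge e f
  same-ends _ _ (inj₁ (refl , refl)) (inj₁ (refl , refl)) = inj₁ (refl , refl)
  same-ends _ _ (inj₁ (refl , refl)) (inj₂ (refl , refl)) = inj₂ (refl , refl)
  same-ends _ _ (inj₂ (refl , refl)) (inj₁ (refl , refl)) = inj₂ (refl , refl)
  same-ends _ _ (inj₂ (refl , refl)) (inj₂ (refl , refl)) = inj₁ (refl , refl)

  same⇒ends : ∀ e f → SameEdge e f → Ends f c p → Ends e c p
  same⇒ends _ _ (inj₁ (refl , refl)) e = e
  same⇒ends _ _ (inj₂ (refl , refl)) (inj₁ (refl , refl)) = inj₂ (refl , refl)
  same⇒ends _ _ (inj₂ (refl , refl)) (inj₂ (refl , refl)) = inj₁ (refl , refl)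

  both-ends : ∀ e {A} → Ends e c p → set (source e) ⊆ A → set (target e) ⊆ A → set p ⊆ A
  both-ends _ (inj₁ (refl , refl)) _ t⊆ = t⊆
  both-ends _ (inj₂ (refl , refl)) s⊆ _ = s⊆

  lower : ∀ e → ∃₂ λ c p → set c ⋖ set p × Ends e c p
  lower record { adjacent = inj₁ s⋖t } = _ , _ , s⋖t , inj₁ (refl , refl)
  lower record { adjacent = inj₂ t⋖s } = _ , _ , t⋖s , inj₂ (refl , refl)

  lower-unique : ∀ {e c′ p′} → set c ⋖ set p → Ends e c p → set c′ ⋖ set p′ → Ends e c′ p′ → c ≡ c′
  lower-unique _ (inj₁ (refl , refl)) _ (inj₁ (refl , refl)) = refl
  lower-unique _ (inj₂ (refl , refl)) _ (inj₂ (refl , refl)) = refl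
  lower-unique c⋖p (inj₁ (refl , refl)) p⋖c (inj₂ (refl , refl)) =
    ⊥-elim (⊂-irref refl (⊂-trans (proj₁ c⋖p) (proj₁ p⋖c)))
  lower-unique c⋖p (inj₂ (refl , refl)) p⋖c (inj₁ (refl , refl)) =
    ⊥-elim (⊂-irref refl (⊂-trans (proj₁ c⋖p) (proj₁ p⋖c)))

  module _ {e : Edge} (c⋖p : set c ⋖ set p) (ends : Ends e c p) where

    below-edge⁻ : Star (_-edge_ e) u v → set u ⊆ set c → set v ⊆ set c
    below-edge⁻ ε u⊆c = u⊆c
    below-edge⁻ ((u~w , other) ◅ s) u⊆c with step-in c⋖p u~w u⊆c
    ... | inj₁ w⊆c = below-edge⁻ s w⊆c
    ... | inj₂ eqs = contradiction (same-ends ⟨ u~w ⟩ e (inj₁ eqs) ends) other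

    outside-edge⁻ : Star (_-edge_ e) u v → set u ⊈ set c → set v ⊈ set c
    outside-edge⁻ ε u⊈c = u⊈c
    outside-edge⁻ ((u~w , other) ◅ s) u⊈c with step-out c⋖p u~w u⊈c
    ... | inj₁ w⊈c         = outside-edge⁻ s w⊈c
    ... | inj₂ (w≡c , u≡p) = contradiction (same-ends ⟨ u~w ⟩ e (inj₂ (u≡p , w≡c)) ends) other

    below-edge⁺ : set v ⊆ set c → Star (_-edge_ e) c v
    below-edge⁺ {v} v⊆c = reverse
      (λ {a b} (a⋖b , _ , b⊆c) → inj₂ a⋖b , λ same →
        ⋖⇒⊈ c⋖p (both-ends ⟨ inj₂ {A = set b ⋖ set a} a⋖b ⟩ (same⇒ends ⟨ inj₂ {A = set b ⋖ set a} a⋖b ⟩ e same ends) b⊆c (⊆-trans (proj₁ (proj₁ a⋖b)) b⊆c)))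
      (climb v⊆c)

    outside-edge⁺ : set v ⊈ set c → Star (_-edge_ e) p v
    outside-edge⁺ v⊈c = Star.map
      (λ (a~b , a≢c , b≢c) → a~b , λ same → [ a≢c ∘ proj₁ , b≢c ∘ proj₂ ]′ (same⇒ends ⟨ a~b ⟩ e same ends))
      (outside-component c⋖p v⊈c)

    lower-labels : LabelledTree.ComponentLabels tree (_-edge_ e) c (set c)
    lower-labels x = mk⇔ (λ x∈c → below-edge⁺ (leaf⊆⁺ (⋖⇒r∉ c⋖p) x∈c))
                         (λ s → leaf⊆⁻ (below-edge⁻ s (λ z → z)))

    upper-labels : LabelledTree.ComponentLabels tree (_-edge_ e) p (∁ (set c))
    upper-labels x = mk⇔ (λ x∈∁ → outside-edge⁺ λ x⊆c → x∈∁p⇒x∉p x∈∁ (leaf⊆⁻ x⊆c))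
                         (λ s → x∉p⇒x∈∁p λ x∈c → outside-edge⁻ s (⋖⇒⊈ c⋖p) (leaf⊆⁺ (⋖⇒r∉ c⋖p) x∈c))

  member : set c ⋖ set p → F (set c)
  member c⋖p = proj₁ (⊂⇒strong (set-node _) (proj₁ c⋖p))

  to : Edge → ∃ (Strong 𝓑)
  to e with lower e
  ... | c , p , c⋖p , _ = split (member c⋖p) ,
    strong⇐ (subst StrongMember (sym (side-split (member c⋖p))) (⊂⇒strong (set-node c) (proj₁ c⋖p)))

  side-to : ∀ {e} → set c ⋖ set p → Ends e c p → side (proj₁ (to e)) ≡ set c
  side-to {e = e} c⋖p ends with lower e
  ... | c′ , p′ , c′⋖p′ , ends′ =
    trans (side-split (member c′⋖p′)) (cong set (lower-unique {e = e} c′⋖p′ ends′ c⋖p ends))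

  to-cong : ∀ {e f} → SameEdge e f → proj₁ (to e) ≈ proj₁ (to f)
  to-cong {e} {f} same with lower f
  ... | c , p , c⋖p , ends = side≡⇒≈ (trans (side-to {e = e} c⋖p (same⇒ends e f same ends))
                                            (sym (side-split (member c⋖p))))

  to-injective : ∀ {e f} → proj₁ (to e) ≈ proj₁ (to f) → SameEdge e f
  to-injective {e} {f} eq with lower e | lower f
  ... | c , p , c⋖p , ends | c′ , p′ , c′⋖p′ , ends′
    with set-injective (trans (sym (side-split (member c⋖p)))
                              (trans (≈⇒side≡ {split (member c⋖p)} {split (member c′⋖p′)} eq) (side-split (member c′⋖p′))))
  ... | refl with parent-unique c⋖p c′⋖p′
  ...   | refl = same-ends e f ends ends′

  to-surjective : ∀ b → Strong 𝓑 b → ∃ λ e → ∀ {f} → SameEdge f e → proj₁ (to f) ≈ b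
  to-surjective b s with find (inj₂ (strong⇒ s))
  ... | c , eq with parent {c} (subst (r ∉_) (sym eq) (r∉side b))
  ...   | p , c⋖p = record { source = c ; target = p ; adjacent = inj₁ c⋖p } ,
    λ {f} same → side≡⇒≈ (trans (side-to {e = f} c⋖p (same⇒ends f ⟨ inj₁ {B = set p ⋖ set c} c⋖p ⟩ same (inj₁ (refl , refl)))) eq)

  to-induces : ∀ e → LabelledTree.Induces tree e (proj₁ (to e))
  to-induces e with lower e
  ... | c , p , c⋖p , ends@(inj₁ (refl , refl)) = inj₁ (lower-labels {e = e} c⋖p ends , upper-labels {e = e} c⋖p ends)
  ... | c , p , c⋖p , ends@(inj₂ (refl , refl)) = inj₂ (upper-labels {e = e} c⋖p ends , lower-labels {e = e} c⋖p ends)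

  edgesAreStrong : EdgesAreStrong tree 𝓑
  edgesAreStrong = record
    { to        = to
    ; cong      = λ {e} {f} → to-cong {e} {f}
    ; bijective = (λ {e} {f} → to-injective {e} {f}) , λ (b , s) → to-surjective b s
    } , to-induces

-- Uniqueness: an arbitrary tree with the same edges

module Uniqueness {n} (r : Fin n) {F : Pred (Subset n) 0ℓ} (W : WeaklyPartitive (∁ ⁅ r ⁆) F)
  (𝓑 : Pred (Bipartition n) 0ℓ)
  (𝓑⇒F : ∀ {b} → 𝓑 b → F (Bipartition.part b) ⊎ F (∁ (Bipartition.part b)))
  (F⇒𝓑 : ∀ {b} → F (Bipartition.part b) ⊎ F (∁ (Bipartition.part b)) → 𝓑 b)
  (t : LabelledTree n) (edgesAreStrong : EdgesAreStrong t 𝓑) where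

  open Rooted r W
  open Sides 𝓑 𝓑⇒F F⇒𝓑
  open LabelledTree t
  open Edge
  open Walks graph
  open Neighbours graph
  open Bijection (proj₁ edgesAreStrong) using (to; injective; surjective) renaming (cong to to-cong)

  private
    variable
      a b p q u v w : Vertex

  root : Vertex
  root = leaf r

  split-of : Edge → Subset n
  split-of e = side (proj₁ (to e))

  split-of-strong : ∀ e → StrongMember (split-of e)
  split-of-strong e = strong⇒ (proj₂ (to e))

  r∉split : ∀ e → r ∉ split-of e
  r∉split e = r∉side (proj₁ (to e))

  split-of-cong : ∀ {e f} → SameEdge e f → split-of e ≡ split-of f
  split-of-cong {e} {f} same = ≈⇒side≡ {proj₁ (to e)} {proj₁ (to f)} (to-cong {e} {f} same)

  split-of-injective : ∀ {e f} → split-of e ≡ split-of f → SameEdge e f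
  split-of-injective {e} {f} eq = injective {e} {f} (side≡⇒≈ eq)

  Labels : Edge → Vertex → Subset n → Set
  Labels e = ComponentLabels (_-edge_ e)

  orient : ∀ e → (Labels e (source e) (split-of e) × Labels e (target e) (∁ (split-of e)))
               ⊎ (Labels e (source e) (∁ (split-of e)) × Labels e (target e) (split-of e))
  orient e with side-part (proj₁ (to e)) | proj₂ edgesAreStrong e
  ... | inj₁ eq | ind rewrite eq = ind
  ... | inj₂ eq | ind rewrite eq | ∁-involutive (Bipartition.part (proj₁ (to e))) = swap ind

  -- The parent relation of `t` rooted at the leaf of `r`: `w` is the neighbour of `v` towards the
  -- root. Its properties are read off from which side of a deleted edge carries the label `r`.
  Par : Rel Vertex 0ℓ
  Par v w = v ≢ root × v ~ w × Star (_-node_ v) w root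

  par-adjacent : Par v w → v ~ w
  par-adjacent = proj₁ ∘ proj₂

  edge : Par v w → Edge
  edge p = ⟨ par-adjacent p ⟩

  par-root : (p : Par v w) → Star (_-edge_ (edge p)) w root
  par-root p@(_ , _ , s) = node⇒edge {e = edge p} (inj₁ refl) s

  par-labels : (p : Par v w) → Labels (edge p) v (split-of (edge p))
  par-labels p with orient (edge p)
  ... | inj₁ (l , _) = l
  ... | inj₂ (_ , l) = contradiction (Equivalence.from (l r) (par-root p)) (r∉split (edge p))

  par-¬root : (p : Par v w) → ¬ Star (_-edge_ (edge p)) v root
  par-¬root p s = r∉split (edge p) (Equivalence.from (par-labels p r) s)

  -- A second parent `u` would lead from `v` to the root after deletion of the edge to `w`, whereas
  -- `r` is not a label on the side of `v`.
  par-functional : Par v w → Par v u → w ≡ u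
  par-functional {v} {w} {u} p q@(_ , v~u , s) with u ≟ w
  ... | yes u≡w = sym u≡w
  ... | no u≢w  = contradiction ((v~u , different) ◅ node⇒edge {e = edge p} (inj₁ refl) s) (par-¬root p)
    where
    different : ¬ SameEdge (edge q) (edge p)
    different (inj₁ (_ , u≡w)) = u≢w u≡w
    different (inj₂ (v≡w , _)) = ~-irrefl v≡w (par-adjacent p)

  par-asym : Par v w → ¬ Par w v
  par-asym p (_ , _ , s) = par-¬root p (node⇒edge {e = edge p} (inj₂ refl) s)

  -- The end of the edge on the side without `r` is the child. The walk from the other end to the
  -- root avoids it, since from there the root is out of reach.
  par-total : u ~ v → Par u v ⊎ Par v u
  par-total {u} {v} u~v with orient ⟨ u~v ⟩
  ... | inj₁ (lu , lv) = inj₁ ((λ { refl → ¬s ε }) , u~v , proj₂ (avoid-to {e = ⟨ u~v ⟩} ¬s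
          (Equivalence.to (lv r) (x∉p⇒x∈∁p (r∉split _)))))
    where
    ¬s : ¬ Star (_-edge_ ⟨ u~v ⟩) u root
    ¬s s = r∉split _ (Equivalence.from (lu r) s)
  ... | inj₂ (lu , lv) = inj₂ ((λ { refl → ¬s ε }) , ~-sym u~v , proj₂ (avoid-to {e = ⟨ u~v ⟩} ¬s
          (Equivalence.to (lu r) (x∉p⇒x∈∁p (r∉split _)))))
    where
    ¬s : ¬ Star (_-edge_ ⟨ u~v ⟩) v root
    ¬s s = r∉split _ (Equivalence.from (lv r) s)

  par-exists : v ≢ root → ∃ λ w → Par v w
  par-exists {v} v≢root with first-step v≢root (connected v root)
  ... | w , v~w , s = w , v≢root , v~w , s

  abstract
    -- The counterpart of `set`. Taking it from the parent edge, and not from the leaves below,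
    -- makes it a `Node` at once; `label-ancestor` recovers the leaves.
    cluster : Vertex → Subset n
    cluster v with v ≟ root
    ... | yes _     = ⊤
    ... | no v≢root = split-of (edge (proj₂ (par-exists v≢root)))

    cluster-root : cluster root ≡ ⊤
    cluster-root with root ≟ root
    ... | yes _ = refl
    ... | no root≢root = contradiction refl root≢root

    cluster-par : (p : Par v w) → cluster v ≡ split-of (edge p)
    cluster-par {v} p@(v≢root , _) with v ≟ root
    ... | yes v≡root = contradiction v≡root v≢root
    ... | no v≢root = let p′ = proj₂ (par-exists v≢root) in
      split-of-cong {edge p′} {edge p} (inj₁ (refl , par-functional p′ p))

  cluster-node : ∀ v → Node (cluster v)
  cluster-node v with v ≟ root
  ... | yes refl  = inj₁ cluster-root
  ... | no v≢root = let p = proj₂ (par-exists v≢root) in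
    inj₂ (subst StrongMember (sym (cluster-par p)) (split-of-strong (edge p)))

  r∉cluster : Par v w → r ∉ cluster v
  r∉cluster p r∈ = r∉split (edge p) (subst (r ∈_) (cluster-par p) r∈)

  cluster-onto : ∀ {A} → Node A → ∃ λ v → cluster v ≡ A
  cluster-onto (inj₁ refl) = root , cluster-root
  cluster-onto {A} (inj₂ s@(f , _)) with surjective (split f , strong⇐ (subst StrongMember (sym (side-split f)) s))
  ... | e , eq = [
    (λ p → source e , trans (cluster-par p) (trans (split-of-cong {edge p} {e} (inj₁ (refl , refl))) e↦A)) ,
    (λ p → target e , trans (cluster-par p) (trans (split-of-cong {edge p} {e} (inj₂ (refl , refl))) e↦A)) ]′
    (par-total (adjacent e))
    where
    e↦A : split-of e ≡ A
    e↦A = trans (≈⇒side≡ {proj₁ (to e)} {split f} (eq {e} (inj₁ (refl , refl)))) (side-split f)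

  cluster-injective : cluster u ≡ cluster v → u ≡ v
  cluster-injective {u} {v} eq with u ≟ root | v ≟ root
  ... | yes refl | yes refl = refl
  ... | yes refl | no v≢root =
    contradiction (subst (r ∈_) (trans (sym cluster-root) eq) ∈⊤) (r∉cluster (proj₂ (par-exists v≢root)))
  ... | no u≢root | yes refl =
    contradiction (subst (r ∈_) (trans (sym cluster-root) (sym eq)) ∈⊤) (r∉cluster (proj₂ (par-exists u≢root)))
  ... | no u≢root | no v≢root with par-exists u≢root | par-exists v≢root
  ...   | _ , p | _ , q
    with split-of-injective {edge p} {edge q} (trans (sym (cluster-par p)) (trans eq (cluster-par q)))
  ...     | inj₁ (u≡v , _)     = u≡v
  ...     | inj₂ (refl , refl) = contradiction q (par-asym p)

  -- The edge from `p` to `v` is put before the walk from `v` to the leaf of `x`. That walk never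
  -- visits `p`, or else `v` would reach the root without its parent edge.
  cluster-⊆ : Par v p → cluster v ⊆ cluster p
  cluster-⊆ {v} {p} v→p {x} x∈ with p ≟ root
  ... | yes refl = subst (x ∈_) (sym cluster-root) ∈⊤
  ... | no p≢root with par-exists p≢root
  ...   | q , p→q = subst (x ∈_) (sym (cluster-par p→q)) (Equivalence.from (par-labels p→q x)
    ((~-sym (par-adjacent v→p) , different) ◅ node⇒edge {e = edge p→q} (inj₁ refl)
      (proj₂ (avoid-from {e = edge v→p} (λ s → par-¬root v→p (s ◅◅ par-root v→p))
        (Equivalence.to (par-labels v→p x) (subst (x ∈_) (cluster-par v→p) x∈))))))
    where
    different : ¬ SameEdge ⟨ ~-sym (par-adjacent v→p) ⟩ (edge p→q)
    different (inj₁ (_ , refl)) = par-asym v→p p→q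
    different (inj₂ (p≡q , _))  = ~-irrefl p≡q (par-adjacent p→q)

  ancestor-⊆ : Star Par u v → cluster u ⊆ cluster v
  ancestor-⊆ ε x∈ = x∈
  ancestor-⊆ (p ◅ s) x∈ = ancestor-⊆ s (cluster-⊆ p x∈)

  -- A step up from a proper descendant of `v` follows its only parent and stays below `v`; a step
  -- up from `v` would use the deleted edge.
  stays-descendant : (p : Par v w) → Star Par a v → Star (_-edge_ (edge p)) a b → Star Par b v
  stays-descendant p s ε = s
  stays-descendant p s ((a~c , other) ◅ walk) with par-total a~c
  ... | inj₂ c→a = stays-descendant p (c→a ◅ s) walk
  ... | inj₁ a→c with s
  ...   | ε        = contradiction (inj₁ (refl , par-functional a→c p)) other
  ...   | a→d ◅ s′ with par-functional a→c a→d
  ...     | refl = stays-descendant p s′ walk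

  label-ancestor : ∀ {x} → Par v w → x ∈ cluster v → Star Par (leaf x) v
  label-ancestor {x = x} p x∈ =
    stays-descendant p ε (Equivalence.to (par-labels p x) (subst (x ∈_) (cluster-par p) x∈))

  ancestors-linear : Star Par a u → Star Par a v → Star Par u v ⊎ Star Par v u
  ancestors-linear ε s = inj₁ s
  ancestors-linear s@(_ ◅ _) ε = inj₂ s
  ancestors-linear (p ◅ s) (q ◅ s′) with par-functional p q
  ... | refl = ancestors-linear s s′

  -- A node strictly above `cluster v` is the cluster of some `d`. Both `v` and `d` are ancestors of
  -- the leaf of any label in `cluster v`, hence comparable, and the way from `v` up to `d` begins
  -- with `p`.
  par⇒⋖ : Par v p → cluster v ⋖ cluster p
  par⇒⋖ {v} {p} v→p with ⊆⇒≡⊎⊂ (cluster-⊆ v→p)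
  ... | inj₁ eq  = contradiction (par-adjacent v→p) (~-irrefl (cluster-injective eq))
  ... | inj₂ v⊂p = v⊂p , least
    where
    least : ∀ {C} → Node C → cluster v ⊂ C → cluster p ⊆ C
    least nC v⊂C with cluster-onto nC | node-nonempty (cluster-node v)
    ... | d , refl | x , x∈v with d ≟ root
    ...   | yes refl = λ _ → subst (_ ∈_) (sym cluster-root) ∈⊤
    ...   | no d≢root with ancestors-linear (label-ancestor v→p x∈v)
                             (label-ancestor (proj₂ (par-exists d≢root)) (proj₁ v⊂C x∈v))
    ...     | inj₂ d≤v = ⊥-elim (⊂-irref refl (⊂-⊆-trans v⊂C (ancestor-⊆ d≤v)))
    ...     | inj₁ ε   = ⊥-elim (⊂-irref refl v⊂C)
    ...     | inj₁ (v→p′ ◅ s) with par-functional v→p v→p′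
    ...       | refl = ancestor-⊆ s

  ⋖⇒~ : cluster u ⋖ cluster v → u ~ v
  ⋖⇒~ {u} {v} u⋖v with u ≟ root
  ... | yes refl = contradiction (subst (_ ∈_) (sym cluster-root) ∈⊤) (proj₂ (proj₂ (proj₂ (proj₁ u⋖v))))
  ... | no u≢root with par-exists u≢root
  ...   | p , u→p with cluster-injective (⋖-unique (cluster-node p) (cluster-node v) (par⇒⋖ u→p) u⋖v)
  ...     | refl = par-adjacent u→p

  -- A vertex of degree one is isolated once its edge is deleted.
  cluster-leaf : ∀ {x} → x ≢ r → cluster (leaf x) ≡ ⁅ x ⁆
  cluster-leaf {x} x≢r with par-exists (x≢r ∘ leaf-injective)
  ... | p , x→p = trans (cluster-par x→p) (⊆-antisym only
    λ y∈x → subst (_∈ split-of (edge x→p)) (sym (x∈⁅y⁆⇒x≡y x y∈x)) (Equivalence.from (par-labels x→p x) ε))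
    where
    stuck : ∀ {w} → Star (_-edge_ (edge x→p)) (leaf x) w → leaf x ≡ w
    stuck ε = refl
    stuck ((x~w , other) ◅ _) = contradiction
      (inj₁ (refl , length≡1⁻ (Equivalence.from (leaf-image (leaf x)) (x , refl))
                              (∈-neighbours⁺ x~w) (∈-neighbours⁺ (par-adjacent x→p)))) other
    only : split-of (edge x→p) ⊆ ⁅ x ⁆
    only {y} y∈ = subst (_∈ ⁅ x ⁆) (leaf-injective (stuck (Equivalence.to (par-labels x→p y) y∈))) (x∈⁅x⁆ x)

  open module T = Tree r W using (tree; set; set-injective; set-node; find; set-leaf)

  to-vertex : T.Vertex → Vertex
  to-vertex u = proj₁ (cluster-onto (set-node u))

  cluster-to : ∀ u → cluster (to-vertex u) ≡ set u
  cluster-to u = proj₂ (cluster-onto (set-node u))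

  isomorphic : tree ≅ t
  isomorphic = record
    { vertices  = mk↔ₛ′ to-vertex (λ v → proj₁ (find (cluster-node v)))
        (λ v → cluster-injective (trans (cluster-to _) (proj₂ (find (cluster-node v)))))
        (λ u → set-injective (trans (proj₂ (find (cluster-node (to-vertex u)))) (cluster-to u)))
    ; adjacency = λ u v → mk⇔
        [ ⋖⇒~ ∘ transport , ~-sym ∘ ⋖⇒~ ∘ transport ]′
        (⊎-map (untransport ∘ par⇒⋖) (untransport ∘ par⇒⋖) ∘ par-total)
    ; leaves    = λ x → cluster-injective (trans (cluster-to _) (leaf-cluster x))
    }
    where
    transport : ∀ {u v} → set u ⋖ set v → cluster (to-vertex u) ⋖ cluster (to-vertex v)
    transport {u} {v} u⋖v rewrite cluster-to u | cluster-to v = u⋖v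
    untransport : ∀ {u v} → cluster (to-vertex u) ⋖ cluster (to-vertex v) → set u ⋖ set v
    untransport {u} {v} u⋖v rewrite cluster-to u | cluster-to v = u⋖v
    leaf-cluster : ∀ x → set (T.leaf x) ≡ cluster (leaf x)
    leaf-cluster x with set-leaf x
    ... | inj₁ (refl , eq) = trans eq (sym cluster-root)
    ... | inj₂ (x≢r , eq)  = trans eq (sym (cluster-leaf x≢r))

-- Size

least-element : ∀ {n} {A : Subset n} → Nonempty A → ∃ λ x → x ∈ A × (∀ {y} → y ∈ A → x Fin.≤ y)
least-element {A = true ∷ A} _ = zero , Vec.here , λ _ → ℕ.z≤n
least-element {A = false ∷ A} (suc x , Vec.there x∈A) with least-element {A = A} (x , x∈A)
... | m , m∈A , min = suc m , Vec.there m∈A , λ { (Vec.there y∈A) → ℕ.s≤s (min y∈A) }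

length≤ : ∀ {X : Set} {xs : List X} {k} (f : X → Fin k) → Unique xs →
          (∀ {x y} → x ∈ₗ xs → y ∈ₗ xs → f x ≡ f y → x ≡ y) → length xs ℕ.≤ k
length≤ {xs = xs} f u inj = injective⇒≤ {f = f ∘ lookup xs} λ {i} {j} eq →
  lookup-injective u (inj (∈-lookup i) (∈-lookup j) eq)

join-injective : ∀ m n {x y} → join m n x ≡ join m n y → x ≡ y
join-injective m n {x} {y} eq =
  trans (sym (Fin.splitAt-join m n x)) (trans (cong (Fin.splitAt m) eq) (Fin.splitAt-join m n y))

module Size {n} (r : Fin n) {F : Pred (Subset n) 0ℓ} (W : WeaklyPartitive (∁ ⁅ r ⁆) F) where

  open Tree r W

  private
    variable
      u v : Vertex

  -- x starts a second child of v: the minimum of every node below v that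
  -- contains it, but not of v itself.  This determines v.
  Marks : Vertex → Fin n → Set
  Marks v x = x ∈ set v × (∃ λ a → a ∈ set v × a Fin.< x) ×
              (∀ {B y} → Node B → B ⊂ set v → x ∈ B → y ∈ B → x Fin.≤ y)

  -- Let `c` be the child containing the minimum of `set v`, and `x` the least element outside `c`.
  -- A node strictly below `v` that contains `x` is disjoint from `c`, since otherwise it would
  -- contain all of `set v`; so `x` is its minimum.
  mark : Internal v → ∃ (Marks v)
  mark {v} int with least-element (node-nonempty (set-node v))
  ... | a , a∈v , a-min with childᵥ int a∈v
  ...   | c , c⋖v@((c⊆v , z , z∈v , z∉c) , _) , a∈c with least-element (z , ∈∩∁⁺ z∈v z∉c)
  ...     | x , x∈ , x-min with ∈∩∁⁻ x∈
  ...       | x∈v , x∉c = x , x∈v , (a , a∈v , ℕ.≤∧≢⇒< (a-min x∈v) λ eq →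
                x∉c (subst (_∈ set c) (Fin.toℕ-injective eq) a∈c)) , below
    where
    below : ∀ {B y} → Node B → B ⊂ set v → x ∈ B → y ∈ B → x Fin.≤ y
    below {B} {y} nB B⊂v x∈B y∈B with y ∈? set c
    ... | no y∉c  = x-min (∈∩∁⁺ (proj₁ B⊂v y∈B) y∉c)
    ... | yes y∈c with laminar nB (set-node c) y∈B y∈c
    ...   | inj₁ B⊆c = contradiction (B⊆c x∈B) x∉c
    ...   | inj₂ c⊆B = ⊥-elim (⊂-irref refl (⊂-⊆-trans B⊂v
              (⊆-node (set-node c) nB c⋖v c⊆B λ { refl → x∉c x∈B })))

  -- If `set u` were smaller, the mark of `v` would make `x` its minimum, but the mark of `u`
  -- provides the smaller element `a`.
  marks-⊆ : ∀ {x} → Marks u x → Marks v x → set u ⊆ set v → u ≡ v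
  marks-⊆ (x∈u , (a , a∈u , a<x) , _) (_ , _ , min) u⊆v with ⊆⇒≡⊎⊂ᵥ u⊆v
  ... | inj₁ u≡v = u≡v
  ... | inj₂ u⊂v = contradiction a<x (ℕ.≤⇒≯ (min (set-node _) u⊂v x∈u a∈u))

  marks-determine : ∀ {x} → Marks u x → Marks v x → u ≡ v
  marks-determine mu mv with laminar (set-node _) (set-node _) (proj₁ mu) (proj₁ mv)
  ... | inj₁ u⊆v = marks-⊆ mu mv u⊆v
  ... | inj₂ v⊆u = sym (marks-⊆ mv mu v⊆u)

  -- Leaves go to one copy of the ground set by their labels, internal nodes to a second copy by
  -- their marks; hence the bound `n + n`.
  code : ∀ v → ∃ λ c → [ (λ x → leaf x ≡ v) , Marks v ]′ c
  code v with leaf-or-internal v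
  ... | inj₁ (x , eq) = inj₁ x , eq
  ... | inj₂ int      = let x , m = mark int in inj₂ x , m

  code-injective : proj₁ (code u) ≡ proj₁ (code v) → u ≡ v
  code-injective {u} {v} eq with code u | code v
  code-injective refl | inj₁ x , refl | inj₁ .x , refl = refl
  code-injective refl | inj₂ x , mu   | inj₂ .x , mv   = marks-determine mu mv

  #vertices≤ : #vertices ℕ.≤ n ℕ.+ n
  #vertices≤ = injective⇒≤ {f = join n n ∘ proj₁ ∘ code} (code-injective ∘ join-injective n n)

  lower-end : Vertex × Vertex → Vertex
  lower-end (u , v) with set u ⋖? set v
  ... | yes _ = u
  ... | no _  = v

  -- Parents are unique, so the lower end determines the edge. The same edge listed in opposite
  -- orders is excluded because listed pairs are increasing.
  lower-end-injective : ∀ {u v u′ v′} → u Fin.< v → u ~ v → u′ Fin.< v′ → u′ ~ v′ →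
                        lower-end (u , v) ≡ lower-end (u′ , v′) → (u , v) ≡ (u′ , v′)
  lower-end-injective {u} {v} {u′} {v′} u<v u~v u′<v′ u′~v′ eq
    with set u ⋖? set v | set u′ ⋖? set v′ | u~v | u′~v′
  ... | no ¬u⋖v | _ | inj₁ u⋖v | _ = contradiction u⋖v ¬u⋖v
  ... | _ | no ¬u⋖v | _ | inj₁ u⋖v = contradiction u⋖v ¬u⋖v
  ... | yes u⋖v | yes u′⋖v′ | _ | _ with refl ← eq = cong (u ,_) (parent-unique u⋖v u′⋖v′)
  ... | no _ | no _ | inj₂ v⋖u | inj₂ v′⋖u′ with refl ← eq = cong (_, v) (parent-unique v⋖u v′⋖u′)
  ... | yes u⋖v | no _ | _ | inj₂ v′⋖u′ with refl ← eq =
    contradiction (subst (λ w → u Fin.< w) (parent-unique u⋖v v′⋖u′) u<v) (ℕ.<-asym u′<v′)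
  ... | no _ | yes u′⋖v′ | inj₂ v⋖u | _ with refl ← eq =
    contradiction (subst (λ w → v Fin.< w) (parent-unique u′⋖v′ v⋖u) u′<v′) (ℕ.<-asym u<v)

  #edges≤ : #edges ℕ.≤ #vertices
  #edges≤ = length≤ lower-end
    (Unique.filter⁺ P? (Unique.cartesianProduct⁺ (Unique.allFin⁺ _) (Unique.allFin⁺ _)))
    λ {e} {f} e∈ f∈ eq →
      let u<v   , u~v   = proj₂ (∈-filter⁻ P? {xs = pairs} e∈)
          u′<v′ , u′~v′ = proj₂ (∈-filter⁻ P? {xs = pairs} f∈)
      in lower-end-injective u<v u~v u′<v′ u′~v′ eq
    where
    pairs : List (Vertex × Vertex)
    pairs = cartesianProduct (allFin _) (allFin _)
    P? : Decidable (λ ((u , v) : Vertex × Vertex) → u Fin.< v × u ~ v)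
    P? (u , v) = (u Fin.<? v) ×-dec (u ~? v)

  -- The constant 4 is twice 2: there are at most twice `n` vertices, and no more edges than
  -- vertices.
  size≤ : size ℕ.≤ 4 ℕ.* n
  size≤ = begin
    #vertices ℕ.+ #edges       ≤⟨ ℕ.+-mono-≤ #vertices≤ (ℕ.≤-trans #edges≤ #vertices≤) ⟩
    (n ℕ.+ n) ℕ.+ (n ℕ.+ n)    ≡⟨ ℕ.+-assoc n n (n ℕ.+ n) ⟩
    n ℕ.+ (n ℕ.+ (n ℕ.+ n))    ≡⟨ cong (λ m → n ℕ.+ (n ℕ.+ (n ℕ.+ m))) (sym (ℕ.+-identityʳ n)) ⟩
    4 ℕ.* n                    ∎
    where open ℕ.≤-Reasoning

-- The members described by a node

module Quotient {n} (r : Fin n) {F : Pred (Subset n) 0ℓ} (W : WeaklyPartitive (∁ ⁅ r ⁆) F) where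

  open Tree r W

  private
    variable
      I J : Subset #vertices

  abstract
    union : Subset #vertices → Subset n
    union I = select λ x → any? λ c → c ∈? I ×-dec x ∈? set c

    ∈-union⁺ : ∀ {c x} → c ∈ I → x ∈ set c → x ∈ union I
    ∈-union⁺ {I} {c} c∈I x∈c = ∈-select⁺ (λ x → any? λ c → c ∈? I ×-dec x ∈? set c) (c , c∈I , x∈c)

    ∈-union⁻ : ∀ {x} → x ∈ union I → ∃ λ c → c ∈ I × x ∈ set c
    ∈-union⁻ {I} = ∈-select⁻ (λ x → any? λ c → c ∈? I ×-dec x ∈? set c)

  module _ (v : Vertex) where

    abstract
      children : Subset #vertices
      children = select λ c → set c ⋖? set v

      ∈-children⁺ : ∀ {c} → set c ⋖ set v → c ∈ children
      ∈-children⁺ = ∈-select⁺ λ c → set c ⋖? set v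

      ∈-children⁻ : ∀ {c} → c ∈ children → set c ⋖ set v
      ∈-children⁻ = ∈-select⁻ λ c → set c ⋖? set v

    child-unique : ∀ {c d x} → c ∈ children → d ∈ children → x ∈ set c → x ∈ set d → c ≡ d
    child-unique c∈ d∈ x∈c x∈d =
      set-injective (siblings (set-node _) (set-node _) (∈-children⁻ c∈) (∈-children⁻ d∈) x∈c x∈d)

    union-⊆ : I ⊆ children → union I ⊆ set v
    union-⊆ I⊆ x∈ = let c , c∈I , x∈c = ∈-union⁻ x∈ in proj₁ (proj₁ (∈-children⁻ (I⊆ c∈I))) x∈c

    union-∌ : ∀ {c x} → J ⊆ children → c ∈ children → c ∉ J → x ∈ set c → x ∉ union J
    union-∌ J⊆ c∈ c∉J x∈c x∈J with ∈-union⁻ x∈J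
    ... | d , d∈J , x∈d with child-unique c∈ (J⊆ d∈J) x∈c x∈d
    ...   | refl = c∉J d∈J

    union-singleton : ∀ {c} → union ⁅ c ⁆ ≡ set c
    union-singleton {c} = ⊆-antisym
      (λ x∈ → let d , d∈c , x∈d = ∈-union⁻ x∈ in subst (λ d → _ ∈ set d) (x∈⁅y⁆⇒x≡y c d∈c) x∈d)
      (∈-union⁺ (x∈⁅x⁆ c))

    union-∪ : union (I ∪ J) ≡ union I ∪ union J
    union-∪ {I} {J} = ⊆-antisym
      (λ x∈ → let c , c∈ , x∈c = ∈-union⁻ x∈ in
        x∈p∪q⁺ ([ (λ c∈I → inj₁ (∈-union⁺ c∈I x∈c)) , (λ c∈J → inj₂ (∈-union⁺ c∈J x∈c)) ]′ (x∈p∪q⁻ I J c∈)))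
      (∪-⊆ (λ x∈ → let c , c∈ , x∈c = ∈-union⁻ x∈ in ∈-union⁺ (x∈p∪q⁺ (inj₁ c∈)) x∈c)
           (λ x∈ → let c , c∈ , x∈c = ∈-union⁻ x∈ in ∈-union⁺ (x∈p∪q⁺ (inj₂ c∈)) x∈c))

    union-∩ : I ⊆ children → J ⊆ children → union (I ∩ J) ≡ union I ∩ union J
    union-∩ {I} {J} I⊆ J⊆ = ⊆-antisym
      (λ x∈ → let c , c∈ , x∈c = ∈-union⁻ x∈ ; c∈I , c∈J = x∈p∩q⁻ I J c∈ in
        x∈p∩q⁺ (∈-union⁺ c∈I x∈c , ∈-union⁺ c∈J x∈c))
      both
      where
      both : union I ∩ union J ⊆ union (I ∩ J)
      both x∈ with x∈p∩q⁻ (union I) (union J) x∈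
      ... | x∈I , x∈J with ∈-union⁻ x∈I | ∈-union⁻ x∈J
      ...   | c , c∈I , x∈c | d , d∈J , x∈d with child-unique (I⊆ c∈I) (J⊆ d∈J) x∈c x∈d
      ...     | refl = ∈-union⁺ (x∈p∩q⁺ (c∈I , d∈J)) x∈c

    union-─ : I ⊆ children → J ⊆ children → union (I ∩ ∁ J) ≡ union I ∩ ∁ (union J)
    union-─ {I} {J} I⊆ J⊆ = ⊆-antisym
      (λ x∈ → let c , c∈ , x∈c = ∈-union⁻ x∈ ; c∈I , c∉J = ∈∩∁⁻ c∈ in
        ∈∩∁⁺ (∈-union⁺ c∈I x∈c) (union-∌ J⊆ (I⊆ c∈I) c∉J x∈c))
      (λ x∈ → let x∈I , x∉J = ∈∩∁⁻ x∈ ; c , c∈I , x∈c = ∈-union⁻ x∈I in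
        ∈-union⁺ (∈∩∁⁺ c∈I (λ c∈J → x∉J (∈-union⁺ c∈J x∈c))) x∈c)

    union-≬⁺ : I ⊆ children → J ⊆ children → I ≬ J → union I ≬ union J
    union-≬⁺ I⊆ J⊆ ((a , a∈I , a∈J) , (b , b∈I , b∉J) , (c , c∈J , c∉I))
      with node-nonempty (set-node a) | node-nonempty (set-node b) | node-nonempty (set-node c)
    ... | x , x∈a | y , y∈b | z , z∈c =
      (x , ∈-union⁺ a∈I x∈a , ∈-union⁺ a∈J x∈a) ,
      (y , ∈-union⁺ b∈I y∈b , union-∌ J⊆ (I⊆ b∈I) b∉J y∈b) ,
      (z , ∈-union⁺ c∈J z∈c , union-∌ I⊆ (J⊆ c∈J) c∉I z∈c)

    union-≬⁻ : I ⊆ children → J ⊆ children → union I ≬ union J → I ≬ J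
    union-≬⁻ I⊆ J⊆ ((x , x∈I , x∈J) , (y , y∈I , y∉J) , (z , z∈J , z∉I))
      with ∈-union⁻ x∈I | ∈-union⁻ x∈J | ∈-union⁻ y∈I | ∈-union⁻ z∈J
    ... | a , a∈I , x∈a | a′ , a′∈J , x∈a′ | b , b∈I , y∈b | c , c∈J , z∈c
      with child-unique (I⊆ a∈I) (J⊆ a′∈J) x∈a x∈a′
    ...   | refl = (a , a∈I , a′∈J) , (b , b∈I , λ b∈J → y∉J (∈-union⁺ b∈J y∈b)) ,
                   (c , c∈J , λ c∈I → z∉I (∈-union⁺ c∈I z∈c))

    QuotientMember : Pred (Subset #vertices) 0ℓ
    QuotientMember I = I ⊆ children × Nonempty I × F (union I)

    module _ (int : Internal v) where

      union-children : union children ≡ set v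
      union-children = ⊆-antisym (union-⊆ (λ z → z)) λ x∈v →
        let c , c⋖v , x∈c = childᵥ int x∈v in ∈-union⁺ (∈-children⁺ c⋖v) x∈c

      internal-strong : StrongMember (set v)
      internal-strong with set-node v
      ... | inj₁ eq = contradiction (subst (r ∈_) (sym eq) ∈⊤) (proj₁ int)
      ... | inj₂ s  = s

      children-nonempty : Nonempty children
      children-nonempty = let c , c⋖v , _ = childᵥ int (proj₂ (node-nonempty (set-node v))) in c , ∈-children⁺ c⋖v

      union-of-children : ∀ {B} → B ⊆ set v → (∀ {c x} → c ∈ children → x ∈ set c → x ∈ B → set c ⊆ B) →
                          ∃ λ J → J ⊆ children × union J ≡ B
      union-of-children {B} B⊆v saturated = inside ,
        proj₁ ∘ ∈-select⁻ inside? ,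
        ⊆-antisym
          (λ x∈ → let c , c∈ , x∈c = ∈-union⁻ x∈ in proj₂ (∈-select⁻ inside? c∈) x∈c)
          (λ x∈B → let c , c⋖v , x∈c = childᵥ int (B⊆v x∈B) in
            ∈-union⁺ (∈-select⁺ inside? (∈-children⁺ c⋖v , λ {z} → saturated (∈-children⁺ c⋖v) x∈c x∈B {z})) x∈c)
        where
        inside? : Decidable (λ c → c ∈ children × set c ⊆ B)
        inside? c = (c ∈? children) ×-dec (set c ⊆? B)
        inside : Subset #vertices
        inside = select inside?

      quotient : WeaklyPartitive children QuotientMember
      quotient = record
        { F?        = λ I → (I ⊆? children) ×-dec nonempty? I ×-dec F? (union I)
        ; F⇒⊆       = proj₁
        ; nonempty  = proj₁ ∘ proj₂
        ; singleton = λ {c} c∈ → ⁅⁆-⊆ c∈ , (c , x∈⁅x⁆ c) ,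
            subst F (sym union-singleton) (proj₁ (⊂⇒strong (set-node c) (proj₁ (∈-children⁻ c∈))))
        ; whole     = (λ z → z) , children-nonempty , subst F (sym union-children) (proj₁ internal-strong)
        ; ∪-closed  = λ (I⊆ , (c , c∈I) , fI) (J⊆ , _ , fJ) o → ∪-⊆ I⊆ J⊆ , (c , x∈p∪q⁺ (inj₁ c∈I)) ,
            subst F (sym union-∪) (∪-closed fI fJ (union-≬⁺ I⊆ J⊆ o))
        ; ∩-closed  = λ {I} {J} (I⊆ , _ , fI) (J⊆ , _ , fJ) o@((c , c∈) , _) →
            I⊆ ∘ proj₁ ∘ x∈p∩q⁻ I J , (c , x∈p∩q⁺ c∈) ,
            subst F (sym (union-∩ I⊆ J⊆)) (∩-closed fI fJ (union-≬⁺ I⊆ J⊆ o))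
        ; ─-closed  = λ (I⊆ , _ , fI) (J⊆ , _ , fJ) o@(_ , (c , c∈I , c∉J) , _) →
            I⊆ ∘ proj₁ ∘ ∈∩∁⁻ , (c , ∈∩∁⁺ c∈I c∉J) ,
            subst F (sym (union-─ I⊆ J⊆)) (─-closed fI fJ (union-≬⁺ I⊆ J⊆ o))
        }

      -- Since `I` has a second child `b`, a strong union would be a node strictly above the child
      -- `a`. It would then contain `set v`, although it misses the child `c`.
      not-strong : I ⊆ children → Nontrivial I → I ⊂ children → ¬ StrongMember (union I)
      not-strong {I} I⊆ (a , b , a∈I , b∈I , a≢b) (_ , c , c∈ , c∉I) s
        with node-nonempty (set-node b) | node-nonempty (set-node c)
      ... | y , y∈b | z , z∈c =
        union-∌ I⊆ c∈ c∉I z∈c (⊆-node (set-node a) (inj₂ s) (∈-children⁻ (I⊆ a∈I)) (∈-union⁺ a∈I)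
          (λ eq → a≢b (child-unique (I⊆ a∈I) (I⊆ b∈I) (subst (y ∈_) eq (∈-union⁺ b∈I y∈b)) y∈b))
          (proj₁ (proj₁ (∈-children⁻ c∈)) z∈c))

      -- This is the hypothesis of `Core`. Some `B` overlaps `union I`; as `set v` is strong, `B`
      -- lies inside it. As children are strong, `B` is a union of children, unless it lies within
      -- one child; but that child would belong to `I`, while `B` reaches outside `union I`.
      crossed : QuotientMember I → Nontrivial I → I ⊂ children → ∃ λ J → QuotientMember J × I ≬ J
      crossed {I} (I⊆ , _ , fI) nt I⊂ with crossing-or-strong fI
      ... | inj₂ s = contradiction s (not-strong I⊆ nt I⊂)
      ... | inj₁ (B , fB , o@((x , x∈I , x∈B) , (y , y∈I , y∉B) , (z , z∈B , z∉I))) =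
        let J , J⊆ , eq = union-of-children B⊆v saturated
            c , c∈J , _ = ∈-union⁻ (subst (x ∈_) (sym eq) x∈B)
        in J , (J⊆ , (c , c∈J) , subst F (sym eq) fB) , union-≬⁻ I⊆ J⊆ (subst (union I ≬_) (sym eq) o)
        where
        B⊆v : B ⊆ set v
        B⊆v with ¬≬⇒⊆⊎⊇ (proj₂ internal-strong fB) (union-⊆ I⊆ x∈I) x∈B
        ... | inj₁ v⊆B = contradiction (v⊆B (union-⊆ I⊆ y∈I)) y∉B
        ... | inj₂ B⊆v = B⊆v
        saturated : ∀ {c w} → c ∈ children → w ∈ set c → w ∈ B → set c ⊆ B
        saturated {c} c∈ w∈c w∈B with ¬≬⇒⊆⊎⊇ (proj₂ (⊂⇒strong (set-node c) (proj₁ (∈-children⁻ c∈))) fB) w∈c w∈B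
        ... | inj₁ c⊆B = c⊆B
        ... | inj₂ B⊆c with ∈-union⁻ x∈I
        ...   | d , d∈I , x∈d with child-unique c∈ (I⊆ d∈I) (B⊆c x∈B) x∈d
        ...     | refl = contradiction (∈-union⁺ d∈I (B⊆c z∈B)) z∉I

      shape : Shape children QuotientMember
      shape = Core.shape quotient crossed

  -- The least node strictly above U, unless this is X: then U is X ∖ {r} and a node itself.
  home : (∃₂ λ x y → x ≢ r × y ≢ r × x ≢ y) → ∀ {U} → F U →
         ∃ λ v → Internal v × (∃ λ J → J ⊆ children v × union J ≡ U)
  home (x , y , x≢r , y≢r , x≢y) {U} fU with ⊆⇒≡⊎⊂ (F⇒⊆ fU) | find whole-node
  ... | inj₁ refl | v , eq = v , int , children v , (λ z → z) , trans (union-children v int) eq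
    where
    ∈v : ∀ {z} → z ≢ r → z ∈ set v
    ∈v z≢r = subst (_ ∈_) (sym eq) (x∉p⇒x∈∁p (z≢r ∘ x∈⁅y⁆⇒x≡y r))
    int : Internal v
    int = (λ r∈ → r∉ fU (subst (r ∈_) eq r∈)) , x , y , ∈v x≢r , ∈v y≢r , x≢y
  ... | inj₂ U⊂ | _ with least-above (nonempty fU) (r∉ fU) | nonempty fU
  ...   | D , nD , U⋖D@((U⊆D , y , y∈D , y∉U) , least) | x , x∈U with find nD
  ...     | v , refl = v , int , union-of-children v int U⊆D saturated
    where
    int : Internal v
    int = (λ r∈ → x∈∁p⇒x∉p (least whole-node U⊂ r∈) (x∈⁅x⁆ r)) ,
          x , y , U⊆D x∈U , y∈D , λ { refl → y∉U x∈U }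
    saturated : ∀ {c x} → c ∈ children v → x ∈ set c → x ∈ U → set c ⊆ U
    saturated {c} c∈ x∈c x∈U
      with ¬≬⇒⊆⊎⊇ (proj₂ (⊂⇒strong (set-node c) (proj₁ (∈-children⁻ v c∈))) fU) x∈c x∈U
    ... | inj₁ c⊆U = c⊆U
    ... | inj₂ U⊆c with ⊆⇒≡⊎⊂ U⊆c
    ...   | inj₁ refl = λ z → z
    ...   | inj₂ U⊂c  = ⊥-elim (⊂-irref refl (⊂-⊆-trans (proj₁ (∈-children⁻ v c∈)) (least (set-node c) U⊂c)))

-- Intervals of positions and segments of lists

-- Bounds in `ℕ`, the upper one exclusive, allow empty intervals and fit the arguments of `take` and
-- `drop` in `slice`.
HalfOpen : Subset k → ℕ → ℕ → Set
HalfOpen I a b = ∀ i → i ∈ I ⇔ (a ℕ.≤ toℕ i × toℕ i ℕ.< b)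

-- Position 0 of the order at a node is the parent, so a set of positions containing 0 is
-- replaced by its complement.
interval-tail : ∀ {I : Subset k} → Interval (false ∷ I) → ∃₂ λ a b → HalfOpen I a b
interval-tail (a , b , h) = ℕ.pred (toℕ a) , toℕ b , λ i → mk⇔
  (λ i∈ → let a≤ , ≤b = Equivalence.to (h (suc i)) (Vec.there i∈) in ℕ.pred-mono-≤ a≤ , ≤b)
  (λ (a≤ , <b) → drop-there (Equivalence.from (h (suc i)) (pred≤⇒≤suc a≤ , <b)))
  where
  pred≤⇒≤suc : ∀ {m i} → ℕ.pred m ℕ.≤ i → m ℕ.≤ ℕ.suc i
  pred≤⇒≤suc {ℕ.zero}  _   = ℕ.z≤n
  pred≤⇒≤suc {ℕ.suc m} m≤i = ℕ.s≤s m≤i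

interval-∁tail : ∀ {I : Subset k} → Interval (true ∷ I) → ∃₂ λ a b → HalfOpen (∁ I) a b
interval-∁tail {k} {I} (a , b , h) = toℕ b , k , λ i → mk⇔
  (λ i∈∁ → ℕ.≮⇒≥ (λ i<b → x∈∁p⇒x∉p i∈∁ (drop-there (Equivalence.from (h (suc i)) (a≤ i , i<b)))) , toℕ<n i)
  (λ (b≤i , _) → x∉p⇒x∈∁p λ i∈ → ℕ.<⇒≱ (proj₂ (Equivalence.to (h (suc i)) (Vec.there i∈))) b≤i)
  where
  a≤ : ∀ i → a Fin.≤ suc i
  a≤ i = ℕ.≤-trans (proj₁ (Equivalence.to (h zero) Vec.here)) ℕ.z≤n

tail-interval : ∀ {I : Subset k} {a b} → Nonempty I → b ℕ.≤ k → HalfOpen I a b → Interval (false ∷ I)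
tail-interval {b = ℕ.zero} (i , i∈) _ h = contradiction (proj₂ (Equivalence.to (h i) i∈)) λ ()
tail-interval {k = k} {I} {a} {ℕ.suc b} (i₀ , i₀∈) b<k h =
  -- The upper witness has the value of the old exclusive bound: making it inclusive subtracts one,
  -- and the new position 0 adds one.
  suc (fromℕ< a<k) , suc (fromℕ< b<k) , λ where
    zero → mk⇔ (λ ()) λ { (() , _) }
    (suc i) → mk⇔
      (λ { (Vec.there i∈) → let a≤i , i<b = Equivalence.to (h i) i∈ in
           ℕ.s≤s (subst (ℕ._≤ toℕ i) (sym (toℕ-fromℕ< a<k)) a≤i) ,
           subst (toℕ i ℕ.<_) (cong ℕ.suc (sym (toℕ-fromℕ< b<k))) i<b })
      (λ { (ℕ.s≤s a≤i , i<b) → Vec.there (Equivalence.from (h i)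
             (subst (ℕ._≤ toℕ i) (toℕ-fromℕ< a<k) a≤i ,
              subst (toℕ i ℕ.<_) (cong ℕ.suc (toℕ-fromℕ< b<k)) i<b)) })
  where
  a<k : a ℕ.< k
  a<k = ℕ.≤-<-trans (proj₁ (Equivalence.to (h i₀) i₀∈)) (toℕ<n i₀)

module _ {n} (cs : List (Fin n)) where

  image : Subset (length cs) → Subset n
  image I = select λ c → any? λ i → i ∈? I ×-dec lookup cs i ≟ c

  ∈-image⁺ : ∀ {I i} → i ∈ I → lookup cs i ∈ image I
  ∈-image⁺ {I} {i} i∈ = ∈-select⁺ (λ c → any? λ i → i ∈? I ×-dec lookup cs i ≟ c) (i , i∈ , refl)

  ∈-image⁻ : ∀ {I c} → c ∈ image I → ∃ λ i → i ∈ I × lookup cs i ≡ c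
  ∈-image⁻ {I} = ∈-select⁻ λ c → any? λ i → i ∈? I ×-dec lookup cs i ≟ c

  preimage : Subset n → Subset (length cs)
  preimage J = select λ i → lookup cs i ∈? J

  ∈-preimage⁺ : ∀ {J i} → lookup cs i ∈ J → i ∈ preimage J
  ∈-preimage⁺ {J} = ∈-select⁺ λ i → lookup cs i ∈? J

  ∈-preimage⁻ : ∀ {J i} → i ∈ preimage J → lookup cs i ∈ J
  ∈-preimage⁻ {J} = ∈-select⁻ λ i → lookup cs i ∈? J

slice : List X → ℕ → ℕ → List X
slice xs a b = take (b ∸ a) (drop a xs)

∈-slice⁺ : ∀ (xs : List X) a b i → a ℕ.≤ toℕ i → toℕ i ℕ.< b → lookup xs i ∈ₗ slice xs a b
∈-slice⁺ (x ∷ xs) ℕ.zero    (ℕ.suc b) zero    _ _ = here refl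
∈-slice⁺ (x ∷ xs) ℕ.zero    (ℕ.suc b) (suc i) _ (ℕ.s≤s i<b) = there (∈-slice⁺ xs 0 b i ℕ.z≤n i<b)
∈-slice⁺ (x ∷ xs) (ℕ.suc a) (ℕ.suc b) (suc i) (ℕ.s≤s a≤i) (ℕ.s≤s i<b) = ∈-slice⁺ xs a b i a≤i i<b

∈-slice⁻ : ∀ (xs : List X) a b {x} → x ∈ₗ slice xs a b → ∃ λ i → a ℕ.≤ toℕ i × toℕ i ℕ.< b × lookup xs i ≡ x
∈-slice⁻ []       ℕ.zero    ℕ.zero ()
∈-slice⁻ []       ℕ.zero    (ℕ.suc b) ()
∈-slice⁻ []       (ℕ.suc a) b x∈ with b ∸ ℕ.suc a
∈-slice⁻ []       (ℕ.suc a) b () | ℕ.zero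
∈-slice⁻ []       (ℕ.suc a) b () | ℕ.suc _
∈-slice⁻ (x ∷ xs) ℕ.zero    (ℕ.suc b) (here refl) = zero , ℕ.z≤n , ℕ.z<s , refl
∈-slice⁻ (x ∷ xs) ℕ.zero    (ℕ.suc b) (there x∈)  with ∈-slice⁻ xs 0 b x∈
... | i , _ , i<b , eq = suc i , ℕ.z≤n , ℕ.s≤s i<b , eq
∈-slice⁻ (x ∷ xs) (ℕ.suc a) (ℕ.suc b) x∈ with ∈-slice⁻ xs a b x∈
... | i , a≤i , i<b , eq = suc i , ℕ.s≤s a≤i , ℕ.s≤s i<b , eq

slice-++ : ∀ (xs ys zs : List X) → slice (xs ++ ys ++ zs) (length xs) (length xs ℕ.+ length ys) ≡ ys
slice-++ [] ys zs = take-length ys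
  where
  take-length : ∀ ys → take (length ys) (ys ++ zs) ≡ ys
  take-length []       = refl
  take-length (y ∷ ys) = cong (y ∷_) (take-length ys)
slice-++ (x ∷ xs) ys zs = slice-++ xs ys zs

halfOpen⇒segment : ∀ (cs : List (Fin n)) {I a b} → HalfOpen I a b → Segment cs (image cs I)
halfOpen⇒segment cs {I} {a} {b} h = take a cs , slice cs a b , drop (b ∸ a) (drop a cs) ,
  sym (trans (cong (take a cs ++_) (take++drop≡id (b ∸ a) (drop a cs))) (take++drop≡id a cs)) ,
  ⊆-antisym
    (λ c∈ → let i , i∈ , eq = ∈-image⁻ cs c∈ ; a≤i , i<b = Equivalence.to (h i) i∈ in
      subst (_∈ toSet (slice cs a b)) eq (∈-toSet⁺ (∈-slice⁺ cs a b i a≤i i<b)))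
    (toSet-⊆ λ c∈ → let i , a≤i , i<b , eq = ∈-slice⁻ cs a b c∈ in
      subst (_∈ image cs I) eq (∈-image⁺ cs (Equivalence.from (h i) (a≤i , i<b))))

segment⇒halfOpen : ∀ (cs : List (Fin n)) {J} → Unique cs → Segment cs J →
                   ∃₂ λ a b → b ℕ.≤ length cs × HalfOpen (preimage cs J) a b
segment⇒halfOpen cs u (xs , ys , zs , refl , refl) =
  length xs , length xs ℕ.+ length ys , bound , λ i → mk⇔
    (λ i∈ → inside i (subst (lookup cs i ∈ₗ_) (sym (slice-++ xs ys zs)) (∈-toSet⁻ (∈-preimage⁻ cs i∈))))
    (λ (a≤i , i<b) → ∈-preimage⁺ cs (∈-toSet⁺
      (subst (lookup cs i ∈ₗ_) (slice-++ xs ys zs) (∈-slice⁺ cs _ _ i a≤i i<b))))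
  where
  inside : ∀ i → lookup cs i ∈ₗ slice cs (length xs) (length xs ℕ.+ length ys) →
           length xs ℕ.≤ toℕ i × toℕ i ℕ.< length xs ℕ.+ length ys
  inside i c∈ with ∈-slice⁻ cs (length xs) (length xs ℕ.+ length ys) c∈
  ... | j , a≤j , j<b , eq with lookup-injective u eq
  ...   | refl = a≤j , j<b
  bound : length xs ℕ.+ length ys ℕ.≤ length cs
  bound = length-≤ xs
    where
    length-≤ : ∀ xs → length xs ℕ.+ length ys ℕ.≤ length (xs ++ ys ++ zs)
    length-≤ (x ∷ xs) = ℕ.s≤s (length-≤ xs)
    length-≤ [] = go ys
      where
      go : ∀ ys → length ys ℕ.≤ length (ys ++ zs)
      go []       = ℕ.z≤n
      go (y ∷ ys) = ℕ.s≤s (go ys)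

∣p∣>0 : ∀ {I : Subset k} → Nonempty I → 1 ℕ.≤ ∣ I ∣
∣p∣>0 {I = I} (i , i∈) = subst (ℕ._≤ ∣ I ∣) (∣⁅x⁆∣≡1 i)
  (p⊆q⇒∣p∣≤∣q∣ (⁅⁆-⊆ i∈))

∣p∣<n : ∀ {I : Subset k} → Nonempty (∁ I) → ∣ I ∣ ℕ.< k
∣p∣<n {k} {I} (i , i∈∁) = subst (∣ I ∣ ℕ.<_) (∣⊤∣≡n k) (p⊂q⇒∣p∣<∣q∣ ((λ _ → ∈⊤) , i , ∈⊤ , x∈∁p⇒x∉p i∈∁))

∣p∣>0⇒nonempty : ∀ {I : Subset k} → 1 ℕ.≤ ∣ I ∣ → Nonempty I
∣p∣>0⇒nonempty {k} {I} 0<∣I∣ = decidable-stable (nonempty? I) λ e →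
  ℕ.<⇒≢ 0<∣I∣ (sym (trans (cong ∣_∣ (Empty-unique e)) (∣⊥∣≡0 k)))

∣p∣<n⇒∁-nonempty : ∀ {I : Subset k} → ∣ I ∣ ℕ.< k → Nonempty (∁ I)
∣p∣<n⇒∁-nonempty {k} {I} ∣I∣<k = decidable-stable (nonempty? (∁ I)) λ e →
  ℕ.<⇒≢ ∣I∣<k (trans (cong ∣_∣ (⊆-antisym (λ _ → ∈⊤) λ {x} _ → x∉∁p⇒x∈p (λ x∈ → e (x , x∈)))) (∣⊤∣≡n k))

unique-↭ : ∀ {xs ys : List X} → Unique xs → Unique ys → (∀ {x} → x ∈ₗ xs ⇔ x ∈ₗ ys) → xs ↭ ys
unique-↭ u v h = ∼bag⇒↭ (unique∧set⇒bag u v h)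

-- Kinds and orders of the nodes

module Description {n} (r : Fin n) {F : Pred (Subset n) 0ℓ} (W : WeaklyPartitive (∁ ⁅ r ⁆) F)
  (𝓑 : Pred (Bipartition n) 0ℓ)
  (𝓑⇒F : ∀ {b} → 𝓑 b → F (Bipartition.part b) ⊎ F (∁ (Bipartition.part b)))
  (F⇒𝓑 : ∀ {b} → F (Bipartition.part b) ⊎ F (∁ (Bipartition.part b)) → 𝓑 b) where

  open Tree r W
  open Quotient r W
  open Sides 𝓑 𝓑⇒F F⇒𝓑
  open Bipartition

  -- `Admissible` as seen from the children. At a prime node, the set of all children represents the
  -- parent's position alone.
  ChildrenAdmissible : Vertex → Kind → List Vertex → Pred (Subset #vertices) 0ℓ
  ChildrenAdmissible v complete cs J = Unit
  ChildrenAdmissible v circular cs J = Segment cs J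
  ChildrenAdmissible v prime    cs J = (∃ λ c → J ≡ ⁅ c ⁆) ⊎ J ≡ children v

  record Arrangement (v : Vertex) : Set where
    field
      kind       : Kind
      list       : List Vertex
      unique     : Unique list
      ∈-list     : ∀ c → c ∈ₗ list ⇔ c ∈ children v
      admissible : ∀ {J} → J ⊆ children v → Nonempty J →
                   QuotientMember v J ⇔ ChildrenAdmissible v kind list J

  childList : Vertex → List Vertex
  childList v = filter (_∈? children v) (allFin _)

  childList-unique : ∀ v → Unique (childList v)
  childList-unique v = Unique.filter⁺ (_∈? children v) (Unique.allFin⁺ _)

  ∈-childList : ∀ v c → c ∈ₗ childList v ⇔ c ∈ children v
  ∈-childList v c = mk⇔ (λ c∈ → proj₂ (∈-filter⁻ (_∈? children v) {xs = allFin _} c∈))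
                        (∈-filter⁺ (_∈? children v) (∈-allFin c))

  abstract
    arrange : ∀ {v} → Internal v → Arrangement v
    arrange {v} int with shape v int
    ... | linear p u ∈p segment = record
      { kind = circular ; list = p ; unique = u ; ∈-list = ∈p ; admissible = λ _ ne → segment ne }
    ... | complete all = record
      { kind = complete ; list = childList v ; unique = childList-unique v ; ∈-list = ∈-childList v
      ; admissible = λ J⊆ ne → mk⇔ (λ _ → tt) (λ _ → all J⊆ ne) }
    ... | prime only = record
      { kind = prime ; list = childList v ; unique = childList-unique v ; ∈-list = ∈-childList v
      ; admissible = λ J⊆ _ → mk⇔ only λ where
          (inj₁ (c , refl)) → WeaklyPartitive.singleton (quotient v int) (J⊆ (x∈⁅x⁆ c))
          (inj₂ refl)       → WeaklyPartitive.whole (quotient v int) }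

  UnionOfComponents : ∀ v (o : List Vertex) → Subset (length o) → Fin n → Set
  UnionOfComponents v o I x = ∃ λ i → i ∈ I × Star (_-node_ v) (lookup o i) (leaf x)

  -- The body of `Described` with kind and order as free arguments, so that it can be studied before
  -- the labelling exists.
  DescribedAt : ∀ v → Kind → (o : List Vertex) → Subset (length o) → Bipartition n → Set
  DescribedAt v κ o I b =
    1 ℕ.≤ ∣ I ∣ × ∣ I ∣ ℕ.< length o × Admissible κ I ×
    ((∀ x → x ∈ part b ⇔ UnionOfComponents v o I x) ⊎
     (∀ x → x ∈ ∁ (part b) ⇔ UnionOfComponents v o I x))

  -- Every vertex gets a kind and an order: the proof in `InternalNode` is irrelevant, so no data
  -- can be computed from it. In `described⁻` it serves only to refute the case of a leaf.
  record Labelling (v : Vertex) : Set where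
    field
      kind       : Kind
      order      : List Vertex
      order-↭    : order ↭ neighbours v
      described⁻ : .(¬ Leaf v) → ∀ b I → DescribedAt v kind order I b → 𝓑 b
      described⁺ : Internal v → ∀ b J → J ⊆ children v → union J ≡ side b → 𝓑 b →
                   ∃ λ I → DescribedAt v kind order I b

  equal : ∀ {A B : Subset n} {P : Fin n → Set} → (∀ x → x ∈ A ⇔ P x) → (∀ x → P x ⇔ x ∈ B) → A ≡ B
  equal h g = ⊆-antisym (λ {x} x∈ → Equivalence.to (g x) (Equivalence.to (h x) x∈))
                        (λ {x} x∈ → Equivalence.from (h x) (Equivalence.from (g x) x∈))

  ∁-swap : ∀ {A B : Subset n} → A ≡ ∁ B → ∁ A ≡ B
  ∁-swap refl = ∁-involutive _

  either-part : ∀ b {P : Fin n → Set} →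
    (∀ x → x ∈ side b ⇔ P x) ⊎ (∀ x → x ∈ ∁ (side b) ⇔ P x) →
    (∀ x → x ∈ part b ⇔ P x) ⊎ (∀ x → x ∈ ∁ (part b) ⇔ P x)
  either-part b h with side-part b
  ... | inj₁ eq rewrite eq = h
  ... | inj₂ eq rewrite eq | ∁-involutive (part b) = swap h

  module _ {v : Vertex} (int : Internal v) where

    open Arrangement (arrange int) renaming (kind to κ; list to cs)

    private
      p : Vertex
      p = proj₁ (parent {v} (proj₁ int))

      v⋖p : set v ⋖ set p
      v⋖p = proj₂ (parent {v} (proj₁ int))

      o : List Vertex
      o = p ∷ cs

    child-at : ∀ j → lookup cs j ∈ children v
    child-at j = Equivalence.to (∈-list _) (∈-lookup j)

    index-of : ∀ {c} → c ∈ children v → ∃ λ j → lookup cs j ≡ c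
    index-of c∈ = let c∈cs = Equivalence.from (∈-list _) c∈ in Any.index c∈cs , sym (lookup-index c∈cs)

    arrangement-↭ : o ↭ neighbours v
    arrangement-↭ = unique-↭
      (All.tabulate (λ c∈ p≡c → ⋖⇒⊈ v⋖p (proj₁ (proj₁ (∈-children⁻ v
        (subst (_∈ children v) (sym p≡c) (Equivalence.to (∈-list _) c∈)))))) ∷ unique)
      (neighbours-unique v)
      (mk⇔ (λ { (here refl) → ∈-neighbours⁺ {v} (inj₁ v⋖p)
              ; (there c∈)  → ∈-neighbours⁺ {v} (inj₂ (∈-children⁻ v (Equivalence.to (∈-list _) c∈))) })
           (λ u∈ → [ (λ v⋖u → here (parent-unique v⋖u v⋖p))
                   , (λ u⋖v → there (Equivalence.from (∈-list _) (∈-children⁺ v u⋖v))) ]′ (∈-neighbours⁻ {v} u∈)))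

    image-⊆ : ∀ {I} → image cs I ⊆ children v
    image-⊆ c∈ = let i , _ , eq = ∈-image⁻ cs c∈ in subst (_∈ children v) eq (child-at i)

    child-component : ∀ {c x} → c ∈ children v → Star (_-node_ v) c (leaf x) ⇔ x ∈ set c
    child-component c∈ = mk⇔
      (λ s → leaf⊆⁻ (stays-below (∈-children⁻ v c∈) s (λ z → z)))
      (λ x∈c → below-component (∈-children⁻ v c∈) (leaf⊆⁺ (⋖⇒r∉ (∈-children⁻ v c∈)) x∈c))

    parent-component : ∀ {x} → Star (_-node_ v) p (leaf x) ⇔ x ∉ set v
    parent-component = mk⇔
      (λ s x∈v → stays-outside v⋖p s (⋖⇒⊈ v⋖p) (leaf⊆⁺ (proj₁ int) x∈v))
      (λ x∉v → outside-component v⋖p (λ x⊆v → x∉v (leaf⊆⁻ x⊆v)))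

    components-without-parent : ∀ I x → UnionOfComponents v o (false ∷ I) x ⇔ x ∈ union (image cs I)
    components-without-parent I x = mk⇔
      (λ { (suc j , Vec.there j∈ , s) →
           ∈-union⁺ (∈-image⁺ cs j∈) (Equivalence.to (child-component (child-at j)) s) })
      (λ x∈ → let c , c∈ , x∈c = ∈-union⁻ x∈
                  j , j∈ , eq  = ∈-image⁻ cs c∈
              in suc j , Vec.there j∈ ,
                 Equivalence.from (child-component (child-at j)) (subst (λ c → x ∈ set c) (sym eq) x∈c))

    -- The parent's component is everything outside `set v`; choosing it with some children leaves
    -- out exactly the other children.
    components-with-parent : ∀ I x → UnionOfComponents v o (true ∷ I) x ⇔ x ∈ ∁ (union (image cs (∁ I)))
    components-with-parent I x = mk⇔ to from
      where
      to : UnionOfComponents v o (true ∷ I) x → x ∈ ∁ (union (image cs (∁ I)))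
      to (zero , _ , s) = x∉p⇒x∈∁p λ x∈ → Equivalence.to parent-component s (union-⊆ v image-⊆ x∈)
      to (suc j , Vec.there j∈ , s) = x∉p⇒x∈∁p (union-∌ v image-⊆ (child-at j)
        (λ c∈ → let i , i∈ , eq = ∈-image⁻ cs c∈ in
                x∈∁p⇒x∉p i∈ (subst (_∈ I) (sym (lookup-injective unique eq)) j∈))
        (Equivalence.to (child-component (child-at j)) s))
      from : x ∈ ∁ (union (image cs (∁ I))) → UnionOfComponents v o (true ∷ I) x
      from x∈∁ with x ∈? set v
      ... | no x∉v = zero , Vec.here , Equivalence.from parent-component x∉v
      ... | yes x∈v with childᵥ int x∈v
      ...   | c , c⋖v , x∈c with index-of (∈-children⁺ v c⋖v)
      ...     | j , refl with j ∈? I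
      ...       | yes j∈ = suc j , Vec.there j∈ , Equivalence.from (child-component (child-at j)) x∈c
      ...       | no j∉  = contradiction (∈-union⁺ (∈-image⁺ cs (x∉p⇒x∈∁p j∉)) x∈c) (x∈∁p⇒x∉p x∈∁)

    image-all : image cs (∁ Subset.⊥) ≡ children v
    image-all = ⊆-antisym image-⊆ λ c∈ → let j , eq = index-of c∈ in
      subst (_∈ image cs (∁ Subset.⊥)) eq (∈-image⁺ cs (x∉p⇒x∈∁p ∉⊥))

    image-singleton : ∀ j → image cs ⁅ j ⁆ ≡ ⁅ lookup cs j ⁆
    image-singleton j = ⊆-antisym
      (λ c∈ → let i , i∈ , eq = ∈-image⁻ cs c∈ in
        subst (_∈ ⁅ lookup cs j ⁆) (trans (cong (lookup cs) (sym (x∈⁅y⁆⇒x≡y j i∈))) eq) (x∈⁅x⁆ _))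
      (⁅⁆-⊆ (∈-image⁺ cs (x∈⁅x⁆ j)))

    image-preimage : ∀ {J} → J ⊆ children v → image cs (preimage cs J) ≡ J
    image-preimage {J} J⊆ = ⊆-antisym
      (λ c∈ → let i , i∈ , eq = ∈-image⁻ cs c∈ in subst (_∈ J) eq (∈-preimage⁻ cs i∈))
      (λ c∈ → let j , eq = index-of (J⊆ c∈) in
        subst (_∈ image cs (preimage cs J)) eq (∈-image⁺ cs (∈-preimage⁺ cs (subst (_∈ J) (sym eq) c∈))))

    image-nonempty : ∀ {I} → Nonempty I → Nonempty (image cs I)
    image-nonempty (i , i∈) = lookup cs i , ∈-image⁺ cs i∈

    admissible-without-parent : ∀ κ′ I → Admissible κ′ (false ∷ I) → ChildrenAdmissible v κ′ cs (image cs I)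
    admissible-without-parent complete I _ = tt
    admissible-without-parent circular I i = let _ , _ , h = interval-tail i in halfOpen⇒segment cs h
    admissible-without-parent prime .(⁅ j ⁆) (suc j , refl) = inj₁ (lookup cs j , image-singleton j)

    admissible-with-parent : ∀ κ′ I → Admissible κ′ (true ∷ I) → ChildrenAdmissible v κ′ cs (image cs (∁ I))
    admissible-with-parent complete I _ = tt
    -- An interval through position 0 is initial, so the children left out form a final segment.
    admissible-with-parent circular I i = let _ , _ , h = interval-∁tail i in halfOpen⇒segment cs h
    admissible-with-parent prime .Subset.⊥ (zero , refl) = inj₂ image-all

    admissible⇒F : ∀ {J} → J ⊆ children v → Nonempty J → ChildrenAdmissible v κ cs J → F (union J)
    admissible⇒F J⊆ ne adm = proj₂ (proj₂ (Equivalence.from (admissible J⊆ ne) adm))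

    described⇒𝓑 : ∀ b I → DescribedAt v κ o I b → 𝓑 b
    described⇒𝓑 b (false ∷ I) (0<∣I∣ , _ , adm , h) = F⇒𝓑 ([
      (λ h → inj₁ (subst F (sym (equal h (components-without-parent I))) f)) ,
      (λ h → inj₂ (subst F (sym (equal h (components-without-parent I))) f)) ]′ h)
      where
      f : F (union (image cs I))
      f = admissible⇒F image-⊆ (image-nonempty (∣p∣>0⇒nonempty 0<∣I∣)) (admissible-without-parent κ I adm)
    described⇒𝓑 b (true ∷ I) (_ , ∣I∣<k , adm , h) = F⇒𝓑 ([
      (λ h → inj₂ (subst F (sym (∁-swap (equal h (components-with-parent I)))) f)) ,
      (λ h → inj₁ (subst F (sym (trans (sym (∁-involutive _)) (∁-swap (equal h (components-with-parent I))))) f)) ]′ h)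
      where
      f : F (union (image cs (∁ I)))
      -- Position 0 is chosen, so the strict upper bound on the size leaves some child unchosen.
      f = admissible⇒F image-⊆ (image-nonempty (∣p∣<n⇒∁-nonempty (ℕ.s<s⁻¹ ∣I∣<k))) (admissible-with-parent κ I adm)

    parent-admissible : ∀ κ′ → Admissible κ′ (true ∷ Subset.⊥ {length cs})
    parent-admissible complete = tt
    parent-admissible circular = zero , zero , λ where
      zero    → mk⇔ (λ _ → ℕ.z≤n , ℕ.z≤n) (λ _ → Vec.here)
      (suc i) → mk⇔ (λ { (Vec.there i∈) → contradiction i∈ ∉⊥ }) λ { (_ , ()) }
    parent-admissible prime = zero , refl

    children-admissible : ∀ κ′ J → J ⊆ children v → Nonempty J → J ≢ children v →
                          ChildrenAdmissible v κ′ cs J → Admissible κ′ (false ∷ preimage cs J)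
    children-admissible complete J J⊆ ne J≢ _ = tt
    children-admissible circular J J⊆ (c , c∈J) J≢ seg with segment⇒halfOpen cs unique seg | index-of (J⊆ c∈J)
    ... | a , b , b≤k , h | j , refl = tail-interval (j , ∈-preimage⁺ cs c∈J) b≤k h
    children-admissible prime J J⊆ ne J≢ (inj₂ eq) = contradiction eq J≢
    children-admissible prime .(⁅ c ⁆) J⊆ ne J≢ (inj₁ (c , refl)) with index-of (J⊆ (x∈⁅x⁆ c))
    ... | j , refl = suc j , cong (false ∷_) (⊆-antisym
      (λ i∈ → subst (_∈ ⁅ j ⁆) (sym (lookup-injective unique (x∈⁅y⁆⇒x≡y _ (∈-preimage⁻ cs i∈)))) (x∈⁅x⁆ j))
      (⁅⁆-⊆ (∈-preimage⁺ cs (x∈⁅x⁆ _))))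

    -- If `J` consists of all children, `b` belongs to the edge to the parent and is described by
    -- position 0 alone, which every kind admits. Otherwise the positions of `J` serve, shifted by
    -- one.
    𝓑⇒described : ∀ b J → J ⊆ children v → union J ≡ side b → 𝓑 b → ∃ λ I → DescribedAt v κ o I b
    𝓑⇒described b J J⊆ eq ∈𝓑 with J ≟ₛ children v
    ... | yes refl = true ∷ Subset.⊥ ,
      ∣p∣>0 {I = true ∷ Subset.⊥ {length cs}} (zero , Vec.here) ,
      ∣p∣<n {I = true ∷ Subset.⊥ {length cs}} (suc j , Vec.there (x∉p⇒x∈∁p ∉⊥)) ,
      parent-admissible κ ,
      either-part b (inj₂ λ x → mk⇔
        (λ x∈ → Equivalence.from (components-with-parent Subset.⊥ x) (subst (λ A → x ∈ ∁ A) (sym eq′) x∈))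
        (λ u → subst (λ A → x ∈ ∁ A) eq′ (Equivalence.to (components-with-parent Subset.⊥ x) u)))
      where
      j : Fin (length cs)
      j = proj₁ (index-of (proj₂ (children-nonempty v int)))
      eq′ : union (image cs (∁ Subset.⊥)) ≡ side b
      eq′ = trans (cong union image-all) eq
    ... | no J≢ = false ∷ preimage cs J ,
      ∣p∣>0 {I = false ∷ preimage cs J} (suc (proj₁ some) , Vec.there (proj₂ some)) ,
      ∣p∣<n {I = false ∷ preimage cs J} (zero , Vec.here) ,
      children-admissible κ J J⊆ ne J≢
        (Equivalence.to (admissible J⊆ ne) (J⊆ , ne , subst F (sym eq) (𝓑⇒F-side ∈𝓑))) ,
      either-part b (inj₁ λ x → mk⇔
        (λ x∈ → Equivalence.from (components-without-parent (preimage cs J) x) (subst (x ∈_) (sym eq′) x∈))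
        (λ u → subst (x ∈_) eq′ (Equivalence.to (components-without-parent (preimage cs J) x) u)))
      where
      ne : Nonempty J
      ne = let c , c∈J , _ = ∈-union⁻ (subst (proj₁ (side-nonempty b) ∈_) (sym eq) (proj₂ (side-nonempty b))) in c , c∈J
      some : Nonempty (preimage cs J)
      some = let j , at-j = index-of (J⊆ (proj₂ ne)) in j , ∈-preimage⁺ cs (subst (_∈ J) (sym at-j) (proj₂ ne))
      eq′ : union (image cs (preimage cs J)) ≡ side b
      eq′ = trans (cong union (image-preimage J⊆)) eq

  abstract
    labelling : ∀ v → Labelling v
    labelling v with leaf-or-internal v
    ... | inj₂ int = record
      { kind       = Arrangement.kind (arrange int)
      ; order      = _
      ; order-↭    = arrangement-↭ int
      ; described⁻ = λ _ → described⇒𝓑 int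
      ; described⁺ = λ _ → 𝓑⇒described int
      }
    -- Kind and order are default values here.
    ... | inj₁ (x , refl) = record
      { kind       = prime
      ; order      = neighbours v
      ; order-↭    = ↭-refl
      ; described⁻ = λ ¬leaf → ⊥-elim-irr (¬leaf (leaf-Leaf x))
      ; described⁺ = λ int → contradiction (leaf-Leaf x) (internal-¬Leaf int)
      }

  nodeLabelling : NodeLabelling tree
  nodeLabelling = record
    { kind    = λ N → Labelling.kind (labelling (value N))
    ; order   = λ N → Labelling.order (labelling (value N))
    ; order-↭ = λ N → Labelling.order-↭ (labelling (value N))
    }

  𝓑⇔Described : (∃₂ λ x y → x ≢ r × y ≢ r × x ≢ y) → ∀ b → 𝓑 b ⇔ Described tree nodeLabelling b
  𝓑⇔Described others b = mk⇔
    (λ ∈𝓑 → let v , int , J , J⊆ , eq = home others (𝓑⇒F-side ∈𝓑)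
                I , described = Labelling.described⁺ (labelling v) int b J J⊆ eq ∈𝓑
            in (v , [ internal-¬Leaf int ]) , I , described)
    (λ { ((v , [ ¬leaf ]) , I , described) → Labelling.described⁻ (labelling v) ¬leaf b I described })

-- Umodules

-- `Umodule` quantifies over membership proofs but uses them only irrelevantly, so a decision made
-- for one proof holds for all; `irr` is this transfer.
Π-dec : ∀ {A : Set} {B : A → Set} → (∀ {a a′} → B a → B a′) → Dec A → (∀ a → Dec (B a)) → Dec (∀ a → B a)
Π-dec irr (no ¬a) B? = yes λ a → contradiction a ¬a
Π-dec irr (yes a) B? = map′ (λ b a′ → irr b) (λ f → f a) (B? a)

module _ (H : HomogeneousRelation n) where

  private
    M : Pred (Subset n) 0ℓ
    M = Umodule H

  Umodule? : Decidable M
  Umodule? U = all? λ u → all? λ u′ → all? λ x → all? λ x′ →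
    Π-dec (λ f → f) (u ∈? U) λ u∈ → Π-dec (λ f → f) (u′ ∈? U) λ u′∈ →
    Π-dec (λ f → f) (¬? (x ∈? U)) λ x∉ → Π-dec (λ f → f) (¬? (x′ ∈? U)) λ x′∉ →
    map′ (λ (f , g) → mk⇔ f g) (λ e → Equivalence.to e , Equivalence.from e)
      ((T? _ →-dec T? _) ×-dec (T? _ →-dec T? _))

  umodule-singleton : ∀ x → M ⁅ x ⁆
  umodule-singleton x u u′ y y′ u∈ u′∈ y∉ y′∉
    with refl ← x∈⁅y⁆⇒x≡y x u∈ | refl ← x∈⁅y⁆⇒x≡y x u′∈ = mk⇔ (λ h → h) (λ h → h)

  -- The common point `z` mediates: each element of the union agrees with `z` on all outside pairs,
  -- through `A` or through `B`.
  umodule-∪ : ∀ {A B z} → z ∈ A → z ∈ B → M A → M B → M (A ∪ B)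
  umodule-∪ {A} {B} {z} z∈A z∈B mA mB u u′ x x′ u∈ u′∈ x∉ x′∉ =
    mk⇔ (Equivalence.from (pivot u′ u′∈) ∘ Equivalence.to (pivot u u∈))
        (Equivalence.from (pivot u u∈) ∘ Equivalence.to (pivot u′ u′∈))
    where
    pivot : ∀ w w∈ → _ ⇔ _
    pivot w w∈ with x∈p∪q⁻ A B w∈
    ... | inj₁ w∈A = mA w z x x′ w∈A z∈A (x∉ ∘ x∈p∪q⁺ ∘ inj₁) (x′∉ ∘ x∈p∪q⁺ ∘ inj₁)
    ... | inj₂ w∈B = mB w z x x′ w∈B z∈B (x∉ ∘ x∈p∪q⁺ ∘ inj₂) (x′∉ ∘ x∈p∪q⁺ ∘ inj₂)

-- The umodules avoiding a root

module Decomposition (H : HomogeneousRelation n) (r : Fin n)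
  (M-∁ : SelfComplemented (Umodule H)) (2≤n : 2 ≤ n) where

  private
    M : Pred (Subset n) 0ℓ
    M = Umodule H

  UmoduleAvoiding : Pred (Subset n) 0ℓ
  UmoduleAvoiding A = M A × r ∉ A × Nonempty A

  weaklyPartitive : WeaklyPartitive (∁ ⁅ r ⁆) UmoduleAvoiding
  weaklyPartitive = record
    { F?        = λ A → Umodule? H A ×-dec ¬? (r ∈? A) ×-dec nonempty? A
    ; F⇒⊆       = λ (_ , r∉A , _) x∈A → x∉p⇒x∈∁p λ x∈r → r∉A (subst (_∈ _) (x∈⁅y⁆⇒x≡y r x∈r) x∈A)
    ; nonempty  = proj₂ ∘ proj₂
    ; singleton = λ {x} x∈∁ → umodule-singleton H x ,
        (λ r∈x → x∈∁p⇒x∉p x∈∁ (subst (_∈ ⁅ r ⁆) (x∈⁅y⁆⇒x≡y x r∈x) (x∈⁅x⁆ r))) , x , x∈⁅x⁆ x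
    ; whole     = M-∁ _ (umodule-singleton H r) , (λ r∈ → x∈∁p⇒x∉p r∈ (x∈⁅x⁆ r)) , other r 2≤n
    ; ∪-closed  = λ {A} {B} (mA , r∉A , x , x∈A) (mB , r∉B , _) ((z , z∈A , z∈B) , _) →
        umodule-∪ H z∈A z∈B mA mB , [ r∉A , r∉B ]′ ∘ x∈p∪q⁻ A B , x , x∈p∪q⁺ (inj₁ x∈A)
    -- The complements of `A` and `B` meet in `r`, so their union is a umodule; its complement is
    -- the intersection.
    ; ∩-closed  = λ {A} {B} (mA , r∉A , _) (mB , r∉B , _) ((z , z∈) , _) →
        subst M (⊆-antisym
            (λ x∈ → let x∉ = x∈∁p⇒x∉p x∈ in x∈p∩q⁺
              (x∉∁p⇒x∈p (x∉ ∘ x∈p∪q⁺ ∘ inj₁) , x∉∁p⇒x∈p (x∉ ∘ x∈p∪q⁺ ∘ inj₂)))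
            (λ x∈ → let x∈A , x∈B = x∈p∩q⁻ A B x∈ in x∉p⇒x∈∁p
              ([ (λ x∈∁ → x∈∁p⇒x∉p x∈∁ x∈A) , (λ x∈∁ → x∈∁p⇒x∉p x∈∁ x∈B) ]′ ∘ x∈p∪q⁻ (∁ A) (∁ B))))
          (M-∁ _ (umodule-∪ H (x∉p⇒x∈∁p r∉A) (x∉p⇒x∈∁p r∉B) (M-∁ A mA) (M-∁ B mB))) ,
        r∉A ∘ proj₁ ∘ x∈p∩q⁻ A B , z , x∈p∩q⁺ z∈
    -- The difference is the complement of `∁ A ∪ B`, whose two parts meet in the point `b` that the
    -- overlap supplies.
    ; ─-closed  = λ {A} {B} (mA , r∉A , _) (mB , r∉B , _) (_ , (a , a∈A , a∉B) , (b , b∈B , b∉A)) →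
        subst M (⊆-antisym
            (λ x∈ → let x∉ = x∈∁p⇒x∉p x∈ in ∈∩∁⁺
              (x∉∁p⇒x∈p (x∉ ∘ x∈p∪q⁺ ∘ inj₁)) (x∉ ∘ x∈p∪q⁺ ∘ inj₂))
            (λ x∈ → let x∈A , x∉B = ∈∩∁⁻ x∈ in x∉p⇒x∈∁p
              ([ (λ x∈∁ → x∈∁p⇒x∉p x∈∁ x∈A) , x∉B ]′ ∘ x∈p∪q⁻ (∁ A) B)))
          (M-∁ _ (umodule-∪ H (x∉p⇒x∈∁p b∉A) b∈B (M-∁ A mA) mB)) ,
        r∉A ∘ proj₁ ∘ ∈∩∁⁻ , a , ∈∩∁⁺ a∈A a∉B
    }
    where
    other : ∀ {n} (r : Fin n) → 2 ≤ n → Nonempty (∁ ⁅ r ⁆)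
    other zero    (s≤s (s≤s z≤n)) = suc zero , x∉p⇒x∈∁p (x≢y⇒x∉⁅y⁆ {y = zero} λ ())
    other (suc r) (s≤s (s≤s z≤n)) = zero , x∉p⇒x∈∁p (x≢y⇒x∉⁅y⁆ {y = suc r} λ ())

  open Bipartition

  𝓑⇒F : ∀ {b} → bipartitions M b → UmoduleAvoiding (part b) ⊎ UmoduleAvoiding (∁ (part b))
  𝓑⇒F {b} (c , mc , b≈c) with r ∈? part b
  ... | no r∉  = inj₁ (umodule b≈c , r∉ , part-nonempty b)
    where
    umodule : b ≈ c → M (part b)
    umodule (inj₁ eq) = subst M (sym eq) mc
    umodule (inj₂ eq) = subst M (sym eq) (M-∁ _ mc)
  ... | yes r∈ = inj₂ (umodule b≈c , x∈p⇒x∉∁p r∈ , ∁part-nonempty b)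
    where
    umodule : b ≈ c → M (∁ (part b))
    umodule (inj₁ eq) = subst (M ∘ ∁) (sym eq) (M-∁ _ mc)
    umodule (inj₂ eq) = subst M (sym (trans (cong ∁ eq) (∁-involutive _))) mc

  F⇒𝓑 : ∀ {b} → UmoduleAvoiding (part b) ⊎ UmoduleAvoiding (∁ (part b)) → bipartitions M b
  F⇒𝓑 {b} (inj₁ (m , _)) = b , m , inj₁ refl
  F⇒𝓑 {b} (inj₂ (m , _)) = b , subst M (∁-involutive _) (M-∁ _ m) , inj₁ refl

  private
    𝓑 : Pred (Bipartition n) 0ℓ
    𝓑 = bipartitions M

  open Tree r weaklyPartitive public using (tree)
  open TreeEdges r weaklyPartitive 𝓑 (λ {b} → 𝓑⇒F {b}) (λ {b} → F⇒𝓑 {b}) public using (edgesAreStrong)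
  open Uniqueness r weaklyPartitive 𝓑 (λ {b} → 𝓑⇒F {b}) (λ {b} → F⇒𝓑 {b}) public using (isomorphic)
  open Size r weaklyPartitive public using (size≤)
  open Description r weaklyPartitive 𝓑 (λ {b} → 𝓑⇒F {b}) (λ {b} → F⇒𝓑 {b}) public using (nodeLabelling; 𝓑⇔Described)

corollary1 : ∃ λ (C : ℕ) →
    ∀ (n : ℕ) → 3 ≤ n →
    (H : HomogeneousRelation n) →
    SelfComplemented (Umodule H) →
    let 𝓑 = bipartitions (Umodule H) in
    Σ (LabelledTree n) λ t →
    EdgesAreStrong t 𝓑 ×
    (∀ (t′ : LabelledTree n) → EdgesAreStrong t′ 𝓑 → t ≅ t′) ×
    LabelledTree.size t ≤ C * n ×
    (Σ (NodeLabelling t) λ L → ∀ b → 𝓑 b ⇔ Described t L b)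
corollary1 = 4 , λ where
  n (s≤s (s≤s (s≤s z≤n))) H M-∁ →
    -- Any element can be the root; two further ones are needed for `home` to find an internal node.
    let open Decomposition H zero M-∁ (s≤s (s≤s z≤n)) in
    tree , edgesAreStrong , isomorphic , size≤ , nodeLabelling ,
    𝓑⇔Described (suc zero , suc (suc zero) , (λ ()) , (λ ()) , λ ())
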